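{- Let $u$ be an odd prime and let $(x,y,z,n)$ be an exceptional solution of $[(u^2-4)n]^x+(4un)^y=[(u^2+4)n]^z$, with associated decomposition $u^2-4=u_1u_2$ (as defined in the context). Then one of the following holds: (1) $\nu_2(u_1-1)=3$; $x$ is odd, $\nu_2(y)\ge 2$, $\nu_2(z)=1$; and $u_1=t_1t_2$ for coprime integers $t_1,t_2>1$ with $t_1\equiv t_2\equiv 5\pmod 8$ satisfying $t_2^x+t_1^x=2(u^2+4)^{z/2}$ and $t_2^x-t_1^x=2^{y+1}u^{y/2}n^{(y-z)/2}$. (2) $u_1\equiv 5\pmod 8$ and $u_2=w^{2^s}$ for a positive integer $w$, where $s=\nu_2(z-x)-\nu_2(x)$, and one of the following holds: (2.1) $w\equiv \pm 3\pmod 8$; $x$ and $z$ are odd and $\nu_2(y)\ge 1$; $u\equiv 1\pmod 4$; $\left(\frac{u_1}{p}\right)=\left(\frac{w}{p}\right)$ for every prime $p\mid u^2+4$, and $\left(\frac{w}{p}\right)=\left(\frac{u^2+4}{p}\right)$ for every prime $p\mid u_1$; (2.2) $w\equiv \pm 1\pmod 8$; $\nu_2(x)=\nu_2(z)=\beta$ for some $\beta\ge 1$ and $y$ is odd; $u\equiv \pm 3\pmod 8$; $\left(\frac{w}{p}\right)=1$ for every prime $p\mid u^2+4$, and $\left(\frac{w}{p}\right)=\left(\frac{u}{p}\right)$ for every prime $p\mid u_1$; moreover, if $u\equiv 3\pmod 8$, then $w$ is not a perfect square.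
   Context: Let $u$ be an odd prime. Consider the equation $[(u^2-4)n]^x+(4un)^y=[(u^2+4)n]^z$ in positive integers $x,y,z,n$. A solution is exceptional if $n>1$ and $(x,y,z)\neq(2,2,2)$. It is known that every exceptional solution satisfies $y>z>x$; moreover $\gcd(n,u^2+4)=1$ and there are unique coprime positive integers $u_1,u_2$ with $u_1u_2=u^2-4$, $(u^2+4)^z-(4u)^yn^{y-z}=u_1^x$ and $n^{z-x}=u_2^x$ (the associated decomposition). $\nu_2(t)$ denotes the exponent of $2$ in $t$; $\left(\frac{\cdot}{p}\right)$ is the Legendre symbol. -}

module Defs where

open import Data.Nat using (ℕ; zero; suc; _*_; _^_; _%_)
open import Data.Nat.Divisibility using (_∣_; _∣?_)
open import Data.Fin using (Fin; toℕ)
open import Data.Fin.Properties using (any?)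
open import Data.Integer using (ℤ; 0ℤ; 1ℤ; -1ℤ)
open import Data.Product using (_×_)
open import Relation.Nullary using (¬_; yes; no)
open import Relation.Binary.PropositionalEquality using (_≡_)
import Data.Nat.Properties as ℕP

-- ν₂ t ≡ₑ k : the exponent of 2 in t is exactly k (2^k ∣ t and 2^(k+1) ∤ t).
-- For t = 0 no k satisfies this (ν₂(0) is not a natural number).
V₂ : ℕ → ℕ → Set
V₂ t k = (2 ^ k ∣ t) × ¬ (2 ^ suc k ∣ t)

legendre : ℕ → ℕ → ℤ
legendre a zero = 0ℤ
legendre a (suc q) with suc q ∣? a
... | yes _ = 0ℤ
... | no _ with any? (λ (x : Fin (suc q)) → (toℕ x * toℕ x) % suc q ℕP.≟ a % suc q)
...   | yes _ = 1ℤ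
...   | no _ = -1ℤ

-- Since C = u² + 4 is 8 modulo every divisor t of u² − 4 and 5 modulo 8, reciprocity gives (t/C) = (2/t); moreover −4 and
-- 4u are squares modulo C. Reading C^z = u₁^x + (4u)^y n^(y−z) modulo C, u₁, u and 8 ties the parities of x, y and z to the
-- classes of u₁, u₂ and n modulo 8. For even x the difference of squares C^z − u₁^x has the factors 2·4^(y−1) n₁^(y−z) and
-- 2 u^y n₂^(y−z) with n₁ n₂ = n, and their symbols settle everything. For odd x and even z the right-hand side of
-- u₁^x = C^z − D² splits into two x-th powers. If 4 divides z the splitting can be repeated until T^x = C^2Z + E² with Z odd
-- and T dividing C − 8: modulo T the number C ≡ 8 is a quartic residue, but its quartic character is (2/C) = −1. This last
-- contradiction is derived over ℚ from quadratic symbols at a point of the conic e² = 2C f² + T g².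

module Submission where

open import Data.Nat.Coprimality as Cop using (Coprime)
open import Data.Product using (_,_; ∃; proj₁; proj₂; _×_; Σ; ∃-syntax)
open import Data.Sum using (_⊎_; inj₁; inj₂; [_,_]′)
open import Data.Empty using (⊥-elim; ⊥)
open import Relation.Nullary using (¬_; yes; no; contradiction)
open import Relation.Binary.PropositionalEquality hiding (J)
open import Function using (_∘_; _$_)
open import Relation.Binary.Definitions using (tri<; tri≈; tri>; Tri)
open import Data.Nat.Primality using (Prime; euclidsLemma; prime⇒nonTrivial; prime⇒irreducible; prime⇒nonZero)
open import Data.Nat.Induction using (<-rec)
import Data.Nat.Properties as ℕP
import Data.Integer.Properties as ℤP

-- The symbols are taken modulo composite numbers such as `C`, `u₁` and divisors of `n`, whose prime
-- factors are unknown. So `J` is built for every odd modulus from signs of balanced residues, and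
-- reciprocity is proved at that level. The Legendre symbols of the conclusion are reached from
-- another side: relations up to squares of units are kept as `SquareClass`, which can be read as an
-- equality of `J` at the whole modulus and as an equality of `legendre` at each prime divisor.
--
-- The obstacle is `4 ∣ z` in case (1). A quartic symbol would call for Gaussian integers and prime
-- moduli. Here a rational point of a conic attached to the square-free parts of `C` and `T`
-- replaces it: the integer factorisation `w w̄ = C S` plays the role of one in the Gaussian
-- integers. A pigeonhole box yields some point, but the symbols used afterwards may vanish when `f`
-- shares a prime with `C`. Therefore the point is rotated until `f` is prime to `C`, and then made
-- pairwise coprime, which square-freeness of the two coefficients permits.

module JacobiSymbol where

  open import Data.Nat as ℕ using (ℕ; zero; suc; z≤n; s≤s; _%_; _/_)
  open import Data.Integer as ℤ using (ℤ; +_; -[1+_]; +[1+_]; _+_; _*_; _-_; -_; ∣_∣; 0ℤ; 1ℤ; -1ℤ; _^_)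
  open import Data.Integer.DivMod using (_%ℕ_; _/ℕ_; n%ℕd<d; a≡a%ℕn+[a/ℕn]*n)
  open import Data.Integer.Tactic.RingSolver using (solve-∀)
  open import Data.Fin using (Fin; zero; suc; toℕ; fromℕ<; opposite)
  open import Data.Fin.Permutation as Perm using (Permutation; permutation)
  open import Data.Nat.DivMod using (m≡m%n+[m/n]*n; m%n<n; [m+kn]%n≡m%n)
  import Data.Nat.Divisibility as ℕD
  import Data.Nat.GCD as ℕG
  import Data.Fin.Properties as FinP
  import Data.Nat.Tactic.RingSolver as ℕR
  open import Algebra.Properties.CommutativeMonoid.Sum ℤP.*-1-commutativeMonoid using () renaming (sum to ∏; sum-cong-≗ to ∏-cong; ∑-distrib-+ to ∏-distrib; ∑-comm to ∏-comm; sum-permute to ∏-permute)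

  -- Congruences, signs and balanced residues modulo an odd number

  record Cong (n : ℕ) (a b : ℤ) : Set where
    constructor by
    field
      quotient : ℤ
      equation : a ≡ b + quotient * + n

  cong-refl : ∀ {n a} → Cong n a a
  cong-refl {n} {a} = by (0ℤ) $ lem a (+ n)
    where lem : ∀ a n → a ≡ a + 0ℤ * n
          lem = solve-∀

  cong-sym : ∀ {n a b} → Cong n a b → Cong n b a
  cong-sym {n} {a} {b} (by q refl) = by (- q) $ lem b q (+ n)
    where lem : ∀ b q n → b ≡ (b + q * n) + (- q) * n
          lem = solve-∀

  cong-trans : ∀ {n a b c} → Cong n a b → Cong n b c → Cong n a c
  cong-trans {n} {a} {b} {c} (by q refl) (by r refl) = by (q + r) $ lem c q r (+ n)
    where lem : ∀ c q r n → c + r * n + q * n ≡ c + (q + r) * n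
          lem = solve-∀

  cong-* : ∀ {n a b c d} → Cong n a b → Cong n c d → Cong n (a * c) (b * d)
  cong-* {n} {a} {b} {c} {d} (by q refl) (by r refl) = by (q * d + b * r + q * r * + n) $ lem b q d r (+ n)
    where lem : ∀ b q d r n → (b + q * n) * (d + r * n) ≡ b * d + (q * d + b * r + q * r * n) * n
          lem = solve-∀

  cong-+ : ∀ {n a b c d} → Cong n a b → Cong n c d → Cong n (a + c) (b + d)
  cong-+ {n} {a} {b} {c} {d} (by q refl) (by r refl) = by (q + r) $ lem b q d r (+ n)
    where lem : ∀ b q d r n → (b + q * n) + (d + r * n) ≡ b + d + (q + r) * n
          lem = solve-∀

  cong-neg : ∀ {n a b} → Cong n a b → Cong n (- a) (- b)
  cong-neg {n} {a} {b} (by q refl) = by (- q) $ lem b q (+ n)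
    where lem : ∀ b q n → - (b + q * n) ≡ - b + (- q) * n
          lem = solve-∀

  cong-≡ : ∀ {n a b} → a ≡ b → Cong n a b
  cong-≡ refl = cong-refl

  -- sgn takes the value 0 at 0, unlike the two-valued sign of the library.
  sgn : ℤ → ℤ
  sgn (+ zero)  = 0ℤ
  sgn +[1+ _ ]  = 1ℤ
  sgn -[1+ _ ]  = -1ℤ

  data Trit : ℤ → Set where
    t0 : Trit 0ℤ
    t+ : Trit 1ℤ
    t- : Trit -1ℤ

  sgn-trit : ∀ a → Trit (sgn a)
  sgn-trit (+ zero) = t0
  sgn-trit +[1+ _ ] = t+
  sgn-trit -[1+ _ ] = t-

  sgn-* : ∀ a b → sgn (a * b) ≡ sgn a * sgn b
  sgn-* (+ zero) b = refl
  sgn-* +[1+ m ] (+ zero) rewrite ℕP.*-zeroʳ m = refl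
  sgn-* +[1+ m ] +[1+ n ] = refl
  sgn-* +[1+ m ] -[1+ n ] = refl
  sgn-* -[1+ m ] (+ zero) rewrite ℕP.*-zeroʳ m = refl
  sgn-* -[1+ m ] +[1+ n ] = refl
  sgn-* -[1+ m ] -[1+ n ] = refl

  sgn-neg : ∀ a → sgn (- a) ≡ - sgn a
  sgn-neg (+ zero) = refl
  sgn-neg +[1+ _ ] = refl
  sgn-neg -[1+ _ ] = refl

  sgn-abs : ∀ a → a ≡ sgn a * + ∣ a ∣
  sgn-abs (+ zero) = refl
  sgn-abs +[1+ n ] = cong +[1+_] (sym (ℕP.+-identityʳ n))
  sgn-abs -[1+ n ] = cong -[1+_] (sym (ℕP.+-identityʳ n))

  sgn-pos : ∀ {a} → 0ℤ ℤ.< a → sgn a ≡ 1ℤ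
  sgn-pos {+[1+ _ ]} _ = refl
  sgn-pos {+ zero} (ℤ.+<+ ())

  sgn-negative : ∀ {a} → a ℤ.< 0ℤ → sgn a ≡ -1ℤ
  sgn-negative { -[1+ _ ]} _ = refl
  sgn-negative {+ _} (ℤ.+<+ ())

  trit-sgn : ∀ {s} → Trit s → sgn s ≡ s
  trit-sgn t0 = refl
  trit-sgn t+ = refl
  trit-sgn t- = refl

  odd : ℕ → ℕ
  odd h = suc (2 ℕ.* h)

  abstract
    bal : ℕ → ℤ → ℤ
    bal h a = + ((a + + h) %ℕ odd h) - + h

    bal-cong : ∀ h a → Cong (odd h) a (bal h a)
    bal-cong h a = by q $ trans (lem1 a (+ h)) (trans (cong (_- + h) (a≡a%ℕn+[a/ℕn]*n (a + + h) (odd h))) (lem2 (+ ((a + + h) %ℕ odd h)) (q * + odd h) (+ h)))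
      where
      q : ℤ
      q = (a + + h) /ℕ odd h
      lem1 : ∀ a h → a ≡ a + h - h
      lem1 = solve-∀
      lem2 : ∀ r q h → r + q - h ≡ r - h + q
      lem2 = solve-∀

    bal-bound : ∀ h a → ∣ bal h a ∣ ℕ.≤ h
    bal-bound h a with (a + + h) %ℕ odd h | n%ℕd<d (a + + h) (odd h)
    ... | r | s≤s r≤2h with ℕP.≤-total h r
    ... | inj₁ h≤r = subst (λ z → ∣ z ∣ ℕ.≤ h) (sym (trans (ℤP.m-n≡m⊖n r h) (ℤP.⊖-≥ h≤r)))
                       (ℕP.≤-trans (ℕP.∸-monoˡ-≤ h r≤2h) (ℕP.≤-reflexive (trans (cong (ℕ._∸ h) (cong (h ℕ.+_) (ℕP.+-identityʳ h))) (ℕP.m+n∸m≡n h h))))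
    ... | inj₂ r≤h = subst (λ z → ∣ z ∣ ℕ.≤ h) (sym (trans (ℤP.m-n≡m⊖n r h) (ℤP.⊖-≤ r≤h)))
                       (subst (ℕ._≤ h) (sym (ℤP.∣-i∣≡∣i∣ (+ (h ℕ.∸ r)))) (ℕP.m∸n≤m h r))

  -- Two such integers differ by at most `2h`, less than the modulus, so the quotient in their
  -- congruence is 0. This makes the balanced residue unique.
  cong-small : ∀ h b c → ∣ b ∣ ℕ.≤ h → ∣ c ∣ ℕ.≤ h → Cong (odd h) b c → b ≡ c
  cong-small h b c b≤ c≤ (by q e) = trans e (trans (cong (λ z → c + z * + odd h) {q} {0ℤ} (ℤP.∣i∣≡0⇒i≡0 q0)) (lem c (+ odd h)))
    where
    lem : ∀ c n → c + 0ℤ * n ≡ c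
    lem = solve-∀
    lem2 : ∀ c x → c + x - c ≡ x
    lem2 = solve-∀
    e2 : b - c ≡ q * + odd h
    e2 = trans (cong (_- c) e) (lem2 c (q * + odd h))
    bd : ∣ q ∣ ℕ.* odd h ℕ.≤ 2 ℕ.* h
    bd = subst (ℕ._≤ 2 ℕ.* h) (trans (cong ∣_∣ e2) (ℤP.abs-* q (+ odd h)))
           (ℕP.≤-trans (ℤP.∣i-j∣≤∣i∣+∣j∣ b c) (ℕP.≤-trans (ℕP.+-mono-≤ b≤ c≤) (ℕP.≤-reflexive (cong (h ℕ.+_) (sym (ℕP.+-identityʳ h))))))
    q0' : ∀ m → m ℕ.* odd h ℕ.≤ 2 ℕ.* h → m ≡ 0
    q0' zero _ = refl
    q0' (suc m) le = contradiction (ℕP.≤-trans (ℕP.m≤m+n (odd h) (m ℕ.* odd h)) le) ℕP.1+n≰n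
    q0 : ∣ q ∣ ≡ 0
    q0 = q0' ∣ q ∣ bd

  bal-unique : ∀ h a c → ∣ c ∣ ℕ.≤ h → Cong (odd h) a c → bal h a ≡ c
  bal-unique h a c c≤ e = cong-small h _ _ (bal-bound h a) c≤ (cong-trans (cong-sym (bal-cong h a)) e)

  bal-resp : ∀ h {a b} → Cong (odd h) a b → bal h a ≡ bal h b
  bal-resp h {a} {b} e = bal-unique h a _ (bal-bound h b) (cong-trans e (bal-cong h b))

  trit-*-bound : ∀ {s h} → Trit s → ∀ a → ∣ a ∣ ℕ.≤ h → ∣ s * a ∣ ℕ.≤ h
  trit-*-bound t0 a _ = z≤n
  trit-*-bound {h = h} t+ a le = subst (λ z → ∣ z ∣ ℕ.≤ h) (sym (ℤP.*-identityˡ a)) le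
  trit-*-bound {h = h} t- a le = subst (ℕ._≤ h) (sym (trans (cong ∣_∣ (ℤP.-1*i≡-i a)) (ℤP.∣-i∣≡∣i∣ a))) le

  -- The residue interval is symmetric about 0, so multiplication by 0, 1 or -1 commutes with
  -- reduction.
  bal-trit : ∀ h {s} → Trit s → ∀ a → bal h (s * a) ≡ s * bal h a
  bal-trit h {s} ts a = bal-unique h _ _ (trit-*-bound ts _ (bal-bound h a)) (cong-* (cong-refl {a = s}) (bal-cong h a))

  ε : ℕ → ℤ → ℤ
  ε h a = sgn (bal h a)

  res : ℕ → ℤ → ℕ
  res h a = ∣ bal h a ∣

  ε-resp : ∀ h {a b} → Cong (odd h) a b → ε h a ≡ ε h b
  ε-resp h e = cong sgn (bal-resp h e)

  ε-trit : ∀ h {s} → Trit s → ∀ a → ε h (s * a) ≡ s * ε h a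
  ε-trit h {s} ts a = trans (cong sgn (bal-trit h ts a)) (trans (sgn-* s _) (cong (_* ε h a) (trit-sgn ts)))

  ε-res : ∀ h a → Cong (odd h) a (ε h a * + res h a)
  ε-res h a = cong-trans (bal-cong h a) (cong-≡ (sgn-abs (bal h a)))

  swap* : ∀ b s c → b * (s * c) ≡ s * (b * c)
  swap* = solve-∀

  -- Replacing `a` by its sign times its absolute residue and pulling out the sign gives a cocycle
  -- rule, whose product over the half-system is the multiplicativity of the symbol.
  ε-mul : ∀ h b a → ε h (b * a) ≡ ε h a * ε h (b * + res h a)
  ε-mul h b a = trans (ε-resp h (cong-trans (cong-* (cong-refl {a = b}) (ε-res h a)) (cong-≡ (swap* b (ε h a) (+ res h a)))))
                  (ε-trit h (sgn-trit (bal h a)) (b * + res h a))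

  -- Gauss–Schering: the sign of a on the half-system {1,…,h} is the Jacobi symbol for composite moduli too, and the
  -- product vanishes when a and 2h + 1 are not coprime.
  jac : ℕ → ℤ → ℤ
  jac h a = ∏ {h} (λ i → ε h (a * + suc (toℕ i)))

  jac-resp : ∀ h {a b} → Cong (odd h) a b → jac h a ≡ jac h b
  jac-resp h {a} {b} e = ∏-cong {h} (λ i → ε-resp h (cong-* e (cong-refl {a = + suc (toℕ i)})))

  trit-* : ∀ {a b} → Trit a → Trit b → Trit (a * b)
  trit-* t0 _ = t0
  trit-* t+ t0 = t0
  trit-* t+ t+ = t+
  trit-* t+ t- = t-
  trit-* t- t0 = t0
  trit-* t- t+ = t-
  trit-* t- t- = t+

  ∏-trit : ∀ {n} (f : Fin n → ℤ) → (∀ i → Trit (f i)) → Trit (∏ f)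
  ∏-trit {zero} f t = t+
  ∏-trit {suc n} f t = trit-* (t zero) (∏-trit (f ∘ suc) (t ∘ suc))

  jac-trit : ∀ h a → Trit (jac h a)
  jac-trit h a = ∏-trit {h} _ (λ i → sgn-trit _)

  ∏-zero : ∀ {n} (f : Fin n → ℤ) i → f i ≡ 0ℤ → ∏ f ≡ 0ℤ
  ∏-zero f zero e rewrite e = refl
  ∏-zero f (suc i) e rewrite ∏-zero (f ∘ suc) i e = ℤP.*-zeroʳ (f zero)

  ∏-const : ∀ n (c : ℤ) → ∏ {n} (λ _ → c) ≡ c ^ n
  ∏-const zero c = refl
  ∏-const (suc n) c = cong (c *_) (∏-const n c)

  -- Multiplicativity in the numerator

  Inv : ℕ → ℤ → Set
  Inv n a = ∃ λ a' → Cong n (a' * a) 1ℤ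

  coprime⇒inv : ∀ a n → Coprime a n → Inv n (+ a)
  coprime⇒inv a n c with Cop.coprime-Bézout c
  ... | ℕG.Bézout.+- x y eq = + x , (by (+ y) $ trans (sym (ℤP.pos-* x a)) (trans (cong +_ (sym eq)) (trans (ℤP.pos-+ 1 (y ℕ.* n)) (cong (_+_ 1ℤ) (ℤP.pos-* y n)))))
  ... | ℕG.Bézout.-+ x y eq = - + x , (by (- + y) $ trans (lem1 (+ x) (+ a)) (trans (cong (λ z → 1ℤ - z) e2) (lem2 (+ y) (+ n))))
    where
    lem1 : ∀ x a → (- x) * a ≡ 1ℤ - (1ℤ + x * a)
    lem1 = solve-∀
    lem2 : ∀ y n → 1ℤ - y * n ≡ 1ℤ + (- y) * n
    lem2 = solve-∀
    e2 : 1ℤ + + x * + a ≡ + y * + n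
    e2 = trans (cong (_+_ 1ℤ) (sym (ℤP.pos-* x a))) (trans (sym (ℤP.pos-+ 1 (x ℕ.* a))) (trans (cong +_ eq) (ℤP.pos-* y n)))

  sgn-square : ∀ {a} → Trit a → a ≡ 0ℤ ⊎ a * a ≡ 1ℤ
  sgn-square t0 = inj₁ refl
  sgn-square t+ = inj₂ refl
  sgn-square t- = inj₂ refl

  abs-trit : ∀ {s} → Trit s → s ≢ 0ℤ → ∀ a → ∣ s * a ∣ ≡ ∣ a ∣
  abs-trit t0 n a = contradiction refl n
  abs-trit t+ n a = cong ∣_∣ (ℤP.*-identityˡ a)
  abs-trit t- n a = trans (cong ∣_∣ (ℤP.-1*i≡-i a)) (ℤP.∣-i∣≡∣i∣ a)

  res-resp : ∀ h {a b} → Cong (odd h) a b → res h a ≡ res h b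
  res-resp h e = cong ∣_∣ (bal-resp h e)

  sgn≡0 : ∀ a → sgn a ≡ 0ℤ → a ≡ 0ℤ
  sgn≡0 (+ zero) _ = refl

  -- The index of the half-system {1,…,h} hit by a residue; junk when the residue is 0.
  idx : ∀ {h} → Fin h → ℤ → Fin h
  idx {suc h} _ a with res (suc h) a | bal-bound (suc h) a
  ... | zero  | _ = zero
  ... | suc r | s≤s le = fromℕ< (s≤s le)

  idx-toℕ : ∀ {h} (i : Fin h) a → bal h a ≢ 0ℤ → suc (toℕ (idx i a)) ≡ res h a
  idx-toℕ {suc h} i a nz with res (suc h) a in eq | bal-bound (suc h) a
  ... | zero  | _ = contradiction (ℤP.∣i∣≡0⇒i≡0 eq) nz
  ... | suc r | s≤s le = cong suc (FinP.toℕ-fromℕ< (s≤s le))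

  res-small : ∀ h m → m ℕ.≤ h → bal h (+ m) ≡ + m
  res-small h m le = bal-unique h (+ m) (+ m) le cong-refl

  lem-assoc : ∀ b' b k → b' * (b * k) ≡ b' * b * k
  lem-assoc = solve-∀

  inv-cancel : ∀ {n} b b' k → Cong n (b' * b) 1ℤ → Cong n (b' * (b * k)) k
  inv-cancel b b' k e = cong-trans (cong-≡ (lem-assoc b' b k)) (cong-trans (cong-* e (cong-refl {a = k})) (cong-≡ (ℤP.*-identityˡ k)))

  inv-nonzero′ : ∀ h b b' k → Cong (odd h) (b' * b) 1ℤ → bal h k ≡ k → bal h (b * k) ≡ 0ℤ → k ≡ 0ℤ
  inv-nonzero′ h b b' k e k≡ z = trans (sym k≡) (bal-unique h k 0ℤ z≤n (cong-trans (cong-sym (inv-cancel b b' k e))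
    (cong-trans (cong-* (cong-refl {a = b'}) (cong-trans (bal-cong h (b * k)) (cong-≡ z))) (cong-≡ (ℤP.*-zeroʳ b')))))

  -- `res` forgets the sign of `b * k`. Multiplying by `b'` recovers `k` up to that sign, which is
  -- nonzero because `b` is invertible, and the outer absolute value removes it.
  res-back′ : ∀ h b b' k → Cong (odd h) (b' * b) 1ℤ → bal h k ≡ k → k ≢ 0ℤ → res h (b' * + res h (b * k)) ≡ ∣ k ∣
  res-back′ h b b' k e k≡ k≢0 = trans (sym (abs-trit (sgn-trit (bal h c)) nz (bal h (b' * + res h c))))
      (trans (cong ∣_∣ (sym (bal-trit h (sgn-trit (bal h c)) (b' * + res h c))))
      (trans (res-resp h step) (cong ∣_∣ k≡)))
    where
    c = b * k
    nz : sgn (bal h c) ≢ 0ℤ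
    nz z = k≢0 (inv-nonzero′ h b b' k e k≡ (sgn≡0 _ z))
    step : Cong (odd h) (ε h c * (b' * + res h c)) k
    step = cong-trans (cong-≡ (sym (swap* b' (ε h c) (+ res h c))))
            (cong-trans (cong-* (cong-refl {a = b'}) (cong-sym (ε-res h c))) (inv-cancel b b' k e))

  inv-nonzero : ∀ h {b b'} → Cong (odd h) (b' * b) 1ℤ → ∀ (i : Fin h) → bal h (b * + suc (toℕ i)) ≢ 0ℤ
  inv-nonzero h {b} {b'} e i z = contradiction (inv-nonzero′ h b b' (+ suc (toℕ i)) e (res-small h (suc (toℕ i)) (FinP.toℕ<n i)) z) λ ()

  res-back : ∀ h {b b'} → Cong (odd h) (b' * b) 1ℤ → ∀ (i : Fin h) →
    res h (b' * + res h (b * + suc (toℕ i))) ≡ suc (toℕ i)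
  res-back h {b} {b'} e i = res-back′ h b b' (+ suc (toℕ i)) e (res-small h (suc (toℕ i)) (FinP.toℕ<n i)) λ ()

  -- The permutation takes each member of the half-system to the absolute residue of its product
  -- with `b`; the same map for `b'` is its inverse by `res-back`.
  mulPerm : ∀ h {b b'} → Cong (odd h) (b' * b) 1ℤ → Permutation h h
  mulPerm h {b} {b'} e = permutation (f b) (f b') (inv {b'} {b} e') (inv {b} {b'} e)
    where
    f : ℤ → Fin h → Fin h
    f b i = idx i (b * + suc (toℕ i))
    e' : Cong (odd h) (b * b') 1ℤ
    e' = cong-trans (cong-≡ (ℤP.*-comm b b')) e
    inv : ∀ {b b'} → Cong (odd h) (b' * b) 1ℤ → ∀ i → f b' (f b i) ≡ i
    inv {b} {b'} e i = FinP.toℕ-injective (ℕP.suc-injective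
        (trans (idx-toℕ (f b i) _ (inv-nonzero h {b'} {b} (cong-trans (cong-≡ (ℤP.*-comm b b')) e) (f b i)))
        (trans (cong (λ z → res h (b' * + z)) (idx-toℕ i _ (inv-nonzero h {b} {b'} e i))) (res-back h {b} {b'} e i))))

  -- In the product of `ε-mul` over the half-system, the factors that contain `a` run through the
  -- half-system again, rearranged by `mulPerm`.
  jac-mul-inv : ∀ h a b → Inv (odd h) b → jac h (a * b) ≡ jac h a * jac h b
  jac-mul-inv h a b (b' , e) =
    trans (∏-cong {h} (λ i → trans (ε-resp h (cong-≡ (ℤP.*-assoc a b _))) (ε-mul h a (b * + suc (toℕ i)))))
    (trans (∏-distrib {h} (λ i → ε h (b * + suc (toℕ i))) (λ i → ε h (a * + res h (b * + suc (toℕ i)))))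
    (trans (ℤP.*-comm (jac h b) _) (cong (_* jac h b) (sym
      (trans (∏-permute (λ i → ε h (a * + suc (toℕ i))) (mulPerm h {b} {b'} e))
        (∏-cong {h} (λ i → cong (λ z → ε h (a * + z)) (idx-toℕ i _ (inv-nonzero h {b} {b'} e i)))))))))

  ∣⇒Cong0 : ∀ {n a} → n ℕD.∣ ∣ a ∣ → Cong n a 0ℤ
  ∣⇒Cong0 {n} {a} (ℕD.divides q eq) = by (sgn a * + q) $ trans (sgn-abs a) (trans (cong (λ z → sgn a * + z) eq)
    (trans (cong (sgn a *_) (ℤP.pos-* q n)) (lem (sgn a) (+ q) (+ n))))
    where lem : ∀ s q n → s * (q * n) ≡ 0ℤ + s * q * n
          lem = solve-∀

  -- If the gcd is at least 2, the modulus divided by it lies in the half-system, and its product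
  -- with `a` is 0 modulo `odd h`: one factor vanishes.
  jac-zero : ∀ h a → ¬ Coprime ∣ a ∣ (odd h) → jac h a ≡ 0ℤ
  jac-zero h a nc with ℕG.gcd ∣ a ∣ (odd h) in geq | ℕG.gcd[m,n]∣m ∣ a ∣ (odd h) | ℕG.gcd[m,n]∣n ∣ a ∣ (odd h)
  ... | zero  | _ | ℕD.divides q eq = contradiction (trans eq (ℕP.*-zeroʳ q)) λ ()
  ... | suc zero | _ | _ = ⊥-elim (nc (Cop.gcd≡1⇒coprime geq))
  ... | suc (suc d) | ℕD.divides p e1 | ℕD.divides zero ()
  ... | suc (suc d) | ℕD.divides p e1 | ℕD.divides (suc q) e2 = ∏-zero {h} _ i0 (cong sgn (bal-unique h _ 0ℤ z≤n cz))
    where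
    q<h : suc q ℕ.≤ h
    q<h = ℕP.≮⇒≥ λ h<q → ℕP.1+n≰n (ℕP.≤-trans (ℕP.*-mono-≤ {2} {suc (suc d)} (s≤s (s≤s z≤n)) h<q)
            (ℕP.≤-trans (ℕP.≤-reflexive (ℕP.*-comm (suc (suc d)) (suc q))) (ℕP.≤-trans (ℕP.≤-reflexive (sym e2)) (ℕP.≤-trans (s≤s (ℕP.≤-refl)) (lem h)))))
      where lem : ∀ h → suc (2 ℕ.* h) ℕ.≤ h ℕ.+ suc (h ℕ.+ 0)
            lem h = ℕP.≤-reflexive (sym (ℕP.+-suc h (h ℕ.+ 0)))
    i0 : Fin h
    i0 = fromℕ< q<h
    cz : Cong (odd h) (a * + suc (toℕ i0)) 0ℤ
    cz = ∣⇒Cong0 (ℕD.divides p (trans (ℤP.abs-* a _) (trans (cong₂ ℕ._*_ e1 (cong suc (FinP.toℕ-fromℕ< q<h))) (trans (ℕP.*-assoc p (suc (suc d)) (suc q)) (cong (p ℕ.*_) (trans (ℕP.*-comm (suc (suc d)) (suc q)) (sym e2)))))))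

  inv-neg : ∀ {n a} → Inv n (- a) → Inv n a
  inv-neg {n} {a} (a' , e) = - a' , cong-trans (cong-≡ (lem a' a)) e
    where lem : ∀ a' a → (- a') * a ≡ a' * (- a)
          lem = solve-∀

  abs-inv : ∀ {n a} → Inv n (+ ∣ a ∣) → Inv n a
  abs-inv {a = + m} i = i
  abs-inv {a = -[1+ m ]} i = inv-neg {a = -[1+ m ]} i

  coprime⇒Inv : ∀ {n} a → Coprime ∣ a ∣ n → Inv n a
  coprime⇒Inv {n} a c = abs-inv (coprime⇒inv ∣ a ∣ n c)

  jac-mul : ∀ h a b → jac h (a * b) ≡ jac h a * jac h b
  jac-mul h a b with Cop.coprime? ∣ b ∣ (odd h)
  ... | yes c = jac-mul-inv h a b (coprime⇒Inv b c)
  -- A common factor of `b` and the modulus also divides `a * b`, so both sides are 0.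
  ... | no nc = trans (jac-zero h (a * b) nc') (sym (trans (cong (jac h a *_) (jac-zero h b nc)) (ℤP.*-zeroʳ (jac h a))))
    where
    nc' : ¬ Coprime ∣ a * b ∣ (odd h)
    nc' c = nc (λ (d∣b , d∣n) → c (subst (_ ℕD.∣_) (sym (ℤP.abs-* a b)) (ℕD.∣n⇒∣m*n ∣ a ∣ d∣b) , d∣n))

  jac-one : ∀ h → jac h 1ℤ ≡ 1ℤ
  jac-one h = trans (∏-cong {h} (λ i → trans (cong (ε h) (ℤP.*-identityˡ (+ suc (toℕ i)))) (cong sgn (res-small h _ (FinP.toℕ<n i)))))
    (trans (∏-const h 1ℤ) (one-pow h))
    where one-pow : ∀ h → 1ℤ ^ h ≡ 1ℤ
          one-pow zero = refl
          one-pow (suc h) = trans (ℤP.*-identityˡ _) (one-pow h)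

  jac-neg1 : ∀ h → jac h -1ℤ ≡ -1ℤ ^ h
  jac-neg1 h = trans (∏-cong {h} (λ i → trans (ε-trit h t- (+ suc (toℕ i))) (cong (λ z → -1ℤ * sgn z) (res-small h _ (FinP.toℕ<n i)))))
    (∏-const h -1ℤ)

  trit-unit : ∀ {a} b → Trit a → b * a ≡ 1ℤ → a * a ≡ 1ℤ
  trit-unit b ta e with sgn-square ta
  ... | inj₂ r = r
  ... | inj₁ refl = contradiction (trans (sym (ℤP.*-zeroʳ b)) e) λ ()

  jac-sq : ∀ h a → Coprime ∣ a ∣ (odd h) → jac h a * jac h a ≡ 1ℤ
  jac-sq h a c with coprime⇒Inv a c
  ... | a' , e = trit-unit (jac h a') (jac-trit h a) (trans (sym (jac-mul h a' a)) (trans (jac-resp h e) (jac-one h)))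

  -- Reciprocity by comparison of signs

  ∏-one : ∀ {n} (f : Fin n → ℤ) → (∀ i → f i ≡ 1ℤ) → ∏ f ≡ 1ℤ
  ∏-one {zero} f e = refl
  ∏-one {suc n} f e rewrite e zero | ∏-one (f ∘ suc) (e ∘ suc) = refl

  -- ∏ over i = 1,…,2g of sgn (i n − 2 m), with the factors grouped in pairs.
  crossing : ℤ → ℤ → ℕ → ℤ
  crossing n m j = sgn ((+ 2 * + j + 1ℤ) * n - + 2 * m) * sgn ((+ 2 * + j + + 2) * n - + 2 * m)

  sgn-pos-nat : ∀ a b → a ℕ.< b → sgn (+ b - + a) ≡ 1ℤ
  sgn-pos-nat a b a<b = sgn-pos (subst (ℤ._< + b - + a) (ℤP.+-inverseʳ (+ a)) (ℤP.+-monoˡ-< (- + a) (ℤ.+<+ a<b)))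

  sgn-neg-nat : ∀ a b → b ℕ.< a → sgn (+ b - + a) ≡ -1ℤ
  sgn-neg-nat a b b<a = sgn-negative (subst (+ b - + a ℤ.<_) (ℤP.+-inverseʳ (+ a)) (ℤP.+-monoˡ-< (- + a) (ℤ.+<+ b<a)))

  lin : ∀ c n m → + c * + n - + 2 * + m ≡ + (c ℕ.* n) - + (2 ℕ.* m)
  lin c n m = cong₂ _-_ (sym (ℤP.pos-* c n)) (sym (ℤP.pos-* 2 m))

  coef1 : ∀ j → + 2 * + j + 1ℤ ≡ + (2 ℕ.* j ℕ.+ 1)
  coef1 j = cong (_+ 1ℤ) (sym (ℤP.pos-* 2 j))

  coef2 : ∀ j → + 2 * + j + + 2 ≡ + (2 ℕ.* j ℕ.+ 2)
  coef2 j = cong (_+ + 2) (sym (ℤP.pos-* 2 j))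

  crossing-shift : ∀ n m j → crossing n (n + m) (suc j) ≡ crossing n m j
  crossing-shift n m j = cong₂ (λ x y → sgn x * sgn y) (trans (cong (λ z → (+ 2 * z + 1ℤ) * n - + 2 * (n + m)) (ℤP.pos-+ 1 j)) (lem1 n m (+ j)))
     (trans (cong (λ z → (+ 2 * z + + 2) * n - + 2 * (n + m)) (ℤP.pos-+ 1 j)) (lem2 n m (+ j)))
    where
    lem1 : ∀ n m j → (+ 2 * (1ℤ + j) + 1ℤ) * n - + 2 * (n + m) ≡ (+ 2 * j + 1ℤ) * n - + 2 * m
    lem1 = solve-∀
    lem2 : ∀ n m j → (+ 2 * (1ℤ + j) + + 2) * n - + 2 * (n + m) ≡ (+ 2 * j + + 2) * n - + 2 * m
    lem2 = solve-∀

  cross1 : ∀ n m j → sgn ((+ 2 * + j + 1ℤ) * + n - + 2 * + m) ≡ sgn (+ ((2 ℕ.* j ℕ.+ 1) ℕ.* n) - + (2 ℕ.* m))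
  cross1 n m j = cong sgn (trans (cong (λ z → z * + n - + 2 * + m) (coef1 j)) (lin (2 ℕ.* j ℕ.+ 1) n m))

  cross2 : ∀ n m j → sgn ((+ 2 * + j + + 2) * + n - + 2 * + m) ≡ sgn (+ ((2 ℕ.* j ℕ.+ 2) ℕ.* n) - + (2 ℕ.* m))
  cross2 n m j = cong sgn (trans (cong (λ z → z * + n - + 2 * + m) (coef2 j)) (lin (2 ℕ.* j ℕ.+ 2) n m))

  2m<cn : ∀ {c n m} → 2 ℕ.≤ c → m ℕ.< n → 2 ℕ.* m ℕ.< c ℕ.* n
  2m<cn {c} {n} {m} 2≤c m<n = ℕP.<-≤-trans (ℕP.*-monoʳ-< 2 m<n) (ℕP.*-monoˡ-≤ n 2≤c)

  cross-far : ∀ n m → m ℕ.< n → ∀ j → crossing (+ n) (+ m) (suc j) ≡ 1ℤ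
  cross-far n m m<n j = cong₂ _*_
    (trans (cross1 n m (suc j)) (sgn-pos-nat _ _ (2m<cn {2 ℕ.* suc j ℕ.+ 1} {n} {m} (ℕP.≤-trans (ℕP.*-monoʳ-≤ 2 {1} {suc j} (s≤s z≤n)) (ℕP.m≤m+n _ 1)) m<n)))
    (trans (cross2 n m (suc j)) (sgn-pos-nat _ _ (2m<cn {2 ℕ.* suc j ℕ.+ 2} {n} {m} (ℕP.m≤n+m 2 (2 ℕ.* suc j)) m<n)))

  2m≤2h : ∀ {m h} → 2 ℕ.* m ℕ.< odd h → m ℕ.≤ h
  2m≤2h {m} {h} (s≤s le) = ℕP.*-cancelˡ-≤ 2 le

  ε-low : ∀ h m → 0 ℕ.< m → m ℕ.≤ h → ε h (+ m) ≡ 1ℤ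
  ε-low h m 0<m m≤h = trans (cong sgn (res-small h m m≤h)) (sgn-pos (ℤ.+<+ 0<m))

  ε-high : ∀ h m → h ℕ.< m → m ℕ.< odd h → ε h (+ m) ≡ -1ℤ
  ε-high h m h<m m<n = trans (cong sgn (bal-unique h (+ m) (+ m - + odd h) small (by 1ℤ (lem (+ m) (+ odd h))))) (sgn-neg-nat (odd h) m m<n)
    where
    lem : ∀ m n → m ≡ m - n + 1ℤ * n
    lem = solve-∀
    small : ∣ + m - + odd h ∣ ℕ.≤ h
    small = ℕP.≤-trans (ℕP.≤-reflexive (trans (cong ∣_∣ (trans (ℤP.m-n≡m⊖n m (odd h)) (ℤP.⊖-≤ (ℕP.<⇒≤ m<n)))) (ℤP.∣-i∣≡∣i∣ (+ (odd h ℕ.∸ m)))))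
             (ℕP.≤-trans (ℕP.∸-monoʳ-≤ (odd h) h<m) (ℕP.≤-reflexive (trans (cong (ℕ._∸ h) (cong (h ℕ.+_) (ℕP.+-identityʳ h))) (ℕP.m+n∸m≡n h h))))

  -- The balanced residue of m changes sign exactly when 2 m passes a multiple of n.
  ε-crossing : ∀ h g m → 0 ℕ.< m → 2 ℕ.* m ℕ.< odd g ℕ.* odd h →
    ε h (+ m) ≡ ∏ {g} (λ j → crossing (+ odd h) (+ m) (toℕ j))
  ε-crossing h zero m 0<m lt = ε-low h m 0<m (2m≤2h (subst (2 ℕ.* m ℕ.<_) (ℕP.*-identityˡ (odd h)) lt))
  ε-crossing h (suc g) m 0<m lt with ℕP.<-cmp m (odd h)
  -- Below the modulus only the pair `j = 0` can be negative, and its sign is that of `odd h - 2m`,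
  -- which separates `m ≤ h` from `m > h`.
  ... | tri< m<n _ _ = trans (first (ℕP.<-≤-connex h m)) (sym (trans (cong₂ _*_ f0 (∏-one {g} (λ j → crossing (+ odd h) (+ m) (suc (toℕ j))) (λ j → cross-far (odd h) m m<n (toℕ j)))) (ℤP.*-identityʳ _)))
    where
    f0 : crossing (+ odd h) (+ m) 0 ≡ sgn (+ odd h - + (2 ℕ.* m))
    f0 = trans (cong₂ _*_ (trans (cross1 (odd h) m 0) (cong (λ z → sgn (+ z - + (2 ℕ.* m))) (ℕP.*-identityˡ (odd h))))
                 (trans (cross2 (odd h) m 0) (sgn-pos-nat _ _ (2m<cn {2} {odd h} {m} ℕP.≤-refl m<n)))) (ℤP.*-identityʳ _)
    first : (h ℕ.< m) ⊎ (m ℕ.≤ h) → ε h (+ m) ≡ sgn (+ odd h - + (2 ℕ.* m))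
    first (inj₂ m≤h) = trans (ε-low h m 0<m m≤h) (sym (sgn-pos-nat _ _ (s≤s (ℕP.*-monoʳ-≤ 2 m≤h))))
    first (inj₁ h<m) = trans (ε-high h m h<m m<n) (sym (sgn-neg-nat _ _ (ℕP.<-≤-trans (ℕP.≤-reflexive (sym (ℕP.*-suc 2 h))) (ℕP.*-monoʳ-≤ 2 h<m))))
  ... | tri≈ _ refl _ = trans (cong sgn (bal-unique h (+ m) 0ℤ z≤n (by 1ℤ (lem (+ m))))) (sym (trans (cong (_* ∏ {g} (λ j → crossing (+ m) (+ m) (suc (toℕ j)))) z0) refl))
    where
    lem : ∀ m → m ≡ 0ℤ + 1ℤ * m
    lem = solve-∀
    lem2 : ∀ n → (+ 2 * 0ℤ + + 2) * n - + 2 * n ≡ 0ℤ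
    lem2 = solve-∀
    z0 : crossing (+ m) (+ m) 0 ≡ 0ℤ
    z0 = trans (cong (λ z → sgn ((+ 2 * 0ℤ + 1ℤ) * + m - + 2 * + m) * sgn z) (lem2 (+ m))) (ℤP.*-zeroʳ (sgn ((+ 2 * 0ℤ + 1ℤ) * + m - + 2 * + m)))
  -- Above the modulus the pair `j = 0` consists of two negative signs and drops out. Lowering `m`
  -- by the modulus shifts the other pairs by one, so induction on `g` applies.
  ... | tri> _ _ n<m = trans (ε-resp h (by 1ℤ (trans (cong +_ (sym m≡)) (trans (ℤP.pos-+ n m') (lem (+ n) (+ m'))))))
       (trans (ε-crossing h g m' (ℕP.m<n⇒0<n∸m n<m) lt') (sym (trans (cong₂ _*_ z0 shift) (ℤP.*-identityˡ _))))
    where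
    n = odd h
    m' = m ℕ.∸ n
    m≡ : n ℕ.+ m' ≡ m
    m≡ = ℕP.m+[n∸m]≡n (ℕP.<⇒≤ n<m)
    lem : ∀ n m → n + m ≡ m + 1ℤ * n
    lem = solve-∀
    lt' : 2 ℕ.* m' ℕ.< odd g ℕ.* n
    lt' = ℕP.+-cancelˡ-< (2 ℕ.* n) _ _ (subst₂ ℕ._<_ (trans (cong (2 ℕ.*_) (sym m≡)) (ℕP.*-distribˡ-+ 2 n m')) (trans (cong (ℕ._* n) (cong suc (ℕP.*-suc 2 g))) (ℕP.*-distribʳ-+ n 2 (odd g))) lt)
    shift : ∏ {g} (λ j → crossing (+ n) (+ m) (suc (toℕ j))) ≡ ∏ {g} (λ j → crossing (+ n) (+ m') (toℕ j))
    shift = ∏-cong {g} (λ j → trans (cong (λ z → crossing (+ n) z (suc (toℕ j))) (trans (cong +_ (sym m≡)) (ℤP.pos-+ n m'))) (crossing-shift (+ n) (+ m') (toℕ j)))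
    2n<2m : 2 ℕ.* n ℕ.< 2 ℕ.* m
    2n<2m = ℕP.*-monoʳ-< 2 n<m
    z0 : crossing (+ n) (+ m) 0 ≡ 1ℤ
    z0 = cong₂ _*_ (trans (cross1 n m 0) (sgn-neg-nat _ _ (ℕP.≤-<-trans (ℕP.*-monoˡ-≤ n {1} {2} (s≤s z≤n)) 2n<2m)))
                   (trans (cross2 n m 0) (sgn-neg-nat _ _ 2n<2m))

  -- The two families of signs whose product is jac h (odd g); Sym is symmetric and Alt antisymmetric in the two moduli.
  Sym Alt : ℤ → ℤ → ℕ → ℕ → ℤ
  Sym n a i j = sgn (a * n - + 2 * + suc j * n - + 2 * + suc i * a)
  Alt n a i j = sgn (+ suc j * n - + suc i * a)

  opposite-suc : ∀ {g} (j : Fin g) → suc (toℕ (opposite j)) ℕ.+ toℕ j ≡ g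
  opposite-suc {g} j = trans (cong (λ z → suc z ℕ.+ toℕ j) (FinP.opposite-prop j))
     (trans (sym (ℕP.+-suc (g ℕ.∸ suc (toℕ j)) (toℕ j))) (ℕP.m∸n+n≡m (FinP.toℕ<n j)))

  pos-odd : ∀ g → + odd g ≡ 1ℤ + + 2 * + g
  pos-odd g = trans (ℤP.pos-+ 1 (2 ℕ.* g)) (cong (_+_ 1ℤ) (ℤP.pos-* 2 g))

  pos-suc : ∀ i → + suc i ≡ 1ℤ + + i
  pos-suc i = ℤP.pos-+ 1 i

  sgn-2* : ∀ a → sgn (+ 2 * a) ≡ sgn a
  sgn-2* a = trans (sgn-* (+ 2) a) (ℤP.*-identityˡ (sgn a))

  -- Row `i` is `ε-crossing` at `m = a * k`. The even multiples of the modulus give `Alt` once a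
  -- factor 2 is dropped. The odd ones, taken in reverse order, give `Sym`, since
  -- `2 (g - 1 - j) + 1 = a - 2 (j + 1)`.
  jac-grid : ∀ h g → jac h (+ odd g) ≡ ∏ {h} (λ i → ∏ {g} (λ j → Sym (+ odd h) (+ odd g) (toℕ i) (toℕ j) * Alt (+ odd h) (+ odd g) (toℕ i) (toℕ j)))
  jac-grid h g = ∏-cong {h} (λ i → trans (row i) (sym (∏-distrib {g} _ _)))
    where
    a = odd g
    n = odd h
    row : ∀ (i : Fin h) → ε h (+ a * + suc (toℕ i)) ≡ ∏ {g} (λ j → Sym (+ n) (+ a) (toℕ i) (toℕ j)) * ∏ {g} (λ j → Alt (+ n) (+ a) (toℕ i) (toℕ j))
    row i = trans (cong (ε h) (sym (ℤP.pos-* a k))) (trans (ε-crossing h g (a ℕ.* k) (s≤s z≤n) bound)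
       (trans (∏-distrib {g} (λ j → sgn ((+ 2 * + toℕ j + 1ℤ) * + n - + 2 * + (a ℕ.* k))) (λ j → sgn ((+ 2 * + toℕ j + + 2) * + n - + 2 * + (a ℕ.* k))))
       (cong₂ _*_ (trans (∏-permute {g} {g} _ Perm.reverse) (∏-cong {g} (λ j → cong sgn (left j)))) (∏-cong {g} (λ j → trans (cong sgn (right j)) (sgn-2* (+ suc (toℕ j) * + n - + k * + a)))))))
      where
      k = suc (toℕ i)
      bound : 2 ℕ.* (a ℕ.* k) ℕ.< a ℕ.* n
      bound = ℕP.≤-<-trans (ℕP.≤-reflexive (trans (sym (ℕP.*-assoc 2 a k)) (trans (cong (ℕ._* k) (ℕP.*-comm 2 a)) (ℕP.*-assoc a 2 k))))
               (ℕP.*-monoʳ-< a (s≤s (ℕP.*-monoʳ-≤ 2 (FinP.toℕ<n i))))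
      right : ∀ (j : Fin g) → (+ 2 * + toℕ j + + 2) * + n - + 2 * + (a ℕ.* k) ≡ + 2 * (+ suc (toℕ j) * + n - + k * + a)
      right j = trans (cong (λ z → (+ 2 * + toℕ j + + 2) * + n - + 2 * z) (ℤP.pos-* a k))
                 (trans (lem (+ toℕ j) (+ n) (+ a) (+ k)) (cong (λ z → + 2 * (z * + n - + k * + a)) (sym (pos-suc (toℕ j)))))
        where lem : ∀ j n a k → (+ 2 * j + + 2) * n - + 2 * (a * k) ≡ + 2 * ((1ℤ + j) * n - k * a)
              lem = solve-∀
      left : ∀ (j : Fin g) → (+ 2 * + toℕ (opposite j) + 1ℤ) * + n - + 2 * + (a ℕ.* k) ≡ + a * + n - + 2 * + suc (toℕ j) * + n - + 2 * + k * + a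
      left j = trans (cong (λ z → (+ 2 * + toℕ (opposite j) + 1ℤ) * + n - + 2 * z) (ℤP.pos-* a k))
                 (trans (lem (+ toℕ (opposite j)) (+ toℕ j) (+ n) (+ a) (+ k))
                   (trans (cong (λ z → z * + n - + 2 * (1ℤ + + toℕ j) * + n - + 2 * + k * + a) e) (cong (λ z → + a * + n - + 2 * z * + n - + 2 * + k * + a) (sym (pos-suc (toℕ j))))))
        where
        lem : ∀ o j n a k → (+ 2 * o + 1ℤ) * n - + 2 * (a * k) ≡ (1ℤ + + 2 * (1ℤ + o + j)) * n - + 2 * (1ℤ + j) * n - + 2 * k * a
        lem = solve-∀
        e : 1ℤ + + 2 * (1ℤ + + toℕ (opposite j) + + toℕ j) ≡ + a
        e = trans (cong (λ z → 1ℤ + + 2 * (z + + toℕ j)) (sym (pos-suc (toℕ (opposite j)))))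
             (trans (cong (λ z → 1ℤ + + 2 * z) (trans (sym (ℤP.pos-+ (suc (toℕ (opposite j))) (toℕ j))) (cong +_ (opposite-suc j)))) (sym (pos-odd g)))

  -- Exchanging the moduli transposes the grid of signs. Each of its `g * h` cells keeps its `Sym`
  -- factor and negates its `Alt` factor.
  jac-reciprocity : ∀ h g → jac g (+ odd h) ≡ (-1ℤ ^ (g ℕ.* h)) * jac h (+ odd g)
  jac-reciprocity h g = trans (jac-grid g h) (trans (∏-comm {g} {h} (λ j i → Sym (+ a) (+ n) (toℕ j) (toℕ i) * Alt (+ a) (+ n) (toℕ j) (toℕ i)))
     (trans (∏-cong {h} (λ i → trans (∏-cong {g} (λ j → flip i j)) (trans (∏-distrib {g} (λ _ → -1ℤ) _) (cong (_* ∏ {g} (λ j → f i j)) (∏-const g -1ℤ)))))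
     (trans (∏-distrib {h} (λ _ → -1ℤ ^ g) _) (cong₂ _*_ (trans (∏-const h (-1ℤ ^ g)) (ℤP.^-*-assoc -1ℤ g h)) (sym (jac-grid h g))))))
    where
    n = odd h
    a = odd g
    f : Fin h → Fin g → ℤ
    f i j = Sym (+ n) (+ a) (toℕ i) (toℕ j) * Alt (+ n) (+ a) (toℕ i) (toℕ j)
    lemS : ∀ n a i j → n * a - + 2 * i * a - + 2 * j * n ≡ a * n - + 2 * j * n - + 2 * i * a
    lemS = solve-∀
    lemR : ∀ n a i j → i * a - j * n ≡ - (j * n - i * a)
    lemR = solve-∀
    lem : ∀ s r → s * (- r) ≡ -1ℤ * (s * r)
    lem = solve-∀
    flip : ∀ (i : Fin h) (j : Fin g) → Sym (+ a) (+ n) (toℕ j) (toℕ i) * Alt (+ a) (+ n) (toℕ j) (toℕ i) ≡ -1ℤ * f i j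
    flip i j = trans (cong₂ _*_ (cong sgn (lemS (+ n) (+ a) (+ suc (toℕ i)) (+ suc (toℕ j))))
                      (trans (cong sgn (lemR (+ n) (+ a) (+ suc (toℕ i)) (+ suc (toℕ j)))) (sgn-neg (+ suc (toℕ j) * + n - + suc (toℕ i) * + a))))
               (lem (Sym (+ n) (+ a) (toℕ i) (toℕ j)) (Alt (+ n) (+ a) (toℕ i) (toℕ j)))

  -- Multiplicativity in the modulus and the symbol of 2

  halves : ∀ n → ∃ λ k → n ≡ 2 ℕ.* k ⊎ n ≡ odd k
  halves zero = 0 , inj₁ refl
  halves (suc n) with halves n
  ... | k , inj₁ refl = k , inj₂ refl
  ... | k , inj₂ refl = suc k , inj₁ (sym (ℕP.*-suc 2 k))

  -1^2k : ∀ k → -1ℤ ^ (2 ℕ.* k) ≡ 1ℤ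
  -1^2k k = trans (sym (ℤP.^-*-assoc -1ℤ 2 k)) (lem k)
    where lem : ∀ k → 1ℤ ^ k ≡ 1ℤ
          lem zero = refl
          lem (suc k) = trans (ℤP.*-identityˡ _) (lem k)

  cong-down : ∀ {m n a b} → Cong (m ℕ.* n) a b → Cong m a b
  cong-down {m} {n} {a} {b} (by q e) = by (q * + n) (trans e (cong (_+_ b) (trans (cong (q *_) (ℤP.pos-* m n)) (lem q (+ m) (+ n)))))
    where lem : ∀ q m n → q * (m * n) ≡ q * n * m
          lem = solve-∀

  -- Reciprocity speaks of odd numerators only; adding the odd modulus to an even residue makes it
  -- odd.
  odd-rep : ∀ h a → ∃ λ g → Cong (odd h) a (+ odd g)
  odd-rep h a with halves (a %ℕ odd h)
  ... | k , inj₂ e = k , by (a /ℕ odd h) (trans (a≡a%ℕn+[a/ℕn]*n a (odd h)) (cong (λ z → + z + (a /ℕ odd h) * + odd h) e))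
  ... | k , inj₁ e = k ℕ.+ h , by (a /ℕ odd h - 1ℤ) (trans (a≡a%ℕn+[a/ℕn]*n a (odd h)) (trans (cong (λ z → + z + (a /ℕ odd h) * + odd h) e) 
       (trans (lem (+ (2 ℕ.* k)) (a /ℕ odd h) (+ odd h)) (cong (λ z → z + (a /ℕ odd h - 1ℤ) * + odd h) (trans (sym (ℤP.pos-+ (2 ℕ.* k) (odd h))) (cong +_ (lem2 k h)))))))
    where
    lem : ∀ k q n → k + q * n ≡ k + n + (q - 1ℤ) * n
    lem = solve-∀
    lem2 : ∀ k h → 2 ℕ.* k ℕ.+ suc (2 ℕ.* h) ≡ suc (2 ℕ.* (k ℕ.+ h))
    lem2 = ℕR.solve-∀

  infixl 7 _⊛_
  -- Multiplication of odd numbers expressed by their halves, the index that `jac` uses.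
  _⊛_ : ℕ → ℕ → ℕ
  h ⊛ g = 2 ℕ.* (h ℕ.* g) ℕ.+ h ℕ.+ g

  odd-⊛ : ∀ h g → odd (h ⊛ g) ≡ odd h ℕ.* odd g
  odd-⊛ = lem
    where lem : ∀ h g → suc (2 ℕ.* (2 ℕ.* (h ℕ.* g) ℕ.+ h ℕ.+ g)) ≡ suc (2 ℕ.* h) ℕ.* suc (2 ℕ.* g)
          lem = ℕR.solve-∀

  -- Reciprocity turns this into multiplicativity in the numerator; the signs agree because `h ⊛ k`
  -- and `h + k` have the same parity.
  jac-bottom-odd : ∀ h k g → jac (h ⊛ k) (+ odd g) ≡ jac h (+ odd g) * jac k (+ odd g)
  jac-bottom-odd h k g = trans (jac-reciprocity g (h ⊛ k)) (trans (cong₂ _*_ pw (trans (cong (jac g) (trans (cong +_ (odd-⊛ h k)) (ℤP.pos-* (odd h) (odd k)))) (jac-mul g (+ odd h) (+ odd k))))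
     (trans (lem (-1ℤ ^ (h ℕ.* g)) (-1ℤ ^ (k ℕ.* g)) (jac g (+ odd h)) (jac g (+ odd k))) (sym (cong₂ _*_ (jac-reciprocity g h) (jac-reciprocity g k)))))
    where
    lem : ∀ a b c d → a * b * (c * d) ≡ a * c * (b * d)
    lem = solve-∀
    lem2 : ∀ h k g → (2 ℕ.* (h ℕ.* k) ℕ.+ h ℕ.+ k) ℕ.* g ≡ 2 ℕ.* (h ℕ.* k ℕ.* g) ℕ.+ (h ℕ.* g ℕ.+ k ℕ.* g)
    lem2 = ℕR.solve-∀
    pw : -1ℤ ^ ((h ⊛ k) ℕ.* g) ≡ -1ℤ ^ (h ℕ.* g) * -1ℤ ^ (k ℕ.* g)
    pw = trans (cong (-1ℤ ^_) (lem2 h k g)) (trans (ℤP.^-distribˡ-+-* -1ℤ (2 ℕ.* (h ℕ.* k ℕ.* g)) _) (trans (cong₂ _*_ (-1^2k (h ℕ.* k ℕ.* g)) (ℤP.^-distribˡ-+-* -1ℤ (h ℕ.* g) (k ℕ.* g))) (ℤP.*-identityˡ _)))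

  jac-bottom : ∀ h k a → jac (h ⊛ k) a ≡ jac h a * jac k a
  jac-bottom h k a with odd-rep (h ⊛ k) a
  ... | g , e = trans (jac-resp (h ⊛ k) e) (trans (jac-bottom-odd h k g) (sym (cong₂ _*_ (jac-resp h (cong-down {odd h} {odd k} e'))
        (jac-resp k (cong-down {odd k} {odd h} (subst (λ n → Cong n a (+ odd g)) (ℕP.*-comm (odd h) (odd k)) e'))))))
    where
    e' : Cong (odd h ℕ.* odd k) a (+ odd g)
    e' = subst (λ n → Cong n a (+ odd g)) (odd-⊛ h k) e

  -- Modulo `2h + 3` the number 2 is `-(2h + 1)`. Reciprocity, whose sign is trivial because
  -- `h (h + 1)` is even, leads to `2h + 3`, which is 2 modulo `2h + 1`.
  jac-two-step : ∀ h → jac (suc h) (+ 2) ≡ -1ℤ ^ suc h * jac h (+ 2)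
  jac-two-step h = trans (jac-resp (suc h) {+ 2} { -1ℤ * + odd h} (by 1ℤ e1)) (trans (jac-mul (suc h) -1ℤ (+ odd h))
     (cong₂ _*_ (jac-neg1 (suc h)) (trans (jac-reciprocity h (suc h)) (trans (cong₂ _*_ pw (jac-resp h {+ odd (suc h)} {+ 2} (by 1ℤ e2))) (ℤP.*-identityˡ _)))))
    where
    os : odd (suc h) ≡ 2 ℕ.+ odd h
    os = cong suc (ℕP.*-suc 2 h)
    lem : ∀ n → + 2 ≡ -1ℤ * n + 1ℤ * (+ 2 + n)
    lem = solve-∀
    e1 : + 2 ≡ -1ℤ * + odd h + 1ℤ * + odd (suc h)
    e1 = trans (lem (+ odd h)) (cong (λ z → -1ℤ * + odd h + 1ℤ * z) (trans (sym (ℤP.pos-+ 2 (odd h))) (cong +_ (sym os))))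
    e2 : + odd (suc h) ≡ + 2 + 1ℤ * + odd h
    e2 = trans (cong +_ os) (trans (ℤP.pos-+ 2 (odd h)) (cong (_+_ (+ 2)) (sym (ℤP.*-identityˡ (+ odd h)))))
    ev : ∀ h → ∃ λ k → suc h ℕ.* h ≡ 2 ℕ.* k
    ev zero = 0 , refl
    ev (suc h) with ev h
    ... | k , e = k ℕ.+ suc h , trans (lem' h) (trans (cong (ℕ._+ 2 ℕ.* suc h) e) (sym (ℕP.*-distribˡ-+ 2 k (suc h))))
      where lem' : ∀ h → suc (suc h) ℕ.* suc h ≡ suc h ℕ.* h ℕ.+ 2 ℕ.* suc h
            lem' = ℕR.solve-∀
    pw : -1ℤ ^ (suc h ℕ.* h) ≡ 1ℤ
    pw = trans (cong (-1ℤ ^_) (proj₂ (ev h))) (-1^2k (proj₁ (ev h)))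

  -- The exponents of the four signs add up to the even number `4h + 10`. A step of 4 in `h` is a
  -- step of 8 in the modulus.
  jac-two-period : ∀ h → jac (4 ℕ.+ h) (+ 2) ≡ jac h (+ 2)
  jac-two-period h = trans (jac-two-step (3 ℕ.+ h)) (trans (cong (-1ℤ ^ (4 ℕ.+ h) *_) (trans (jac-two-step (2 ℕ.+ h)) (cong (-1ℤ ^ (3 ℕ.+ h) *_)
     (trans (jac-two-step (1 ℕ.+ h)) (cong (-1ℤ ^ (2 ℕ.+ h) *_) (jac-two-step h))))))
     (trans (lem (-1ℤ ^ h) (jac h (+ 2))) (trans (cong (λ z → z * z * jac h (+ 2)) sq) (ℤP.*-identityˡ (jac h (+ 2))))))
    where
    lem : ∀ p j → -1ℤ * (-1ℤ * (-1ℤ * (-1ℤ * p))) * (-1ℤ * (-1ℤ * (-1ℤ * p)) * (-1ℤ * (-1ℤ * p) * (-1ℤ * p * j))) ≡ p * p * (p * p) * j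
    lem = solve-∀
    sq : -1ℤ ^ h * -1ℤ ^ h ≡ 1ℤ
    sq = trans (sym (ℤP.^-distribˡ-+-* -1ℤ h h)) (trans (cong (-1ℤ ^_) (cong (h ℕ.+_) (sym (ℕP.+-identityʳ h)))) (-1^2k h))

  -- The symbol indexed by its modulus

  χ : ℕ → ℤ
  χ 1 = 1ℤ
  χ 3 = -1ℤ
  χ 5 = -1ℤ
  χ 7 = 1ℤ
  χ _ = 0ℤ

  χ₈ : ℕ → ℤ
  χ₈ n = χ (n % 8)

  Odd : ℕ → Set
  Odd n = n % 2 ≡ 1

  odd-half : ∀ {n} → Odd n → n ≡ odd (n / 2)
  odd-half {n} o = trans (m≡m%n+[m/n]*n n 2) (trans (cong (ℕ._+ (n / 2) ℕ.* 2) o) (cong suc (ℕP.*-comm (n / 2) 2)))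

  half-odd : ∀ h → odd h / 2 ≡ h
  half-odd h = ℕP.*-cancelʳ-≡ (odd h / 2) h 2 (ℕP.suc-injective (trans (sym (trans (m≡m%n+[m/n]*n (odd h) 2) (cong (ℕ._+ (odd h / 2) ℕ.* 2) (odd-Odd h)))) (cong suc (ℕP.*-comm 2 h))))
    where
    odd-Odd : ∀ h → odd h % 2 ≡ 1
    odd-Odd h = trans (cong (_% 2) (cong suc (ℕP.*-comm 2 h))) ([m+kn]%n≡m%n 1 h 2)

  odd-Odd : ∀ h → Odd (odd h)
  odd-Odd h = trans (cong (_% 2) (cong suc (ℕP.*-comm 2 h))) ([m+kn]%n≡m%n 1 h 2)

  Odd-* : ∀ {m n} → Odd m → Odd n → Odd (m ℕ.* n)
  Odd-* {m} {n} om on = trans (cong (_% 2) (trans (cong₂ ℕ._*_ (odd-half {m} om) (odd-half {n} on)) (sym (odd-⊛ (m / 2) (n / 2))))) (odd-Odd ((m / 2) ⊛ (n / 2)))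

  abstract
    -- For even `n` this is the symbol modulo `n + 1`, which is why lemmas that tie the value to `n`
    -- itself ask for `Odd n`.
    J : ℤ → ℕ → ℤ
    J a n = jac (n / 2) a

    J-resp : ∀ {n a b} → Odd n → Cong n a b → J a n ≡ J b n
    J-resp {n} {a} {b} o e = jac-resp (n / 2) (subst (λ z → Cong z a b) (odd-half {n} o) e)

    J-mul : ∀ a b n → J (a * b) n ≡ J a n * J b n
    J-mul a b n = jac-mul (n / 2) a b

    J-trit : ∀ a n → Trit (J a n)
    J-trit a n = jac-trit (n / 2) a

    J-sq : ∀ a {n} → Odd n → Coprime ∣ a ∣ n → J a n * J a n ≡ 1ℤ
    J-sq a {n} o c = jac-sq (n / 2) a (subst (Coprime ∣ a ∣) (odd-half {n} o) c)

    J-modulo-1 : ∀ a → J a 1 ≡ 1ℤ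
    J-modulo-1 a = refl

    J-one : ∀ n → J 1ℤ n ≡ 1ℤ
    J-one n = jac-one (n / 2)

    J-neg1 : ∀ n → J -1ℤ n ≡ -1ℤ ^ (n / 2)
    J-neg1 n = jac-neg1 (n / 2)

    J-bottom : ∀ a {m n} → Odd m → Odd n → J a (m ℕ.* n) ≡ J a m * J a n
    J-bottom a {m} {n} om on = trans (cong (λ z → jac z a) (trans (cong (_/ 2) (trans (cong₂ ℕ._*_ (odd-half {m} om) (odd-half {n} on)) (sym (odd-⊛ (m / 2) (n / 2))))) (half-odd ((m / 2) ⊛ (n / 2))))) (jac-bottom (m / 2) (n / 2) a)

    %4-odd : ∀ {n} → n % 4 ≡ 1 → n ≡ odd (2 ℕ.* (n / 4))
    %4-odd {n} e = trans (m≡m%n+[m/n]*n n 4) (trans (cong (ℕ._+ (n / 4) ℕ.* 4) e) (lem (n / 4)))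
      where lem : ∀ q → 1 ℕ.+ q ℕ.* 4 ≡ suc (2 ℕ.* (2 ℕ.* q))
            lem = ℕR.solve-∀

    %4-Odd : ∀ {n} → n % 4 ≡ 1 → Odd n
    %4-Odd {n} e = subst Odd (sym (%4-odd {n} e)) (odd-Odd (2 ℕ.* (n / 4)))

    J-recip : ∀ {m n} → m % 4 ≡ 1 → Odd n → J (+ m) n ≡ J (+ n) m
    J-recip {m} {n} em on = sym (trans (cong (λ z → J z m) (cong +_ (odd-half {n} on))) (trans (jac-reciprocity (n / 2) (m / 2)) (trans (cong (_* J (+ odd (m / 2)) n) pw) (trans (ℤP.*-identityˡ _) (cong (λ z → J (+ z) n) (sym (odd-half {m} (%4-Odd {m} em))))))))
      where
      hm : m / 2 ≡ 2 ℕ.* (m / 4)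
      hm = trans (cong (_/ 2) (%4-odd {m} em)) (half-odd (2 ℕ.* (m / 4)))
      pw : -1ℤ ^ (m / 2 ℕ.* (n / 2)) ≡ 1ℤ
      pw = trans (cong (-1ℤ ^_) (trans (cong (ℕ._* (n / 2)) hm) (ℕP.*-assoc 2 (m / 4) (n / 2)))) (-1^2k (m / 4 ℕ.* (n / 2)))

    J-neg1-1mod4 : ∀ {n} → n % 4 ≡ 1 → J -1ℤ n ≡ 1ℤ
    J-neg1-1mod4 {n} e = trans (J-neg1 n) (trans (cong (-1ℤ ^_) (trans (cong (_/ 2) (%4-odd {n} e)) (half-odd (2 ℕ.* (n / 4))))) (-1^2k (n / 4)))

    J-neg1-3mod4 : ∀ {n} → n % 4 ≡ 3 → J -1ℤ n ≡ -1ℤ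
    J-neg1-3mod4 {n} e = trans (J-neg1 n) (trans (cong (-1ℤ ^_) (trans (cong (_/ 2) e') (half-odd (suc (2 ℕ.* (n / 4)))))) (cong (-1ℤ *_) (-1^2k (n / 4))))
      where
      lem : ∀ q → 3 ℕ.+ q ℕ.* 4 ≡ suc (2 ℕ.* (suc (2 ℕ.* q)))
      lem = ℕR.solve-∀
      e' : n ≡ odd (suc (2 ℕ.* (n / 4)))
      e' = trans (m≡m%n+[m/n]*n n 4) (trans (cong (ℕ._+ (n / 4) ℕ.* 4) e) (lem (n / 4)))

    jac-two-4q : ∀ q r → jac (4 ℕ.* q ℕ.+ r) (+ 2) ≡ jac r (+ 2)
    jac-two-4q zero r = refl
    jac-two-4q (suc q) r = trans (cong (λ z → jac (z ℕ.+ r) (+ 2)) (ℕP.*-suc 4 q)) (trans (jac-two-period (4 ℕ.* q ℕ.+ r)) (jac-two-4q q r))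

    J-two-res : ∀ n r → n % 8 ≡ odd r → J (+ 2) n ≡ jac r (+ 2)
    J-two-res n r e = trans (cong (λ z → jac z (+ 2)) (trans (cong (_/ 2) e') (half-odd (4 ℕ.* (n / 8) ℕ.+ r)))) (jac-two-4q (n / 8) r)
      where
      lem : ∀ q r → suc (2 ℕ.* r) ℕ.+ q ℕ.* 8 ≡ suc (2 ℕ.* (4 ℕ.* q ℕ.+ r))
      lem = ℕR.solve-∀
      e' : n ≡ odd (4 ℕ.* (n / 8) ℕ.+ r)
      e' = trans (m≡m%n+[m/n]*n n 8) (trans (cong (ℕ._+ (n / 8) ℕ.* 8) e) (lem (n / 8) r))

  data OddRes : ℕ → Set where
    r1 : OddRes 1
    r3 : OddRes 3
    r5 : OddRes 5
    r7 : OddRes 7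

  odd-res : ∀ {n} → Odd n → OddRes (n % 8)
  odd-res {n} o = go (n % 8) (m%n<n n 8) (trans (sym r2) o)
    where
    r2 : n % 2 ≡ (n % 8) % 2
    r2 = trans (cong (_% 2) (trans (m≡m%n+[m/n]*n n 8) (cong (n % 8 ℕ.+_) (sym (ℕP.*-assoc (n / 8) 4 2))))) ([m+kn]%n≡m%n (n % 8) ((n / 8) ℕ.* 4) 2)
    go : ∀ r → r ℕ.< 8 → r % 2 ≡ 1 → OddRes r
    go 0 _ ()
    go 1 _ _ = r1
    go 2 _ ()
    go 3 _ _ = r3
    go 4 _ ()
    go 5 _ _ = r5
    go 6 _ ()
    go 7 _ _ = r7
    go (suc (suc (suc (suc (suc (suc (suc (suc r)))))))) (s≤s (s≤s (s≤s (s≤s (s≤s (s≤s (s≤s (s≤s ())))))))) _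

  J-two : ∀ {n} → Odd n → J (+ 2) n ≡ χ₈ n
  J-two {n} o = go (n % 8) refl (odd-res {n} o)
    where
    go : ∀ r → n % 8 ≡ r → OddRes r → J (+ 2) n ≡ χ₈ n
    go _ e r1 = trans (J-two-res n 0 e) (sym (cong χ e))
    go _ e r3 = trans (J-two-res n 1 e) (trans (jac-two-step 0) (sym (cong χ e)))
    go _ e r5 = trans (J-two-res n 2 e) (trans (jac-two-step 1) (trans (cong (1ℤ *_) (jac-two-step 0)) (sym (cong χ e))))
    go _ e r7 = trans (J-two-res n 3 e) (trans (jac-two-step 2) (trans (cong (-1ℤ *_) (trans (jac-two-step 1) (cong (1ℤ *_) (jac-two-step 0)))) (sym (cong χ e))))

module Arithmetic where

  open import Data.Nat
  open import Data.Nat.Divisibility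
  open import Data.Nat.DivMod using ([m+kn]%n≡m%n; %-distribˡ-*)
  open import Data.Nat.GCD using (gcd; gcd[m,n]∣m; gcd[m,n]∣n; gcd[m,n]≢0; gcd-greatest)
  open import Data.Nat.Primality.Factorisation using (factorise; PrimeFactorisation)
  open import Data.Nat.Tactic.RingSolver using (solve-∀)
  open import Data.List using ([]; _∷_)
  open import Data.List.Relation.Unary.All using (All; []; _∷_)
  open import Defs
  open JacobiSymbol

  -- Coprimality, exact powers and residues modulo 8

  pow-* : ∀ a b k → (a * b) ^ k ≡ a ^ k * b ^ k
  pow-* a b zero = refl
  pow-* a b (suc k) = trans (cong (a * b *_) (pow-* a b k)) (lem a b (a ^ k) (b ^ k))
    where lem : ∀ a b c d → a * b * (c * d) ≡ a * c * (b * d)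
          lem = solve-∀

  pow-2* : ∀ a k → a ^ (2 * k) ≡ a ^ k * a ^ k
  pow-2* a k = trans (ℕP.^-distribˡ-+-* a k (k + 0)) (cong (λ z → a ^ k * a ^ z) (ℕP.+-identityʳ k))

  pow-pos : ∀ {a} k → 0 < a → 0 < a ^ k
  pow-pos {suc a} k _ = ℕP.m^n>0 (suc a) k

  pos-≢ : ∀ {a} → 0 < a → a ≢ 0
  pos-≢ (s≤s _) ()

  *-pos : ∀ {a b} → 0 < a → 0 < b → 0 < a * b
  *-pos {suc a} {suc b} _ _ = s≤s z≤n

  pos-*ˡ : ∀ {a b} → 0 < a * b → 0 < a
  pos-*ˡ {suc a} _ = s≤s z≤n

  pos-*ʳ : ∀ a {b} → 0 < a * b → 0 < b
  pos-*ʳ a {zero} p = contradiction (subst (0 <_) (ℕP.*-zeroʳ a) p) λ ()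
  pos-*ʳ a {suc b} _ = s≤s z≤n

  cancelˡ : ∀ {a b c} → 0 < a → a * b ≡ a * c → b ≡ c
  cancelˡ {suc a} {b} {c} _ e = ℕP.*-cancelˡ-≡ b c (suc a) e

  pow-injective : ∀ {a b k} → 0 < k → a ^ k ≡ b ^ k → a ≡ b
  pow-injective {a} {b} {suc k} _ e with ℕP.<-cmp a b
  ... | tri< a<b _ _ = contradiction e (ℕP.<⇒≢ (ℕP.^-monoˡ-< (suc k) a<b))
  ... | tri≈ _ a≡b _ = a≡b
  ... | tri> _ _ b<a = contradiction (sym e) (ℕP.<⇒≢ (ℕP.^-monoˡ-< (suc k) b<a))

  coprime-∣ˡ : ∀ {a b n} → Coprime a n → b ∣ a → Coprime b n
  coprime-∣ˡ c b∣a (d∣b , d∣n) = c (∣-trans d∣b b∣a , d∣n)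

  coprime-∣ʳ : ∀ {a m n} → Coprime a n → m ∣ n → Coprime a m
  coprime-∣ʳ c m∣n (d∣a , d∣m) = c (d∣a , ∣-trans d∣m m∣n)

  coprime-sym : ∀ {a b} → Coprime a b → Coprime b a
  coprime-sym c (x , y) = c (y , x)

  coprime-1 : ∀ n → Coprime 1 n
  coprime-1 n (d∣1 , _) = ∣1⇒≡1 d∣1

  coprime-*ˡ : ∀ {a b n} → Coprime a n → Coprime b n → Coprime (a * b) n
  coprime-*ˡ {a} {b} {n} ca cb {d} (d∣ab , d∣n) = cb (Cop.coprime-divisor {d} {a} {b} (λ (e∣d , e∣a) → ca (e∣a , ∣-trans e∣d d∣n)) d∣ab , d∣n)

  coprime-*ʳ : ∀ {a m n} → Coprime a m → Coprime a n → Coprime a (m * n)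
  coprime-*ʳ {a} {m} {n} cm cn = coprime-sym {m * n} {a} (coprime-*ˡ {m} {n} {a} (coprime-sym {a} {m} cm) (coprime-sym {a} {n} cn))

  coprime-^ˡ : ∀ {a n} k → Coprime a n → Coprime (a ^ k) n
  coprime-^ˡ {a} {n} zero c = coprime-1 n
  coprime-^ˡ {a} {n} (suc k) c = coprime-*ˡ {a} {a ^ k} {n} c (coprime-^ˡ {a} {n} k c)

  coprime-^ʳ : ∀ {a n} k → Coprime a n → Coprime a (n ^ k)
  coprime-^ʳ {a} {n} k c = coprime-sym {n ^ k} {a} (coprime-^ˡ {n} {a} k (coprime-sym {a} {n} c))

  coprime-divisor : ∀ {m n o} → Coprime m n → m ∣ n * o → m ∣ o
  coprime-divisor {m} {n} {o} c = Cop.coprime-divisor {m} {n} {o} c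

  coprime-divisorʳ : ∀ {m n o} → Coprime m n → m ∣ o * n → m ∣ o
  coprime-divisorʳ {m} {n} {o} c e = coprime-divisor {m} {n} {o} c (subst (m ∣_) (ℕP.*-comm o n) e)

  gcd-split : ∀ m n → 0 < n → ∃ λ g → ∃ λ m' → ∃ λ n' → m ≡ g * m' × n ≡ g * n' × Coprime m' n' × 0 < g
  gcd-split m n 0<n with gcd[m,n]∣m m n | gcd[m,n]∣n m n
  ... | divides m' em | divides n' en = g , m' , n' , trans em (ℕP.*-comm m' g) , trans en (ℕP.*-comm n' g) , cop , 0<g
    where
    g = gcd m n
    0<g : 0 < g
    0<g = ℕP.n≢0⇒n>0 (gcd[m,n]≢0 m n (inj₂ (pos-≢ 0<n)))
    cop : Coprime m' n'
    cop {d} (divides p refl , divides q refl) = ∣1⇒≡1 (*-cancelˡ-∣ g {{>-nonZero 0<g}} (subst (g * d ∣_) (sym (ℕP.*-identityʳ g)) (gcd-greatest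
        (divides p (trans em (lem p d g))) (divides q (trans en (lem q d g))))))
      where lem : ∀ p d g → p * d * g ≡ p * (g * d)
            lem = solve-∀

  coprime-lcm : ∀ {a b n} → Coprime a b → a ∣ n → b ∣ n → a * b ∣ n
  coprime-lcm {a} {b} c a∣n (divides q refl) with coprime-divisorʳ {a} {b} {q} c a∣n
  ... | divides r refl = divides r (ℕP.*-assoc r a b)

  -- Take `g = gcd m n` and `n = g n'`. By coprimality the k-th powers of `g` and `n'` divide `m`
  -- and `v`, and since the two products agree, both divisibilities are equalities.
  coprime-power-split : ∀ {m v n k} → 0 < k → 0 < n → Coprime m v → m * v ≡ n ^ k →
    ∃ λ a → ∃ λ b → m ≡ a ^ k × v ≡ b ^ k × a * b ≡ n
  coprime-power-split {m} {v} {n} {suc k} _ 0<n cmv e with gcd-split m n 0<n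
  ... | g , m' , n' , refl , refl , c , 0<g = g , n' , sym (proj₁ both) , sym (proj₂ both) , refl
    where
    n'∣v : n' ∣ v
    n'∣v = coprime-divisor {n'} {m'} {v} (coprime-sym {m'} {n'} c) (*-cancelˡ-∣ g {{>-nonZero 0<g}} (divides ((g * n') ^ k) (trans (sym (ℕP.*-assoc g m' v)) (trans e (ℕP.*-comm (g * n') _)))))
    gk∣m : g ^ suc k ∣ g * m'
    gk∣m = coprime-divisorʳ {g ^ suc k} {v} {g * m'} (coprime-^ˡ {g} {v} (suc k) (coprime-∣ˡ {g * m'} {g} {v} cmv (m∣m*n m'))) (subst (g ^ suc k ∣_) (sym (trans e (pow-* g n' (suc k)))) (m∣m*n (n' ^ suc k)))
    nk∣v : n' ^ suc k ∣ v
    nk∣v = coprime-divisor {n' ^ suc k} {g * m'} {v} (coprime-^ˡ {n'} {g * m'} (suc k) (coprime-sym {g * m'} {n'} (coprime-∣ʳ {g * m'} {n'} {v} cmv n'∣v))) (subst (n' ^ suc k ∣_) (sym (trans e (pow-* g n' (suc k)))) (n∣m*n (g ^ suc k)))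
    0<mv : 0 < g ^ suc k * n' ^ suc k
    0<mv = subst (0 <_) (pow-* g n' (suc k)) (pow-pos (suc k) 0<n)
    tight : ∀ {a b c d} → a ∣ c → b ∣ d → c * d ≡ a * b → 0 < a * b → a ≡ c × b ≡ d
    tight {a} {b} (divides p refl) (divides q refl) e 0<ab with ℕP.m*n≡1⇒m≡1 p q pq | ℕP.m*n≡1⇒n≡1 p q pq
      where
      lem : ∀ p q a b → a * b * (p * q) ≡ p * a * (q * b)
      lem = solve-∀
      pq : p * q ≡ 1
      pq = cancelˡ {a * b} 0<ab (trans (lem p q a b) (trans e (sym (ℕP.*-identityʳ _))))
    ... | refl | refl = sym (ℕP.*-identityˡ a) , sym (ℕP.*-identityˡ b)
    both : g ^ suc k ≡ g * m' × n' ^ suc k ≡ v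
    both = tight gk∣m nk∣v (trans e (pow-* g n' (suc k))) 0<mv

  -- After division by the gcd of `q` and `r`, the reduced `q'` divides the square of `r'` and is
  -- prime to it, so it is 1.
  square-quotient : ∀ {q a r} → 0 < q → a * (q * q) ≡ r * r → ∃ λ v → a ≡ v * v × r ≡ q * v
  square-quotient {q} {a} {r} 0<q e with gcd-split r q 0<q
  ... | g , r' , q' , refl , refl , c , 0<g = r' , trans (sym (trans (cong (λ z → a * (z * z)) q1) (ℕP.*-identityʳ a))) e2 , cong (_* r') (sym (trans (cong (g *_) q1) (ℕP.*-identityʳ g)))
    where
    lem1 : ∀ g a q → g * g * (a * (q * q)) ≡ a * (g * q * (g * q))
    lem1 = solve-∀
    lem2 : ∀ g r → g * r * (g * r) ≡ g * g * (r * r)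
    lem2 = solve-∀
    e2 : a * (q' * q') ≡ r' * r'
    e2 = cancelˡ (*-pos 0<g 0<g) (trans (lem1 g a q') (trans e (lem2 g r')))
    q1 : q' ≡ 1
    q1 = c (coprime-divisor {q'} {r'} {r'} (coprime-sym {r'} {q'} c) (divides (a * q') (trans (sym e2) (sym (ℕP.*-assoc a q' q')))) , ∣-refl)

  odd-power-square : ∀ {a r} j → 0 < a → a ^ odd j ≡ r * r → ∃ λ v → a ≡ v * v × r ≡ v ^ odd j
  odd-power-square {a} {r} j 0<a e with square-quotient {a ^ j} {a} {r} (pow-pos j 0<a) (trans (cong (a *_) (sym (pow-2* a j))) e)
  ... | v , refl , e' = v , refl , trans e' (trans (ℕP.*-comm _ v) (cong (v *_) (trans (pow-* v v j) (sym (pow-2* v j)))))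

  -- `odd-power-square` takes one square root at a time and keeps the odd exponent. This extracts
  -- the `w` of the theorem from `n ^ d ≡ u₂ ^ x`.
  root-2^s : ∀ s {a m} j → 0 < a → a ^ odd j ≡ m ^ (2 ^ s) → ∃ λ w → a ≡ w ^ (2 ^ s) × w ^ odd j ≡ m
  root-2^s zero {a} {m} j 0<a e = a , sym (ℕP.*-identityʳ a) , trans e (ℕP.*-identityʳ m)
  root-2^s (suc s) {a} {m} j 0<a e with odd-power-square {a} {m ^ (2 ^ s)} j 0<a (trans e (pow-2* m (2 ^ s)))
  ... | v , refl , e' with root-2^s s {v} {m} j (pos-*ˡ 0<a) (sym e')
  ... | w , refl , e'' = w , sym (pow-2* w (2 ^ s)) , e''

  2∤odd : ∀ k → ¬ (2 ∣ odd k)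
  2∤odd k (divides q e) = contradiction (trans (sym (odd-Odd k)) (trans (cong (_% 2) e) ([m+kn]%n≡m%n 0 q 2))) λ ()

  two-adic : ∀ t → 0 < t → ∃ λ a → ∃ λ j → t ≡ 2 ^ a * odd j
  two-adic = <-rec _ go
    where
    go : ∀ t → (∀ {m} → m < t → 0 < m → ∃ λ a → ∃ λ j → m ≡ 2 ^ a * odd j) → 0 < t → ∃ λ a → ∃ λ j → t ≡ 2 ^ a * odd j
    go t rec 0<t with halves t
    ... | k , inj₂ refl = 0 , k , sym (ℕP.*-identityˡ _)
    ... | zero , inj₁ refl = contradiction 0<t λ ()
    ... | suc k , inj₁ refl with rec {suc k} (ℕP.m<m+n (suc k) (s≤s z≤n)) (s≤s z≤n)
    ... | a , j , e = suc a , j , trans (cong (2 *_) e) (sym (ℕP.*-assoc 2 (2 ^ a) (odd j)))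

  V₂-intro : ∀ a j → V₂ (2 ^ a * odd j) a
  V₂-intro a j = m∣m*n (odd j) , λ d → 2∤odd j (*-cancelˡ-∣ (2 ^ a) {{ℕP.m^n≢0 2 a}} (subst (_∣ 2 ^ a * odd j) (ℕP.*-comm 2 (2 ^ a)) d))

  -- A divisor `t` of `m ^ (j + 1)` is `gcd t m` times a divisor of `m ^ j`. Multiplicative
  -- properties thus pass from divisors of `m` to divisors of its powers without prime
  -- factorisation.
  dvd-power-ind : (P : ℕ → Set) → P 1 → (∀ {a b} → P a → P b → P (a * b)) →
    ∀ {m} → 0 < m → (∀ {d} → d ∣ m → P d) → ∀ j {t} → t ∣ m ^ j → P t
  dvd-power-ind P p1 p* 0<m pd zero t∣1 = subst P (sym (∣1⇒≡1 t∣1)) p1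
  dvd-power-ind P p1 p* {m} 0<m pd (suc j) {t} t∣ with gcd-split t m 0<m
  ... | g , t' , m' , refl , refl , c , 0<g = p* {g} {t'} (pd (m∣m*n m')) (dvd-power-ind P p1 p* 0<m pd j
     (coprime-divisor {t'} {m'} {(g * m') ^ j} c (*-cancelˡ-∣ g {{>-nonZero 0<g}} (subst (g * t' ∣_) (ℕP.*-assoc g m' _) t∣))))

  odd-sq-mod8 : ∀ {a} → Odd a → (a * a) % 8 ≡ 1
  odd-sq-mod8 {a} o = trans (%-distribˡ-* a a 8) (go (a % 8) (odd-res {a} o))
    where
    go : ∀ r → OddRes r → (r * r) % 8 ≡ 1
    go _ r1 = refl
    go _ r3 = refl
    go _ r5 = refl
    go _ r7 = refl

  mod8-cong-* : ∀ {a b c d} → a % 8 ≡ c % 8 → b % 8 ≡ d % 8 → (a * b) % 8 ≡ (c * d) % 8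
  mod8-cong-* {a} {b} {c} {d} e f = trans (%-distribˡ-* a b 8) (trans (cong₂ (λ x y → (x * y) % 8) e f) (sym (%-distribˡ-* c d 8)))

  even-pow-mod8 : ∀ {a} k → Odd a → (a ^ (2 * k)) % 8 ≡ 1
  even-pow-mod8 {a} zero o = refl
  even-pow-mod8 {a} (suc k) o = trans (cong (_% 8) (trans (cong (a ^_) (ℕP.*-suc 2 k)) (sym (ℕP.*-assoc a a _))))
    (mod8-cong-* {a * a} {a ^ (2 * k)} {1} {1} (odd-sq-mod8 {a} o) (even-pow-mod8 {a} k o))

  odd-pow-mod8 : ∀ {a} k → Odd a → (a ^ odd k) % 8 ≡ a % 8
  odd-pow-mod8 {a} k o = trans (mod8-cong-* {a} {a ^ (2 * k)} {a} {1} refl (even-pow-mod8 {a} k o)) (cong (_% 8) (ℕP.*-identityʳ a))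

  Odd-*ˡ : ∀ {a b} → Odd (a * b) → Odd a
  Odd-*ˡ {a} {b} o with halves a
  ... | k , inj₂ refl = odd-Odd k
  ... | k , inj₁ refl = contradiction (trans (sym o) (trans (cong (_% 2) (trans (ℕP.*-assoc 2 k b) (ℕP.*-comm 2 (k * b)))) ([m+kn]%n≡m%n 0 (k * b) 2))) λ ()

  Odd-*ʳ : ∀ {a b} → Odd (a * b) → Odd b
  Odd-*ʳ {a} {b} o = Odd-*ˡ {b} {a} (subst Odd (ℕP.*-comm a b) o)

  Odd-^ : ∀ {a} k → Odd a → Odd (a ^ k)
  Odd-^ zero o = refl
  Odd-^ {a} (suc k) o = Odd-* {a} {a ^ k} o (Odd-^ {a} k o)

  Odd-pos : ∀ {a} → Odd a → 0 < a
  Odd-pos {suc a} _ = s≤s z≤n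

  Odd-∣ : ∀ {a b} → a ∣ b → Odd b → Odd a
  Odd-∣ {a} (divides q refl) o = Odd-*ʳ {q} {a} o

  coprime-2 : ∀ {n} → Odd n → Coprime 2 n
  coprime-2 {n} o {d} (d∣2 , d∣n) with ∣⇒≤ d∣2
  ... | _ with d | d∣2 | d∣n
  ... | zero | divides q e | _ = contradiction (trans e (ℕP.*-zeroʳ q)) λ ()
  ... | suc zero | _ | _ = refl
  ... | suc (suc zero) | _ | 2∣n = ⊥-elim (2∤odd (n / 2) (subst (2 ∣_) (odd-half {n} o) 2∣n))
  ... | suc (suc (suc e)) | b | _ = contradiction (∣⇒≤ b) λ { (s≤s (s≤s ())) }

  SquareFree : ℕ → Set
  SquareFree m = ∀ {d} → d * d ∣ m → d ≡ 1

  square-free-part : ∀ n → 0 < n → ∃ λ m → ∃ λ c → n ≡ m * (c * c) × SquareFree m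
  square-free-part = <-rec _ go
    where
    go : ∀ n → (∀ {k} → k < n → 0 < k → ∃ λ m → ∃ λ c → k ≡ m * (c * c) × SquareFree m) → 0 < n →
         ∃ λ m → ∃ λ c → n ≡ m * (c * c) × SquareFree m
    go n rec 0<n with ℕP.anyUpTo? (λ d → (2 + d) * (2 + d) ∣? n) n
    ... | yes (d , _ , divides zero e) = contradiction e (pos-≢ 0<n)
    ... | yes (d , _ , divides (suc q) refl) with rec {suc q} (ℕP.m<m*n (suc q) ((2 + d) * (2 + d)) (s≤s (s≤s z≤n))) (s≤s z≤n)
    ... | m , c , e , sf = m , c * (2 + d) , trans (cong (_* ((2 + d) * (2 + d))) e) (lem m c (2 + d)) , sf
      where lem : ∀ m c d → m * (c * c) * (d * d) ≡ m * (c * d * (c * d))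
            lem = solve-∀
    go n rec 0<n | no none = n , 1 , sym (ℕP.*-identityʳ n) , sf
      where
      sf : SquareFree n
      sf {zero} (divides q e) = contradiction (trans e (ℕP.*-zeroʳ q)) (pos-≢ 0<n)
      sf {suc zero} _ = refl
      sf {suc (suc d)} dd = ⊥-elim (none (d , ℕP.<-≤-trans (ℕP.m<n+m d {2} (s≤s z≤n)) (ℕP.≤-trans (ℕP.m≤m*n (2 + d) (2 + d)) (∣⇒≤ {{>-nonZero 0<n}} dd)) , dd))

  prime-divisor : ∀ d → 0 < d → d ≢ 1 → ∃ λ p → Prime p × p ∣ d
  prime-divisor d 0<d d≢1 = go (PrimeFactorisation.factors pf) (PrimeFactorisation.isFactorisation pf) (PrimeFactorisation.factorsPrime pf)
    where
    open import Data.Nat.ListAction using (product)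
    pf = factorise d {{>-nonZero 0<d}}
    go : ∀ fs → d ≡ product fs → All Prime fs → ∃ λ p → Prime p × p ∣ d
    go [] e _ = contradiction e d≢1
    go (p ∷ ps) e (pp ∷ _) = p , pp , subst (p ∣_) (sym e) (m∣m*n (product ps))

  coprime-by-primes : ∀ {m n} → 0 < n → (∀ p → Prime p → p ∣ m → p ∣ n → ⊥) → Coprime m n
  coprime-by-primes {m} {n} 0<n h {d} (d∣m , d∣n) with d ≟ 1
  ... | yes e = e
  ... | no d≢1 with d ≟ 0
  ... | yes refl = contradiction (0∣⇒≡0 d∣n) (pos-≢ 0<n)
  ... | no d≢0 with prime-divisor d (ℕP.n≢0⇒n>0 d≢0) d≢1
  ... | p , pp , p∣d = ⊥-elim (h p pp (∣-trans p∣d d∣m) (∣-trans p∣d d∣n))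

  isqrt : ∀ m → ∃ λ a → a * a ≤ m × m < suc a * suc a
  isqrt zero = 0 , z≤n , s≤s z≤n
  isqrt (suc m) with isqrt m
  ... | a , lo , hi with suc m ℕP.<? suc a * suc a
  ... | yes lt = a , ℕP.m≤n⇒m≤1+n lo , lt
  ... | no nlt = suc a , ℕP.≮⇒≥ nlt , ℕP.≤-<-trans hi (ℕP.*-mono-< (ℕP.n<1+n (suc a)) (ℕP.n<1+n (suc a)))

module Conics where

  open import Data.Nat as ℕ using (ℕ; zero; suc; z≤n; s≤s; _≤_; _<_; >-nonZero)
  open import Data.Nat.Divisibility using (_∣_; divides; m∣m*n)
  open import Data.Integer as ℤ using (ℤ; +_; -[1+_]; +[1+_]; _+_; _*_; _-_; -_; ∣_∣; 0ℤ; 1ℤ; -1ℤ)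
  open import Data.Integer.DivMod using (_%ℕ_; _/ℕ_; n%ℕd<d; a≡a%ℕn+[a/ℕn]*n)
  open import Data.Integer.Tactic.RingSolver using (solve-∀)
  open import Data.Fin as Fin using (Fin; toℕ; fromℕ<; combine; remQuot)
  import Data.Nat.Tactic.RingSolver as ℕR
  import Data.Fin.Properties as FinP
  open JacobiSymbol
  open Arithmetic

  -- Small vectors and Legendre's theorem on the conic

  Cong0⇒∣ : ∀ {n a} → Cong n a 0ℤ → n ∣ ∣ a ∣
  Cong0⇒∣ {n} {a} (by q e) = divides ∣ q ∣ (trans (cong ∣_∣ (trans e (ℤP.+-identityˡ (q * + n)))) (ℤP.abs-* q (+ n)))

  cong-mult : ∀ n q → Cong n (q * + n) 0ℤ
  cong-mult n q = by q (sym (ℤP.+-identityˡ (q * + n)))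

  cong-mod : ∀ n .{{_ : ℕ.NonZero n}} {a b} → a %ℕ n ≡ b %ℕ n → Cong n (a - b) 0ℤ
  cong-mod n {a} {b} e = by (a /ℕ n - b /ℕ n) (trans (cong₂ _-_ (a≡a%ℕn+[a/ℕn]*n a n) (a≡a%ℕn+[a/ℕn]*n b n))
     (trans (cong (λ z → + z + a /ℕ n * + n - (+ (b %ℕ n) + b /ℕ n * + n)) e) (lem (+ (b %ℕ n)) (a /ℕ n) (b /ℕ n) (+ n))))
    where lem : ∀ r p q n → r + p * n - (r + q * n) ≡ 0ℤ + (p - q) * n
          lem = solve-∀

  abs-sq : ∀ z → + (∣ z ∣ ℕ.* ∣ z ∣) ≡ z * z
  abs-sq (+ n) = ℤP.pos-* n n
  abs-sq -[1+ n ] = refl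

  diff-bound : ∀ {a x y} → x ≤ a → y ≤ a → ∣ + x - + y ∣ ≤ a
  diff-bound {a} {x} {y} x≤ y≤ with ℕP.≤-total x y
  ... | inj₁ x≤y = subst (_≤ a) (sym (trans (cong ∣_∣ (trans (ℤP.m-n≡m⊖n x y) (ℤP.⊖-≤ x≤y))) (ℤP.∣-i∣≡∣i∣ (+ (y ℕ.∸ x))))) (ℕP.≤-trans (ℕP.m∸n≤m y x) y≤)
  ... | inj₂ y≤x = subst (_≤ a) (sym (cong ∣_∣ (trans (ℤP.m-n≡m⊖n x y) (ℤP.⊖-≥ y≤x)))) (ℕP.≤-trans (ℕP.m∸n≤m x y) x≤)

  record SmallVector (n₁ n₂ n₃ a b c : ℕ) (L₁ L₂ L₃ : ℤ → ℤ → ℤ → ℤ) : Set where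
    constructor small
    field
      x y z : ℤ
      nonzero : ¬ (x ≡ 0ℤ × y ≡ 0ℤ × z ≡ 0ℤ)
      x≤ : ∣ x ∣ ≤ a
      y≤ : ∣ y ∣ ≤ b
      z≤ : ∣ z ∣ ≤ c
      c₁ : Cong n₁ (L₁ x y z) 0ℤ
      c₂ : Cong n₂ (L₂ x y z) 0ℤ
      c₃ : Cong n₃ (L₃ x y z) 0ℤ

  Additive : (ℤ → ℤ → ℤ → ℤ) → Set
  Additive L = ∀ x y z x' y' z' → L x y z - L x' y' z' ≡ L (x - x') (y - y') (z - z')

  -- Pigeonhole: the box has more points than there are triples of residues, and two points of one
  -- class differ by the vector sought.
  small-vector : ∀ n₁ n₂ n₃ .{{_ : ℕ.NonZero n₁}} .{{_ : ℕ.NonZero n₂}} .{{_ : ℕ.NonZero n₃}} a b c L₁ L₂ L₃ →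
    Additive L₁ → Additive L₂ → Additive L₃ →
    n₁ ℕ.* (n₂ ℕ.* n₃) < suc a ℕ.* (suc b ℕ.* suc c) → SmallVector n₁ n₂ n₃ a b c L₁ L₂ L₃
  small-vector n₁ n₂ n₃ a b c L₁ L₂ L₃ add₁ add₂ add₃ lt = go (FinP.pigeonhole lt class)
    where
    Box : Set
    Box = Fin (suc a ℕ.* (suc b ℕ.* suc c))
    rest : Box → Fin (suc b ℕ.* suc c)
    rest i = proj₂ (remQuot {suc a} (suc b ℕ.* suc c) i)
    X : Box → Fin (suc a)
    X i = proj₁ (remQuot {suc a} (suc b ℕ.* suc c) i)
    Y : Box → Fin (suc b)
    Y i = proj₁ (remQuot {suc b} (suc c) (rest i))
    Z : Box → Fin (suc c)
    Z i = proj₂ (remQuot {suc b} (suc c) (rest i))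
    rebuild : ∀ i → combine (X i) (combine (Y i) (Z i)) ≡ i
    rebuild i = trans (cong (combine (X i)) (FinP.combine-remQuot {suc b} (suc c) (rest i))) (FinP.combine-remQuot {suc a} (suc b ℕ.* suc c) i)
    V : (ℤ → ℤ → ℤ → ℤ) → Box → ℤ
    V L i = L (+ toℕ (X i)) (+ toℕ (Y i)) (+ toℕ (Z i))
    residue : ∀ n .{{_ : ℕ.NonZero n}} → (ℤ → ℤ → ℤ → ℤ) → Box → Fin n
    residue n L i = fromℕ< (n%ℕd<d (V L i) n)
    class : Box → Fin (n₁ ℕ.* (n₂ ℕ.* n₃))
    class i = combine (residue n₁ L₁ i) (combine (residue n₂ L₂ i) (residue n₃ L₃ i))
    bd : ∀ {n} (i : Fin (suc n)) → toℕ i ≤ n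
    bd i = ℕP.≤-pred (FinP.toℕ<n i)
    eqf : ∀ {n} (i j : Fin n) → + toℕ i - + toℕ j ≡ 0ℤ → i ≡ j
    eqf i j e = FinP.toℕ-injective (ℤP.+-injective (ℤP.i-j≡0⇒i≡j (+ toℕ i) (+ toℕ j) e))
    k : ∀ n .{{_ : ℕ.NonZero n}} {L} → Additive L → ∀ i j → residue n L i ≡ residue n L j →
        Cong n (L (+ toℕ (X i) - + toℕ (X j)) (+ toℕ (Y i) - + toℕ (Y j)) (+ toℕ (Z i) - + toℕ (Z j))) 0ℤ
    k n {L} add i j e = cong-trans (cong-≡ (sym (add (+ toℕ (X i)) (+ toℕ (Y i)) (+ toℕ (Z i)) (+ toℕ (X j)) (+ toℕ (Y j)) (+ toℕ (Z j))))) (cong-mod n {V L i} {V L j}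
       (trans (sym (FinP.toℕ-fromℕ< (n%ℕd<d (V L i) n))) (trans (cong toℕ e) (FinP.toℕ-fromℕ< (n%ℕd<d (V L j) n)))))
    go : (∃ λ i → ∃ λ j → i Fin.< j × class i ≡ class j) → SmallVector n₁ n₂ n₃ a b c L₁ L₂ L₃
    go (i , j , i<j , e) with FinP.combine-injective (residue n₁ L₁ i) _ (residue n₁ L₁ j) _ e
    ... | p , qr with FinP.combine-injective (residue n₂ L₂ i) _ (residue n₂ L₂ j) _ qr
    ... | q , r = small (+ toℕ (X i) - + toℕ (X j)) (+ toℕ (Y i) - + toℕ (Y j)) (+ toℕ (Z i) - + toℕ (Z j)) nz
        (diff-bound (bd (X i)) (bd (X j))) (diff-bound (bd (Y i)) (bd (Y j))) (diff-bound (bd (Z i)) (bd (Z j)))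
        (k n₁ {L₁} add₁ i j p) (k n₂ {L₂} add₂ i j q) (k n₃ {L₃} add₃ i j r)
      where
      nz : ¬ (+ toℕ (X i) - + toℕ (X j) ≡ 0ℤ × + toℕ (Y i) - + toℕ (Y j) ≡ 0ℤ × + toℕ (Z i) - + toℕ (Z j) ≡ 0ℤ)
      nz (ex , ey , ez) = ℕP.<⇒≢ i<j (cong toℕ (trans (sym (rebuild i)) (trans (cong₂ combine (eqf (X i) (X j) ex) (cong₂ combine (eqf (Y i) (Y j) ey) (eqf (Z i) (Z j) ez))) (rebuild j))))

  -- Odd squares are odd and even squares are divisible by 4. The use is to make the bounds of the
  -- box strict.
  twice-odd-not-square : ∀ {m} → Odd m → ∀ e → e ℕ.* e ≢ 2 ℕ.* m
  twice-odd-not-square {m} om e eq with halves e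
  ... | k , inj₂ refl = 2∤odd (2 ℕ.* (k ℕ.* k) ℕ.+ 2 ℕ.* k) (subst (2 ∣_) (lem k) (subst (2 ∣_) (sym eq) (m∣m*n m)))
    where lem : ∀ k → suc (2 ℕ.* k) ℕ.* suc (2 ℕ.* k) ≡ suc (2 ℕ.* (2 ℕ.* (k ℕ.* k) ℕ.+ 2 ℕ.* k))
          lem = ℕR.solve-∀
  ... | k , inj₁ refl = 2∤odd (m ℕ./ 2) (subst (2 ∣_) (odd-half {m} om) (divides (k ℕ.* k) (cancelˡ {2} (s≤s z≤n) (trans (sym eq) (lem k)))))
    where lem : ∀ k → 2 ℕ.* k ℕ.* (2 ℕ.* k) ≡ 2 ℕ.* (k ℕ.* k ℕ.* 2)
          lem = ℕR.solve-∀

  record Solution (B T : ℕ) : Set where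
    constructor sol
    field
      e f g : ℕ
      0<e : 0 < e
      eqn : e ℕ.* e ≡ B ℕ.* (f ℕ.* f) ℕ.+ T ℕ.* (g ℕ.* g)

  pos-sq-sum : ∀ B T f g → + (B ℕ.* (∣ f ∣ ℕ.* ∣ f ∣) ℕ.+ T ℕ.* (∣ g ∣ ℕ.* ∣ g ∣)) ≡ + B * (f * f) + + T * (g * g)
  pos-sq-sum B T f g = trans (ℤP.pos-+ (B ℕ.* (∣ f ∣ ℕ.* ∣ f ∣)) _) (cong₂ _+_ (trans (ℤP.pos-* B _) (cong (+ B *_) (abs-sq f))) (trans (ℤP.pos-* T _) (cong (+ T *_) (abs-sq g))))

  solution-ℤ : ∀ {B T} → 0 < B → 0 < T → ∀ e f g → ¬ (e ≡ 0ℤ × f ≡ 0ℤ × g ≡ 0ℤ) → e * e ≡ + B * (f * f) + + T * (g * g) → Solution B T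
  solution-ℤ {B} {T} 0<B 0<T e f g nz eq = sol (∣ e ∣) (∣ f ∣) (∣ g ∣) (ℕP.n≢0⇒n>0 e≢0) eq'
    where
    eq' : ∣ e ∣ ℕ.* ∣ e ∣ ≡ B ℕ.* (∣ f ∣ ℕ.* ∣ f ∣) ℕ.+ T ℕ.* (∣ g ∣ ℕ.* ∣ g ∣)
    eq' = ℤP.+-injective (trans (abs-sq e) (trans eq (sym (pos-sq-sum B T f g))))
    zero-sq : ∀ {c} → 0 < c → ∀ x → c ℕ.* (∣ x ∣ ℕ.* ∣ x ∣) ≡ 0 → x ≡ 0ℤ
    zero-sq {c} 0<c x z = ℤP.∣i∣≡0⇒i≡0 ([ (λ q → q) , (λ q → q) ]′ (ℕP.m*n≡0⇒m≡0∨n≡0 ∣ x ∣ (cancelˡ 0<c (trans z (sym (ℕP.*-zeroʳ c))))))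
    e≢0 : ∣ e ∣ ≢ 0
    e≢0 z = nz (ℤP.∣i∣≡0⇒i≡0 z , zero-sq 0<B f (ℕP.m+n≡0⇒m≡0 _ s0) , zero-sq 0<T g (ℕP.m+n≡0⇒n≡0 (B ℕ.* (∣ f ∣ ℕ.* ∣ f ∣)) s0))
      where s0 : B ℕ.* (∣ f ∣ ℕ.* ∣ f ∣) ℕ.+ T ℕ.* (∣ g ∣ ℕ.* ∣ g ∣) ≡ 0
            s0 = trans (sym eq') (cong (λ q → q ℕ.* q) z)

  -- Multiplicativity of the norm from ℚ(√T), applied to (e² − T g²)(f² − T) = B (f² − T)².
  solution-twist : ∀ {B T} → 0 < B → 0 < T → ∀ e f g → e * e + + B * + T ≡ + B * (f * f) + + T * (g * g) → Solution B T
  solution-twist {B} {T} 0<B 0<T e f g eq with f * f - + T ℤ.≟ 0ℤ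
  ... | no nz = solution-ℤ 0<B 0<T (e * f - g * + T) (f * f - + T) (g * f - e) (λ (_ , z , _) → nz z)
       (trans (lem e f g (+ B) (+ T)) (trans (cong (λ z → + B * ((f * f - + T) * (f * f - + T)) + + T * ((g * f - e) * (g * f - e)) + (f * f - + T) * (z - (+ B * (f * f) + + T * (g * g)))) eq)
         (lem2 (+ B * ((f * f - + T) * (f * f - + T)) + + T * ((g * f - e) * (g * f - e))) (f * f - + T) (+ B * (f * f) + + T * (g * g)))))
    where
    lem : ∀ e f g B T → (e * f - g * T) * (e * f - g * T) ≡ B * ((f * f - T) * (f * f - T)) + T * ((g * f - e) * (g * f - e)) + (f * f - T) * ((e * e + B * T) - (B * (f * f) + T * (g * g)))
    lem = solve-∀
    lem2 : ∀ a b c → a + b * (c - c) ≡ a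
    lem2 = solve-∀
  -- The twisted vector could be zero here, but then `T` is the square of `f` and `(f, 0, 1)` lies
  -- on the conic.
  ... | yes z = solution-ℤ 0<B 0<T f 0ℤ 1ℤ (λ { (_ , _ , ()) }) (trans (lem (f * f) (+ T)) (trans (cong (_+ + T) z) (lem2 (+ B) (+ T))))
    where
    lem : ∀ x t → x ≡ x - t + t
    lem = solve-∀
    lem2 : ∀ b t → 0ℤ + t ≡ b * (0ℤ * 0ℤ) + t * (1ℤ * 1ℤ)
    lem2 = solve-∀

  ∣-*-coprime : ∀ {m n} → Coprime m n → ∀ z → Cong m z 0ℤ → Cong n z 0ℤ → Cong (m ℕ.* n) z 0ℤ
  ∣-*-coprime {m} {n} c z cm cn = ∣⇒Cong0 (coprime-lcm {m} {n} c (Cong0⇒∣ cm) (Cong0⇒∣ cn))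

  cong-cancel-sq : ∀ {n} r z → Coprime r n → Cong n (+ r * + r * z) 0ℤ → Cong n z 0ℤ
  cong-cancel-sq {n} r z c e = ∣⇒Cong0 (coprime-divisor {n} {r ℕ.* r} {∣ z ∣} (coprime-sym {r ℕ.* r} {n} (coprime-*ˡ {r} {r} {n} c c))
     (subst (n ∣_) (trans (ℤP.abs-* (+ r * + r) z) (cong (ℕ._* ∣ z ∣) (ℤP.abs-* (+ r) (+ r)))) (Cong0⇒∣ e)))

  cong0-sub : ∀ {n a b} → Cong n a b → Cong n (a - b) 0ℤ
  cong0-sub {n} {a} {b} (by q refl) = by q (lem b (q * + n))
    where lem : ∀ b x → b + x - b ≡ 0ℤ + x
          lem = solve-∀

  cong0-sub⁻ : ∀ {n a b} → Cong n (a - b) 0ℤ → Cong n a b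
  cong0-sub⁻ {n} {a} {b} (by q e) = by q (trans (lem a b) (trans (cong (_+_ b) e) (cong (_+_ b) (ℤP.+-identityˡ _))))
    where lem : ∀ a b → a ≡ b + (a - b)
          lem = solve-∀

  -- Legendre's theorem, with the square roots of 2C mod T and of T mod C given as fractions k / c and E / h. The box is
  -- chosen so that e² − 2C f² − T g² is 0 or −2CT at the small vector.
  legendre-conic : ∀ {C T c k h E} → Odd C → Odd T → Coprime C T →
    Coprime c T → Cong T (+ 2 * + C * (+ c * + c)) (+ k * + k) →
    Coprime h C → Cong C (+ T * (+ h * + h)) (+ E * + E) → Solution (2 ℕ.* C) T
  legendre-conic {C} {T} {c} {k} {h} {E} oC oT cCT ccT congT chC congC =
    go (isqrt (B ℕ.* T)) (isqrt T) (isqrt B)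
    where
    B = 2 ℕ.* C
    0<C = Odd-pos {C} oC
    0<T = Odd-pos {T} oT
    0<B : 0 < B
    0<B = *-pos {2} (s≤s z≤n) 0<C
    L₁ L₂ L₃ : ℤ → ℤ → ℤ → ℤ
    L₁ e f g = + c * e - + k * f
    L₂ e f g = + h * e - + E * g
    -- As `T` is odd, the form is `e² - g²` modulo 2, so this condition supplies the factor 2 of
    -- `2CT`.
    L₃ e f g = e - g
    add₁ : Additive L₁
    add₁ = lem (+ c) (+ k)
      where lem : ∀ c k x y z x' y' z' → c * x - k * y - (c * x' - k * y') ≡ c * (x - x') - k * (y - y')
            lem = solve-∀
    add₂ : Additive L₂
    add₂ = lem (+ h) (+ E)
      where lem : ∀ c k x y z x' y' z' → c * x - k * z - (c * x' - k * z') ≡ c * (x - x') - k * (z - z')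
            lem = solve-∀
    add₃ : Additive L₃
    add₃ x _ z x' _ z' = lem x z x' z'
      where lem : ∀ x z x' z' → x - z - (x' - z') ≡ (x - x') - (z - z')
            lem = solve-∀
    sq-lt : ∀ {m n} → m ℕ.* m < n ℕ.* n → m < n
    sq-lt {m} {n} lt = ℕP.≰⇒> λ n≤m → ℕP.<⇒≱ lt (ℕP.*-mono-≤ n≤m n≤m)
    go : (∃ λ a → a ℕ.* a ≤ B ℕ.* T × B ℕ.* T < suc a ℕ.* suc a) → (∃ λ b → b ℕ.* b ≤ T × T < suc b ℕ.* suc b) → (∃ λ d → d ℕ.* d ≤ B × B < suc d ℕ.* suc d) → Solution B T
    go (a , a≤ , <a) (b , b≤ , <b) (d , d≤ , <d) = finish (small-vector T C 2 {{>-nonZero 0<T}} {{>-nonZero 0<C}} a b d L₁ L₂ L₃ add₁ add₂ add₃ count)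
      where
      -- Compared as squares: the three integer square roots belong to `2CT`, `T` and `2C`, whose
      -- product is the square of `2CT`.
      count : T ℕ.* (C ℕ.* 2) < suc a ℕ.* (suc b ℕ.* suc d)
      count = sq-lt (subst₂ _<_ (lemA T C) (lemB (suc a) (suc b) (suc d)) (ℕP.*-mono-< <a (ℕP.*-mono-< <b <d)))
                where
                lemA : ∀ T C → (2 ℕ.* C ℕ.* T) ℕ.* (T ℕ.* (2 ℕ.* C)) ≡ T ℕ.* (C ℕ.* 2) ℕ.* (T ℕ.* (C ℕ.* 2))
                lemA = ℕR.solve-∀
                lemB : ∀ a b d → a ℕ.* a ℕ.* (b ℕ.* b ℕ.* (d ℕ.* d)) ≡ a ℕ.* (b ℕ.* d) ℕ.* (a ℕ.* (b ℕ.* d))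
                lemB = ℕR.solve-∀
      finish : SmallVector T C 2 a b d L₁ L₂ L₃ → Solution B T
      finish (small e f g nz e≤ f≤ g≤ c₁ c₂ c₃) = decide (∣-*-coprime {2} {C ℕ.* T} (coprime-*ʳ {2} {C} {T} (coprime-2 oC) (coprime-2 oT)) Q q2 (∣-*-coprime {C} {T} cCT Q qC qT))
        where
        Q = e * e - + 2 * + C * (f * f) - + T * (g * g)
        qT : Cong T Q 0ℤ
        qT = cong-cancel-sq c Q ccT (cong-trans (cong-≡ (lem (+ c) e (+ C) f (+ T) g (+ k))) (cong-trans (cong-+ (cong-+ (cong0-sub (cong-* ce ce)) (cong0-sub (cong-* (cong-sym congT) (cong-refl {a = f * f})))) (cong-mult T (- (+ c * + c * g * g)))) cong-refl))
          where
          ce : Cong T (+ c * e) (+ k * f)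
          ce = cong0-sub⁻ c₁
          lem : ∀ c e C f T g k → c * c * (e * e - + 2 * C * (f * f) - T * (g * g)) ≡ (c * e * (c * e) - k * f * (k * f)) + (k * k * (f * f) - + 2 * C * (c * c) * (f * f)) + (- (c * c * g * g)) * T
          lem = solve-∀
        qC : Cong C Q 0ℤ
        qC = cong-cancel-sq h Q chC (cong-trans (cong-≡ (lem (+ h) e (+ C) f (+ T) g (+ E))) (cong-+ (cong-+ (cong0-sub (cong-* he he)) (cong0-sub (cong-* (cong-sym congC) (cong-refl {a = g * g})))) (cong-mult C (- (+ h * + h * (+ 2 * (f * f)))))))
          where
          he : Cong C (+ h * e) (+ E * g)
          he = cong0-sub⁻ c₂
          lem : ∀ h e C f T g E → h * h * (e * e - + 2 * C * (f * f) - T * (g * g)) ≡ (h * e * (h * e) - E * g * (E * g)) + (E * E * (g * g) - T * (h * h) * (g * g)) + (- (h * h * (+ 2 * (f * f)))) * C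
          lem = solve-∀
        q2 : Cong 2 Q 0ℤ
        q2 = cong-trans (cong-≡ (lem e (+ C) f (+ T) g)) (cong-trans (cong-+ (cong-+ (cong-* (cong-refl {a = e + g}) c₃) (cong-mult 2 (- (+ C * (f * f))))) (cong-* (cong0-sub (cong-sym oddT)) (cong-refl {a = g * g}))) (cong-≡ (lem2 e g)))
          where
          oddT : Cong 2 (+ T) 1ℤ
          oddT = by (+ (T ℕ./ 2)) (trans (cong +_ (odd-half {T} oT)) (trans (ℤP.pos-+ 1 (2 ℕ.* (T ℕ./ 2))) (cong (_+_ 1ℤ) (trans (ℤP.pos-* 2 (T ℕ./ 2)) (ℤP.*-comm (+ 2) (+ (T ℕ./ 2)))))))
          lem : ∀ e C f T g → e * e - + 2 * C * (f * f) - T * (g * g) ≡ (e + g) * (e - g) + (- (C * (f * f))) * + 2 + (1ℤ - T) * (g * g)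
          lem = solve-∀
          lem2 : ∀ e g → (e + g) * 0ℤ + 0ℤ + 0ℤ * (g * g) ≡ 0ℤ
          lem2 = solve-∀
        ē = ∣ e ∣
        f̄ = ∣ f ∣
        ḡ = ∣ g ∣
        N = B ℕ.* T
        -- Neither `2CT` nor `2C` is a square, being twice an odd number. The strict bounds leave
        -- only the quotients 0 and -1 in `decide`.
        e<N : ē ℕ.* ē < N
        e<N = ℕP.≤∧≢⇒< (ℕP.≤-trans (ℕP.*-mono-≤ e≤ e≤) a≤) (λ z → twice-odd-not-square {C ℕ.* T} (Odd-* {C} {T} oC oT) ē (trans z (ℕP.*-assoc 2 C T)))
        f≤T : f̄ ℕ.* f̄ ≤ T
        f≤T = ℕP.≤-trans (ℕP.*-mono-≤ f≤ f≤) b≤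
        g<B : ḡ ℕ.* ḡ < B
        g<B = ℕP.≤∧≢⇒< (ℕP.≤-trans (ℕP.*-mono-≤ g≤ g≤) d≤) (twice-odd-not-square {C} oC ḡ)
        R = B ℕ.* (f̄ ℕ.* f̄) ℕ.+ T ℕ.* (ḡ ℕ.* ḡ)
        R<2N : R < N ℕ.+ N
        R<2N = ℕP.+-mono-≤-< (ℕP.*-monoʳ-≤ B f≤T) (subst (T ℕ.* (ḡ ℕ.* ḡ) <_) (ℕP.*-comm T B) (ℕP.*-monoʳ-< T {{>-nonZero 0<T}} g<B))
        posN : + (2 ℕ.* (C ℕ.* T)) ≡ + N
        posN = cong +_ (sym (ℕP.*-assoc 2 C T))
        Qpos : Q ≡ + (ē ℕ.* ē) - + R
        Qpos = trans (lem (e * e) (+ 2 * + C) f (+ T) g) (sym (cong₂ _-_ (abs-sq e) (trans (pos-sq-sum B T f g) (cong (λ z → z * (f * f) + + T * (g * g)) (ℤP.pos-* 2 C)))))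
          where lem : ∀ x B f T g → x - B * (f * f) - T * (g * g) ≡ x - (B * (f * f) + T * (g * g))
                lem = solve-∀
        decide : Cong (2 ℕ.* (C ℕ.* T)) Q 0ℤ → Solution B T
        decide (by (+ zero) eq) = solution-ℤ 0<B 0<T e f g nz (trans (sym (abs-sq e)) (trans (ℤP.i-j≡0⇒i≡j (+ (ē ℕ.* ē)) (+ R) (trans (sym Qpos) eq)) (pos-sq-sum B T f g)))
        decide (by +[1+ m ] eq) = contradiction e<N (ℕP.≤⇒≯ (subst (N ≤_) (sym ee) (ℕP.≤-trans (ℕP.m≤m+n N (m ℕ.* N)) (ℕP.m≤n+m (suc m ℕ.* N) R))))
          where
          ee : ē ℕ.* ē ≡ R ℕ.+ suc m ℕ.* N
          ee = ℤP.+-injective (trans (lem (+ (ē ℕ.* ē)) (+ R)) (trans (cong (_+_ (+ R)) (trans (sym Qpos) (trans eq (trans (ℤP.+-identityˡ _) (trans (cong (+[1+ m ] *_) posN) (sym (ℤP.pos-* (suc m) N))))))) (sym (ℤP.pos-+ R _))))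
            where lem : ∀ x r → x ≡ r + (x - r)
                  lem = solve-∀
        decide (by -[1+ zero ] eq) = solution-twist 0<B 0<T e f g (trans (cong₂ _+_ (sym (abs-sq e)) (sym (ℤP.pos-* B T))) (trans (lem (+ (ē ℕ.* ē)) (+ R) (+ N)) (trans (cong (λ z → z + + R + + N) (trans (sym Qpos) (trans eq (trans (ℤP.+-identityˡ _) (cong (-1ℤ *_) posN))))) (trans (lem2 (+ R) (+ N)) (pos-sq-sum B T f g)))))
          where
          lem : ∀ x r n → x + n ≡ x - r + r + n
          lem = solve-∀
          lem2 : ∀ r n → -1ℤ * n + r + n ≡ r
          lem2 = solve-∀
        decide (by -[1+ suc m ] eq) = contradiction R<2N (ℕP.≤⇒≯ (subst (N ℕ.+ N ≤_) ee (ℕP.≤-trans (ℕP.+-monoʳ-≤ N (ℕP.m≤m+n N (m ℕ.* N))) (ℕP.m≤n+m (suc (suc m) ℕ.* N) (ē ℕ.* ē)))))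
          where
          ee : ē ℕ.* ē ℕ.+ suc (suc m) ℕ.* N ≡ R
          ee = ℤP.+-injective (trans (ℤP.pos-+ (ē ℕ.* ē) _) (trans (lem (+ (ē ℕ.* ē)) (+ R) (+ (suc (suc m) ℕ.* N))) (trans (cong (λ z → z + + R + + (suc (suc m) ℕ.* N)) (trans (sym Qpos) (trans eq (trans (ℤP.+-identityˡ _) (trans (cong (-[1+ suc m ] *_) posN) (trans (sym (ℤP.neg-distribˡ-* (+ suc (suc m)) (+ N))) (cong -_ (sym (ℤP.pos-* (suc (suc m)) N)))))))))
               (lem2 (+ R) (+ (suc (suc m) ℕ.* N))))))
            where
            lem : ∀ x r n → x + n ≡ x - r + r + n
            lem = solve-∀
            lem2 : ∀ r n → - n + r + n ≡ r
            lem2 = solve-∀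

open import Data.Nat
open import Data.Nat.Divisibility
open import Data.Nat.Tactic.RingSolver using (solve-∀)
open import Data.Integer as ℤ using (ℤ; +_; 0ℤ; 1ℤ; -1ℤ; -[1+_]) renaming (∣_∣ to abs)
open import Data.Nat.DivMod using (m∣n⇒o%n%m≡o%m; %-remove-+ˡ; %-remove-+ʳ; m%n<n; [m+kn]%n≡m%n; %-distribˡ-*; %-distribˡ-+; m≡m%n+[m/n]*n; m*n/n≡m)
open import Data.Fin using (Fin; toℕ; fromℕ<)
open import Data.Fin.Properties using (any?; toℕ-fromℕ<)
open import Defs
import Data.Integer.Tactic.RingSolver as ℤR
open JacobiSymbol
open Arithmetic
open Conics

-- Primitive points of the conic

sq-∣ : ∀ {d e} → 0 < d → d * d ∣ e * e → d ∣ e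
sq-∣ {d} {e} 0<d (divides q eq) with square-quotient {d} {q} {e} 0<d (sym eq)
... | v , _ , refl = m∣m*n v

SquareFree-2* : ∀ {C} → Odd C → SquareFree C → SquareFree (2 * C)
SquareFree-2* {C} oC sf {d} dd with halves d
... | k , inj₂ refl = sf (coprime-divisor {odd k * odd k} {2} {C} (coprime-sym {2} {odd k * odd k} (coprime-2 (Odd-* {odd k} {odd k} (odd-Odd k) (odd-Odd k)))) dd)
... | k , inj₁ refl = ⊥-elim (2∤odd (C / 2) (subst (2 ∣_) (odd-half {C} oC) (∣-trans (m∣m*n (k * k)) (*-cancelˡ-∣ 2 (subst (_∣ 2 * C) (lem k) dd)))))
  where lem : ∀ k → 2 * k * (2 * k) ≡ 2 * (2 * (k * k))
        lem = solve-∀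

record Primitive (B T : ℕ) : Set where
  constructor prim
  field
    e f g : ℕ
    0<e : 0 < e
    eqn : e * e ≡ B * (f * f) + T * (g * g)
    c-ef : Coprime e f
    c-eg : Coprime e g
    c-fg : Coprime f g

-- The common factor of all three coordinates is divided out. After that the square of a common
-- divisor of `e` and `f` divides `T`, that of `e` and `g` divides `B`, and a common divisor of `f`
-- and `g` also divides `e`. The clause on `f` preserves any coprimality already achieved.
primitive-solution : ∀ {B T} → SquareFree B → SquareFree T → (s : Solution B T) → Σ (Primitive B T) λ p → Primitive.f p ∣ Solution.f s
primitive-solution {B} {T} sB sT (sol e f g 0<e eqn) with gcd-split f e 0<e
... | a , f₁ , e₁ , refl , refl , c₁ , 0<a with gcd-split g a 0<a
... | d , g₁ , k , refl , refl , c₂ , 0<d = prim E F g₁ 0<E eq' cef ceg cfg , divides d (lemf d k f₁)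
  where
  E = k * e₁
  F = k * f₁
  lemf : ∀ d k f → d * k * f ≡ d * (k * f)
  lemf = solve-∀
  0<E : 0 < E
  0<E = *-pos (pos-*ʳ d 0<a) (pos-*ʳ (d * k) 0<e)
  eq' : E * E ≡ B * (F * F) + T * (g₁ * g₁)
  eq' = cancelˡ {d * d} (*-pos 0<d 0<d) (trans (lem1 d k e₁) (trans eqn (lem2 d k f₁ g₁ B T)))
    where
    lem1 : ∀ d k e → d * d * (k * e * (k * e)) ≡ d * k * e * (d * k * e)
    lem1 = solve-∀
    lem2 : ∀ d k f g B T → B * (d * k * f * (d * k * f)) + T * (d * g * (d * g)) ≡ d * d * (B * (k * f * (k * f)) + T * (g * g))
    lem2 = solve-∀
  triple : ∀ {m} → m ∣ E → m ∣ F → m ∣ g₁ → m ≡ 1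
  triple {m} mE mF mg = c₁ (coprime-divisor {m} {k} {f₁} cmk mF , coprime-divisor {m} {k} {e₁} cmk mE)
    where cmk : Coprime m k
          cmk = coprime-∣ˡ {g₁} {m} {k} c₂ mg
  cef : Coprime E F
  cef {m} (mE , mF) = sT (coprime-divisorʳ {m * m} {g₁ * g₁} {T} (coprime-*ˡ {m} {m} cm cm)
      (∣m+n∣m⇒∣n (subst (m * m ∣_) eq' (*-pres-∣ mE mE)) (∣n⇒∣m*n B (*-pres-∣ mF mF))))
    where cm : Coprime m (g₁ * g₁)
          cm = coprime-*ʳ {m} {g₁} {g₁} cm' cm'
            where cm' : Coprime m g₁
                  cm' (a , b) = triple (∣-trans a mE) (∣-trans a mF) b
  ceg : Coprime E g₁
  ceg {m} (mE , mg) = sB (coprime-divisorʳ {m * m} {F * F} {B} (coprime-*ˡ {m} {m} cm cm)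
      (∣m+n∣m⇒∣n (subst (m * m ∣_) (trans eq' (ℕP.+-comm (B * (F * F)) _)) (*-pres-∣ mE mE)) (∣n⇒∣m*n T (*-pres-∣ mg mg))))
    where cm : Coprime m (F * F)
          cm = coprime-*ʳ {m} {F} {F} cm' cm'
            where cm' : Coprime m F
                  cm' (a , b) = triple (∣-trans a mE) b (∣-trans a mg)
  cfg : Coprime F g₁
  cfg {zero} (mF , mg) = contradiction (trans eq' (cong₂ (λ x y → B * (x * x) + T * (y * y)) (0∣⇒≡0 mF) (0∣⇒≡0 mg))) (λ z → pos-≢ (*-pos 0<E 0<E) (trans z (cong₂ _+_ (ℕP.*-zeroʳ B) (ℕP.*-zeroʳ T))))
  cfg {suc m} (mF , mg) = triple (sq-∣ (s≤s z≤n) (subst (suc m * suc m ∣_) (sym eq') (∣m∣n⇒∣m+n (∣n⇒∣m*n B (*-pres-∣ mF mF)) (∣n⇒∣m*n T (*-pres-∣ mg mg))))) mF mg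

-- `μ` is what remains of `K` when the primes shared with `f` are removed by repeated division by
-- the gcd. It is the parameter of the rotation in `move-off`.
split-off : ∀ f K → 0 < K → ∃ λ μ → Coprime μ f × (∀ p → Prime p → p ∣ K → p ∣ μ ⊎ p ∣ f)
split-off f = <-rec _ go
  where
  go : ∀ K → (∀ {k} → k < K → 0 < k → ∃ λ μ → Coprime μ f × (∀ p → Prime p → p ∣ k → p ∣ μ ⊎ p ∣ f)) → 0 < K →
       ∃ λ μ → Coprime μ f × (∀ p → Prime p → p ∣ K → p ∣ μ ⊎ p ∣ f)
  go K rec 0<K with gcd-split f K 0<K
  ... | zero , _ , _ , _ , _ , _ , ()
  ... | suc zero , f' , K' , refl , refl , c , _ = 1 * K' , coprime-sym {1 * f'} {1 * K'} (subst₂ Coprime (sym (ℕP.*-identityˡ f')) (sym (ℕP.*-identityˡ K')) c) , λ p _ d → inj₁ d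
  ... | suc (suc g) , f' , K' , refl , refl , c , _ with rec {K'} (subst (K' <_) (ℕP.*-comm K' (2 + g)) (ℕP.m<m*n K' (2 + g) {{>-nonZero (pos-*ʳ (2 + g) 0<K)}} (s≤s (s≤s z≤n)))) (pos-*ʳ (2 + g) 0<K)
  ... | μ , cμ , h = μ , cμ , λ p pp d → step p pp (euclidsLemma (2 + g) K' pp d)
    where
    step : ∀ p → Prime p → p ∣ 2 + g ⊎ p ∣ K' → p ∣ μ ⊎ p ∣ (2 + g) * f'
    step p pp (inj₁ d) = inj₂ (∣m⇒∣m*n f' d)
    step p pp (inj₂ d) = h p pp d

prime-∤1 : ∀ {p} → Prime p → ¬ (p ≡ 1)
prime-∤1 pp refl with () ← prime⇒nonTrivial pp

∣⇒Cong : ∀ {p} m → p ∣ m → Cong p (+ m) 0ℤ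
∣⇒Cong m d = ∣⇒Cong0 d

-- Let `p` be a prime divisor of `K`. If `p ∣ μ`, then `z ≡ f`, and `f` is prime to `μ`. If `p ∣ f`,
-- then `z ≡ -2 μ e`, and `p` divides none of 2, `μ`, `e`.
move-off-coprime : ∀ {B μ e f K} (z : ℤ) → + f ℤ.* (1ℤ ℤ.+ + B ℤ.* (+ μ ℤ.* + μ)) ≡ z ℤ.+ + 2 ℤ.* (+ μ ℤ.* + e) →
  Odd K → Coprime e f → Coprime μ f → (∀ p → Prime p → p ∣ K → p ∣ μ ⊎ p ∣ f) → Coprime (abs z) K
move-off-coprime {B} {μ} {e} {f} {K} z ez oK c-ef cμ h = coprime-by-primes {abs z} {K} (Odd-pos {K} oK) λ p pp p∣z p∣K → bad p pp (∣⇒Cong0 p∣z) p∣K (h p pp p∣K)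
    where
    w = 1ℤ ℤ.+ + B ℤ.* (+ μ ℤ.* + μ)
    bad : ∀ p → Prime p → Cong p z 0ℤ → p ∣ K → p ∣ μ ⊎ p ∣ f → ⊥
    bad p pp cz p∣K (inj₁ p∣μ) = prime-∤1 pp (cμ (p∣μ , Cong0⇒∣ (cong-trans (cong-≡ (trans (lem (+ f) (+ B) (+ μ)) (cong (λ y → y ℤ.- + f ℤ.* + B ℤ.* + μ ℤ.* + μ) ez)))
        (cong-trans (cong-≡ (lem2 z (+ μ) (+ e) (+ f ℤ.* + B))) (cong-+ cz (cong-trans (cong-* (∣⇒Cong μ p∣μ) (cong-refl {a = v})) (cong-≡ (ℤP.*-zeroˡ v))))))))
      where
      v = + 2 ℤ.* + e ℤ.- + f ℤ.* + B ℤ.* + μ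
      lem : ∀ f B μ → f ≡ f ℤ.* (1ℤ ℤ.+ B ℤ.* (μ ℤ.* μ)) ℤ.- f ℤ.* B ℤ.* μ ℤ.* μ
      lem = ℤR.solve-∀
      lem2 : ∀ z μ e t → z ℤ.+ + 2 ℤ.* (μ ℤ.* e) ℤ.- t ℤ.* μ ℤ.* μ ≡ z ℤ.+ μ ℤ.* (+ 2 ℤ.* e ℤ.- t ℤ.* μ)
      lem2 = ℤR.solve-∀
    bad p pp cz p∣K (inj₂ p∣f) with euclidsLemma 2 (μ * e) pp p∣2μe
      where
      lem : ∀ z y → y ≡ (z ℤ.+ y) ℤ.- z
      lem = ℤR.solve-∀
      c0 : Cong p (+ 2 ℤ.* (+ μ ℤ.* + e)) 0ℤ
      c0 = cong-trans (cong-≡ (trans (lem z (+ 2 ℤ.* (+ μ ℤ.* + e))) (cong (ℤ._- z) (sym ez)))) (cong-+ (cong-trans (cong-* (∣⇒Cong f p∣f) (cong-refl {a = w})) (cong-≡ (ℤP.*-zeroˡ w))) (cong-neg cz))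
      p∣2μe : p ∣ 2 * (μ * e)
      p∣2μe = subst (p ∣_) (trans (ℤP.abs-* (+ 2) (+ μ ℤ.* + e)) (cong (2 *_) (ℤP.abs-* (+ μ) (+ e)))) (Cong0⇒∣ c0)
    ... | inj₁ p∣2 = prime-∤1 pp (coprime-2 {K} oK (p∣2 , p∣K))
    ... | inj₂ p∣μe with euclidsLemma μ e pp p∣μe
    ... | inj₂ p∣e = prime-∤1 pp (c-ef (p∣e , p∣f))
    ... | inj₁ p∣μ = prime-∤1 pp (cμ (p∣μ , p∣f))

solution-coprime : ∀ {B T K} → 0 < B → 0 < T → 1 < K → ∀ e f g → e ℤ.* e ≡ + B ℤ.* (f ℤ.* f) ℤ.+ + T ℤ.* (g ℤ.* g) →
  Coprime (abs f) K → Σ (Solution B T) λ s → Coprime (Solution.f s) K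
solution-coprime {B} {T} {K} 0<B 0<T 1<K e f g eq c = solution-ℤ 0<B 0<T e f g nz eq , c
  where
  nz : ¬ (e ≡ 0ℤ × f ≡ 0ℤ × g ≡ 0ℤ)
  nz (_ , z , _) = ℕP.<⇒≢ 1<K (sym (c (subst (K ∣_) (sym (cong abs z)) (K ∣0) , ∣-refl)))

-- Multiplying e + f√B by (1 - μ√B)² moves f off the primes of K.
move-off : ∀ {B T K} → 0 < B → 0 < T → 1 < K → Odd K → (p : Primitive B T) → Σ (Solution B T) λ s → Coprime (Solution.f s) K
move-off {B} {T} {K} 0<B 0<T 1<K oK (prim e f g 0<e eqn c-ef _ _) with split-off f K (Odd-pos {K} oK)
... | μ , cμ , h = solution-coprime 0<B 0<T 1<K (rot (+ e) (+ B ℤ.* (+ μ ℤ.* + f))) (rot (+ f) (+ μ ℤ.* + e)) ((1ℤ ℤ.- ν) ℤ.* + g)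
        (trans (norm (+ e) (+ f) (+ g) (+ B) (+ T) (+ μ)) (trans (cong (λ z → S ℤ.+ (1ℤ ℤ.- ν) ℤ.* (1ℤ ℤ.- ν) ℤ.* (z ℤ.- r)) eqnℤ) (lem S ((1ℤ ℤ.- ν) ℤ.* (1ℤ ℤ.- ν)) r)))
        (move-off-coprime {B} {μ} {e} {f} {K} (rot (+ f) (+ μ ℤ.* + e)) (lem2 (+ f ℤ.* (1ℤ ℤ.+ ν)) (+ 2 ℤ.* (+ μ ℤ.* + e))) oK c-ef cμ h)
  where
  ν = + B ℤ.* (+ μ ℤ.* + μ)
  rot : ℤ → ℤ → ℤ
  rot a b = a ℤ.* (1ℤ ℤ.+ ν) ℤ.- + 2 ℤ.* b
  r = + B ℤ.* (+ f ℤ.* + f) ℤ.+ + T ℤ.* (+ g ℤ.* + g)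
  S = + B ℤ.* (rot (+ f) (+ μ ℤ.* + e) ℤ.* rot (+ f) (+ μ ℤ.* + e)) ℤ.+ + T ℤ.* ((1ℤ ℤ.- ν) ℤ.* + g ℤ.* ((1ℤ ℤ.- ν) ℤ.* + g))
  eqnℤ : + e ℤ.* + e ≡ r
  eqnℤ = trans (sym (abs-sq (+ e))) (trans (cong +_ eqn) (pos-sq-sum B T (+ f) (+ g)))
  lem : ∀ a b c → a ℤ.+ b ℤ.* (c ℤ.- c) ≡ a
  lem = ℤR.solve-∀
  lem2 : ∀ x y → x ≡ x ℤ.- y ℤ.+ y
  lem2 = ℤR.solve-∀
  -- The multiplier is a square so that its norm is the square of `1 - ν`, which `g` can absorb.
  norm : ∀ e f g B T μ → let ν = B ℤ.* (μ ℤ.* μ) in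
    (e ℤ.* (1ℤ ℤ.+ ν) ℤ.- + 2 ℤ.* (B ℤ.* (μ ℤ.* f))) ℤ.* (e ℤ.* (1ℤ ℤ.+ ν) ℤ.- + 2 ℤ.* (B ℤ.* (μ ℤ.* f))) ≡
    B ℤ.* ((f ℤ.* (1ℤ ℤ.+ ν) ℤ.- + 2 ℤ.* (μ ℤ.* e)) ℤ.* (f ℤ.* (1ℤ ℤ.+ ν) ℤ.- + 2 ℤ.* (μ ℤ.* e))) ℤ.+ T ℤ.* ((1ℤ ℤ.- ν) ℤ.* g ℤ.* ((1ℤ ℤ.- ν) ℤ.* g))
    ℤ.+ (1ℤ ℤ.- ν) ℤ.* (1ℤ ℤ.- ν) ℤ.* (e ℤ.* e ℤ.- (B ℤ.* (f ℤ.* f) ℤ.+ T ℤ.* (g ℤ.* g)))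
  norm = ℤR.solve-∀

-- Symbol calculus

nat-by : ∀ {n a b} q → a ≡ b + q * n → Cong n (+ a) (+ b)
nat-by {n} {a} {b} q e = by (+ q) (trans (cong +_ e) (trans (ℤP.pos-+ b (q * n)) (cong (ℤ._+_ (+ b)) (ℤP.pos-* q n))))

nat-cong-* : ∀ {n} a b c d → Cong n (+ a) (+ b) → Cong n (+ c) (+ d) → Cong n (+ (a * c)) (+ (b * d))
nat-cong-* a b c d e f = cong-trans (cong-≡ (ℤP.pos-* a c)) (cong-trans (cong-* e f) (cong-≡ (sym (ℤP.pos-* b d))))

nat-cong-^ : ∀ {n} a b k → Cong n (+ a) (+ b) → Cong n (+ (a ^ k)) (+ (b ^ k))
nat-cong-^ a b zero e = cong-refl
nat-cong-^ a b (suc k) e = nat-cong-* a b (a ^ k) (b ^ k) e (nat-cong-^ a b k e)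

cong-∣ : ∀ {m n a b} → m ∣ n → Cong n a b → Cong m a b
cong-∣ {m} {n} {a} {b} (divides q refl) e = cong-down {m} {q} (subst (λ z → Cong z a b) (ℕP.*-comm q m) e)

J-nat-* : ∀ a b n → J (+ (a * b)) n ≡ J (+ a) n ℤ.* J (+ b) n
J-nat-* a b n = trans (cong (λ z → J z n) (ℤP.pos-* a b)) (J-mul (+ a) (+ b) n)

J-square : ∀ a {n} → Odd n → Coprime a n → J (+ (a * a)) n ≡ 1ℤ
J-square a {n} o c = trans (J-nat-* a a n) (J-sq (+ a) {n} o c)

J-times-square : ∀ a r {n} → Odd n → Coprime r n → J (a ℤ.* + (r * r)) n ≡ J a n
J-times-square a r {n} o c = trans (J-mul a (+ (r * r)) n) (trans (cong (J a n ℤ.*_) (J-square r {n} o c)) (ℤP.*-identityʳ (J a n)))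

J-square-class : ∀ a b r s {n} → Odd n → Coprime r n → Coprime s n → Cong n (a ℤ.* + (r * r)) (b ℤ.* + (s * s)) → J a n ≡ J b n
J-square-class a b r s {n} o cr cs e = trans (sym (J-times-square a r {n} o cr)) (trans (J-resp {n} o e) (J-times-square b s {n} o cs))

-- A squared symbol is 0 or 1, and a nonzero left side rules out 0. This cancels a square factor
-- whose coprimality to the modulus is not known beforehand.
trit-strip : ∀ {a b t} → Trit t → a ≡ b ℤ.* (t ℤ.* t) → a ℤ.* a ≡ 1ℤ → a ≡ b
trit-strip {b = b} t0 refl e = contradiction (trans (sym (cong (λ z → z ℤ.* z) (ℤP.*-zeroʳ b))) e) λ ()
trit-strip {b = b} t+ e _ = trans e (ℤP.*-identityʳ b)
trit-strip {b = b} t- e _ = trans e (ℤP.*-identityʳ b)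

-- The symbol of -1, tabulated modulo 8 so that it is read off the same residue as `χ`.
χ₄ : ℕ → ℤ
χ₄ 1 = 1ℤ
χ₄ 3 = -1ℤ
χ₄ 5 = 1ℤ
χ₄ 7 = -1ℤ
χ₄ _ = 0ℤ

mod4 : ∀ n → n % 8 % 4 ≡ n % 4
mod4 n = m∣n⇒o%n%m≡o%m 4 8 n (divides 2 refl)

J-minus-one : ∀ {n} → Odd n → J -1ℤ n ≡ χ₄ (n % 8)
J-minus-one {n} o = go (n % 8) refl (odd-res {n} o)
  where
  go : ∀ r → n % 8 ≡ r → OddRes r → J -1ℤ n ≡ χ₄ (n % 8)
  go _ e r1 = trans (J-neg1-1mod4 {n} (trans (sym (mod4 n)) (cong (_% 4) e))) (sym (cong χ₄ e))
  go _ e r3 = trans (J-neg1-3mod4 {n} (trans (sym (mod4 n)) (cong (_% 4) e))) (sym (cong χ₄ e))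
  go _ e r5 = trans (J-neg1-1mod4 {n} (trans (sym (mod4 n)) (cong (_% 4) e))) (sym (cong χ₄ e))
  go _ e r7 = trans (J-neg1-3mod4 {n} (trans (sym (mod4 n)) (cong (_% 4) e))) (sym (cong χ₄ e))

J-minus-one⇒1mod4 : ∀ {n} → Odd n → J -1ℤ n ≡ 1ℤ → n % 4 ≡ 1
J-minus-one⇒1mod4 {n} o e = go (n % 8) refl (odd-res {n} o)
  where
  go : ∀ r → n % 8 ≡ r → OddRes r → n % 4 ≡ 1
  go _ f r1 = trans (sym (mod4 n)) (cong (_% 4) f)
  go _ f r5 = trans (sym (mod4 n)) (cong (_% 4) f)
  go _ f r3 = contradiction (trans (sym e) (trans (J-minus-one {n} o) (cong χ₄ f))) λ ()
  go _ f r7 = contradiction (trans (sym e) (trans (J-minus-one {n} o) (cong χ₄ f))) λ ()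

-- The symbol of -2, split into two factors that both depend on the modulus through its residue
-- modulo 8.
J₋₂ : ℕ → ℤ
J₋₂ n = J -1ℤ n ℤ.* J (+ 2) n

interchange : ∀ a b c d → a ℤ.* b ℤ.* (c ℤ.* d) ≡ a ℤ.* c ℤ.* (b ℤ.* d)
interchange = ℤR.solve-∀

J₋₂-* : ∀ {m n} → Odd m → Odd n → J₋₂ (m * n) ≡ J₋₂ m ℤ.* J₋₂ n
J₋₂-* {m} {n} om on = trans (cong₂ ℤ._*_ (J-bottom -1ℤ {m} {n} om on) (J-bottom (+ 2) {m} {n} om on)) (interchange (J -1ℤ m) (J -1ℤ n) (J (+ 2) m) (J (+ 2) n))

J₋₂-mod8 : ∀ {m n} → Odd m → Odd n → m % 8 ≡ n % 8 → J₋₂ m ≡ J₋₂ n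
J₋₂-mod8 {m} {n} om on e = trans (cong₂ ℤ._*_ (J-minus-one {m} om) (J-two {m} om)) (trans (cong₂ ℤ._*_ (cong χ₄ e) (cong χ e)) (sym (cong₂ ℤ._*_ (J-minus-one {n} on) (J-two {n} on))))

sum-of-squares-coprime : ∀ {X E a} → Coprime X E → a ∣ X * X + E * E → Coprime a X × Coprime a E
sum-of-squares-coprime {X} {E} {a} c a∣ = (λ (d∣a , d∣X) → c (d∣X , half d∣X (coprime-∣ˡ {X} {_} {E} c d∣X) (∣m+n∣m⇒∣n (∣-trans d∣a a∣) (∣m⇒∣m*n X d∣X))))
   , (λ {d} (d∣a , d∣E) → c (half d∣E (coprime-∣ˡ {E} {_} {X} (coprime-sym {X} {E} c) d∣E) (∣m+n∣m⇒∣n (subst (d ∣_) (ℕP.+-comm (X * X) (E * E)) (∣-trans d∣a a∣)) (∣m⇒∣m*n E d∣E)) , d∣E))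
  where
  half : ∀ {d x y} → d ∣ x → Coprime d y → d ∣ y * y → d ∣ y
  half {d} {x} {y} _ cd = coprime-divisor {d} {y} {y} cd

-- Modulo `d` both `X` and `E` are units and `E² ≡ -X²`.
sum-of-squares-minus-one : ∀ {X E d} → Odd d → Coprime X E → d ∣ X * X + E * E → J -1ℤ d ≡ 1ℤ
sum-of-squares-minus-one {X} {E} {d} o c d∣ = sym (trans (sym (J-one d)) $ J-square-class 1ℤ -1ℤ E X {d} o (coprime-sym {d} {E} (proj₂ cc)) (coprime-sym {d} {X} (proj₁ cc)) congr)
  where
  cc = sum-of-squares-coprime {X} {E} {d} c d∣
  congr : Cong d (1ℤ ℤ.* + (E * E)) (-1ℤ ℤ.* + (X * X))
  congr = cong0-sub⁻ (cong-trans (cong-≡ (trans (lem (+ (E * E)) (+ (X * X))) (sym (ℤP.pos-+ (X * X) (E * E))))) (∣⇒Cong0 d∣))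
    where lem : ∀ e x → 1ℤ ℤ.* e ℤ.- -1ℤ ℤ.* x ≡ x ℤ.+ e
          lem = ℤR.solve-∀

-- T splits as a b with x ≡ y (a) and x ≡ −y (b).
J-equal-squares : ∀ {T} x y → Odd T → (∀ {d} → d ∣ T → J -1ℤ d ≡ 1ℤ) → Cong T (+ (x * x)) (+ (y * y)) → J (+ x) T ≡ J (+ y) T
J-equal-squares {T} x y oT neg e with gcd-split (abs (+ x ℤ.- + y)) T (Odd-pos {T} oT)
... | a , z' , b , ez , refl , c , 0<a = trans (J-bottom (+ x) {a} {b} oa ob) (trans (cong₂ ℤ._*_ (J-resp {a} oa ca) (trans (J-resp {b} ob cb) (trans (J-mul -1ℤ (+ y) b) (trans (cong (ℤ._* J (+ y) b) (neg {b} (n∣m*n a))) (ℤP.*-identityˡ (J (+ y) b))))))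
      (sym (J-bottom (+ y) {a} {b} oa ob)))
  where
  oa : Odd a
  oa = Odd-*ˡ {a} {b} oT
  ob : Odd b
  ob = Odd-*ʳ {a} {b} oT
  ca : Cong a (+ x) (+ y)
  ca = cong0-sub⁻ (∣⇒Cong0 (subst (a ∣_) (sym ez) (m∣m*n z')))
  dvd : a * b ∣ a * (z' * (x + y))
  dvd = subst (a * b ∣_) (trans (cong abs (trans (cong₂ ℤ._-_ (ℤP.pos-* x x) (ℤP.pos-* y y)) (lem (+ x) (+ y)))) (trans (ℤP.abs-* (+ x ℤ.- + y) (+ x ℤ.+ + y)) (trans (cong (_* (x + y)) ez) (ℕP.*-assoc a z' (x + y))))) (Cong0⇒∣ (cong0-sub e))
    where lem : ∀ x y → x ℤ.* x ℤ.- y ℤ.* y ≡ (x ℤ.- y) ℤ.* (x ℤ.+ y)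
          lem = ℤR.solve-∀
  cb : Cong b (+ x) (-1ℤ ℤ.* + y)
  cb = cong0-sub⁻ (cong-trans (cong-≡ (trans (lem (+ x) (+ y)) (sym (ℤP.pos-+ x y)))) (∣⇒Cong0 (coprime-divisor {b} {z'} {x + y} (coprime-sym {z'} {b} c) (*-cancelˡ-∣ a {{>-nonZero 0<a}} dvd))))
    where lem : ∀ x y → x ℤ.- -1ℤ ℤ.* y ≡ x ℤ.+ y
          lem = ℤR.solve-∀

J-power-one : ∀ a k n → J (+ a) n ≡ 1ℤ → J (+ (a ^ k)) n ≡ 1ℤ
J-power-one a zero n e = J-one n
J-power-one a (suc k) n e = trans (J-nat-* a (a ^ k) n) (cong₂ ℤ._*_ e (J-power-one a k n e))

mod8⇒odd : ∀ {n r} → n % 8 ≡ r → r % 2 ≡ 1 → Odd n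
mod8⇒odd {n} e o = trans (sym (m∣n⇒o%n%m≡o%m 2 8 n (divides 4 refl))) (trans (cong (_% 2) e) o)

mod8⇒mod4 : ∀ {n r} → n % 8 ≡ r → n % 4 ≡ r % 4
mod8⇒mod4 {n} e = trans (sym (mod4 n)) (cong (_% 4) e)

-- Rational quartic reciprocity

-- The product of all the relations: every sign occurs to an even power except `ta tb = (2/C) = -1`.
-- In the application `A` is `(Cb/Ca)`; `p`, `q` are the symbols of `w'` at `Ca`, `Cb` and `r` that
-- of `w''` at `Cb`; `h`, `e`, `t` followed by `a` or `b` stand for `h₁`, `e`, 2 at `Ca` or `Cb`;
-- `mw`, `mh`, `me` are the symbols of -2 at `w'`, `h₁`, `e`.
sign-clash : ∀ A p q r ha hb ea eb ta tb mw mh me → mw ℤ.* (q ℤ.* p) ≡ 1ℤ → A ℤ.* p ≡ ta ℤ.* (ha ℤ.* ea) → A ℤ.* r ≡ tb ℤ.* (hb ℤ.* eb) →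
  q ℤ.* r ≡ tb → tb ℤ.* mw ≡ mh ℤ.* me → mh ℤ.* (hb ℤ.* ha) ≡ 1ℤ → me ℤ.* (eb ℤ.* ea) ≡ 1ℤ → tb ℤ.* ta ≡ -1ℤ →
  A ℤ.* A ≡ 1ℤ → r ℤ.* r ≡ 1ℤ → ⊥
sign-clash A p q r ha hb ea eb ta tb mw mh me a b c d g i j f A² r² = contradiction eq λ ()
  where
  eq : 1ℤ ≡ -1ℤ
  eq = trans (sym (cong₂ ℤ._*_ (cong₂ ℤ._*_ a A²) r²)) (trans (l1 A p q r mw) (trans (cong₂ (λ u v → mw ℤ.* u ℤ.* v) b (cong₂ ℤ._*_ c d))
    (trans (l2 ta tb ha hb ea eb mw) (trans (cong₂ (λ u v → u ℤ.* v ℤ.* (ha ℤ.* hb ℤ.* (ea ℤ.* eb))) g f) (trans (l3 mh me ha hb ea eb) (cong₂ (λ u v → -1ℤ ℤ.* u ℤ.* v) i j))))))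
    where
    l1 : ∀ A p q r mw → mw ℤ.* (q ℤ.* p) ℤ.* (A ℤ.* A) ℤ.* (r ℤ.* r) ≡ mw ℤ.* (A ℤ.* p) ℤ.* (A ℤ.* r ℤ.* (q ℤ.* r))
    l1 = ℤR.solve-∀
    l2 : ∀ ta tb ha hb ea eb mw → mw ℤ.* (ta ℤ.* (ha ℤ.* ea)) ℤ.* (tb ℤ.* (hb ℤ.* eb) ℤ.* tb) ≡ (tb ℤ.* mw) ℤ.* (tb ℤ.* ta) ℤ.* (ha ℤ.* hb ℤ.* (ea ℤ.* eb))
    l2 = ℤR.solve-∀
    l3 : ∀ mh me ha hb ea eb → mh ℤ.* me ℤ.* -1ℤ ℤ.* (ha ℤ.* hb ℤ.* (ea ℤ.* eb)) ≡ -1ℤ ℤ.* (mh ℤ.* (hb ℤ.* ha)) ℤ.* (me ℤ.* (eb ℤ.* ea))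
    l3 = ℤR.solve-∀

unit-factor : ∀ {q r t} → Trit r → q ℤ.* r ≡ t → t ℤ.* t ≡ 1ℤ → r ℤ.* r ≡ 1ℤ
unit-factor {q} t0 refl e = contradiction (trans (sym (cong (λ z → z ℤ.* z) (ℤP.*-zeroʳ q))) e) λ ()
unit-factor t+ _ _ = refl
unit-factor t- _ _ = refl

coprime-2⇒Odd : ∀ {n} → Coprime n 2 → Odd n
coprime-2⇒Odd {n} c with halves n
... | k , inj₂ refl = odd-Odd k
... | k , inj₁ refl = contradiction (c (m∣m*n k , ∣-refl)) λ ()

-- T h² = X² + E² turns the conic into w w̄ = C S with w = h₁ e + E g₁ and w̄ = h₁ e − E g₁. The symbols of w and w̄ at
-- complementary factors of C, together with (−2C/w') = 1 for the part w' of w prime to C, are incompatible.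
conic-obstruction : ∀ {C T X X₀ E h c} → X ≡ C * X₀ → C % 8 ≡ 5 → T % 8 ≡ 1 → SquareFree C → Odd h → 8 ∣ E →
  (∀ {d} → d ∣ C → d % 4 ≡ 1) → T * (h * h) ≡ X * X + E * E → Coprime X E → J (+ c) T ≡ 1ℤ →
  Cong T (+ (2 * C * (c * c))) (+ 16) → (∀ {d} → d ∣ h → J₋₂ d ℤ.* J (+ C) d ≡ 1ℤ) →
  (p : Primitive (2 * C) T) → Coprime (Primitive.f p) X → ⊥
conic-obstruction {C} {T} {X} {X₀} {E} {h} {c} eX C5 T1 sC oh 8∣E C4 eT cXE Jc congT Jh (prim e f g 0<e eqn c-ef c-eg c-fg) cfX =
  go (gcd-split g h (Odd-pos {h} oh))
  where
  oC : Odd C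
  oC = mod8⇒odd {C} C5 refl
  oT : Odd T
  oT = mod8⇒odd {T} T1 refl
  T4 : T % 4 ≡ 1
  T4 = mod8⇒mod4 {T} T1
  C4' : C % 4 ≡ 1
  C4' = mod8⇒mod4 {C} C5
  C∣X : C ∣ X
  C∣X = subst (C ∣_) (sym eX) (m∣m*n X₀)
  T∣ : T ∣ X * X + E * E
  T∣ = subst (T ∣_) eT (m∣m*n (h * h))
  h∣ : h ∣ X * X + E * E
  h∣ = subst (h ∣_) eT (∣n⇒∣m*n T (m∣m*n h))
  cTX : Coprime T X
  cTX = proj₁ (sum-of-squares-coprime {X} {E} {T} cXE T∣)
  chX : Coprime h X
  chX = proj₁ (sum-of-squares-coprime {X} {E} {h} cXE h∣)
  c2CT : Coprime (2 * C) T
  c2CT = coprime-*ˡ {2} {C} {T} (coprime-2 {T} oT) (coprime-sym {T} {C} (coprime-∣ʳ {T} {C} {X} cTX C∣X))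
  ce2C : Coprime e (2 * C)
  ce2C {d} (d∣e , d∣2C) = c-eg (d∣e , coprime-divisor {d} {g} {g} (coprime-∣ˡ {e} {d} {g} c-eg d∣e) (coprime-divisor {d} {T} {g * g} (coprime-∣ˡ {2 * C} {d} {T} c2CT d∣2C)
      (∣m+n∣m⇒∣n (subst (d ∣_) eqn (∣m⇒∣m*n e d∣e)) (∣m⇒∣m*n (f * f) d∣2C))))
  oe : Odd e
  oe = coprime-2⇒Odd {e} (coprime-∣ʳ {e} {2} {2 * C} ce2C (m∣m*n C))
  0<f : 0 < f
  0<f = ℕP.n≢0⇒n>0 λ { refl → absurd (∣-antisym (subst (C ∣_) (cfX (X ∣0 , ∣-refl)) C∣X) (1∣ C)) }
    where absurd : C ≡ 1 → ⊥
          absurd refl = contradiction C5 λ ()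
  -- Powers of 2 have symbol 1 because `T ≡ 1` modulo 8. For the odd part `m` of `f`, reciprocity
  -- leads to `(T/m)`, and `T g² ≡ e²` modulo `m`.
  JfT : J (+ f) T ≡ 1ℤ
  JfT = step (two-adic f 0<f)
    where
    step : (∃ λ a → ∃ λ j → f ≡ 2 ^ a * odd j) → J (+ f) T ≡ 1ℤ
    step (a , j , ef) = trans (cong (λ z → J (+ z) T) ef) (trans (J-nat-* (2 ^ a) m T) (cong₂ ℤ._*_ (J-power-one 2 a T (trans (J-two {T} oT) (cong χ T1)))
        (trans (sym (J-recip {T} {m} T4 om)) (trans (J-square-class (+ T) 1ℤ g e {m} om (cm g c-fg) (cm e (coprime-sym {e} {f} c-ef)) congr) (J-one m)))))
      where
      m = odd j
      om : Odd m
      om = odd-Odd j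
      m∣f : m ∣ f
      m∣f = divides (2 ^ a) ef
      cm : ∀ y → Coprime f y → Coprime y m
      cm y cc = coprime-sym {m} {y} (coprime-∣ˡ {f} {m} {y} cc m∣f)
      congr : Cong m (+ T ℤ.* + (g * g)) (1ℤ ℤ.* + (e * e))
      congr = cong-trans (cong-≡ (sym (ℤP.pos-* T (g * g)))) (cong-trans (cong-sym (nat-by {m} {e * e} {T * (g * g)} (2 * C * f * 2 ^ a) (trans eqn (trans (cong (λ z → 2 * C * (f * z) + T * (g * g)) ef) (lem (2 * C) f (2 ^ a) m (T * (g * g))))))) (cong-≡ (sym (ℤP.*-identityˡ _))))
        where lem : ∀ B f a m t → B * (f * (a * m)) + t ≡ t + B * f * a * m
              lem = solve-∀
  -- Modulo `T` the squares of `e c` and `4 f` agree, because `2 C c² ≡ 16`. Their symbols agree as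
  -- well, since -1 has symbol 1 at every divisor of `T`.
  JeT : J (+ e) T ≡ 1ℤ
  JeT = trans (sym (trans (J-nat-* e c T) (trans (cong (J (+ e) T ℤ.*_) Jc) (ℤP.*-identityʳ (J (+ e) T)))))
     (trans (J-equal-squares {T} (e * c) (4 * f) oT (λ {d} d∣T → sum-of-squares-minus-one {X} {E} {d} (Odd-∣ d∣T oT) cXE (∣-trans d∣T T∣)) congr)
       (trans (J-nat-* 4 f T) (cong₂ ℤ._*_ (J-square 2 {T} oT (coprime-2 {T} oT)) JfT)))
    where
    congr : Cong T (+ (e * c * (e * c))) (+ (4 * f * (4 * f)))
    congr = cong-trans (nat-by {T} {e * c * (e * c)} {2 * C * (c * c) * (f * f)} (g * g * (c * c)) (trans (lem1 e c) (trans (cong (_* (c * c)) eqn) (lem2 (2 * C) f T g c))))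
      (cong-trans (nat-cong-* (2 * C * (c * c)) 16 (f * f) (f * f) congT cong-refl) (cong-≡ (cong +_ (lem3 f))))
      where
      lem1 : ∀ e c → e * c * (e * c) ≡ e * e * (c * c)
      lem1 = solve-∀
      lem2 : ∀ B f T g c → (B * (f * f) + T * (g * g)) * (c * c) ≡ B * (c * c) * (f * f) + g * g * (c * c) * T
      lem2 = solve-∀
      lem3 : ∀ f → 16 * (f * f) ≡ 4 * f * (4 * f)
      lem3 = solve-∀
  J-2C : ∀ n → J (-1ℤ ℤ.* + 2 ℤ.* + C) n ≡ J₋₂ n ℤ.* J (+ C) n
  J-2C n = trans (J-mul (-1ℤ ℤ.* + 2) (+ C) n) (cong (ℤ._* J (+ C) n) (J-mul -1ℤ (+ 2) n))
  -- Modulo `e` the conic reads `T g² ≡ -2 C f²`, so `(-2C/e) = (T/e) = (e/T) = 1`.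
  Je : J₋₂ e ℤ.* J (+ C) e ≡ 1ℤ
  Je = trans (sym (J-2C e)) (trans (sym (J-square-class (+ T) (-1ℤ ℤ.* + 2 ℤ.* + C) g f {e} oe (coprime-sym {e} {g} c-eg) (coprime-sym {e} {f} c-ef) congr)) (trans (J-recip {T} {e} T4 oe) JeT))
    where
    congr : Cong e (+ T ℤ.* + (g * g)) (-1ℤ ℤ.* + 2 ℤ.* + C ℤ.* + (f * f))
    congr = by (+ e) (trans (lem (+ T ℤ.* + (g * g)) (+ C) (+ (f * f))) (cong (λ z → -1ℤ ℤ.* + 2 ℤ.* + C ℤ.* + (f * f) ℤ.+ z) (trans (cong₂ ℤ._+_ (trans (cong (ℤ._* + (f * f)) (sym (ℤP.pos-* 2 C))) (sym (ℤP.pos-* (2 * C) (f * f)))) (sym (ℤP.pos-* T (g * g)))) (trans (sym (ℤP.pos-+ (2 * C * (f * f)) (T * (g * g)))) (trans (cong +_ (sym eqn)) (ℤP.pos-* e e))))))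
      where lem : ∀ t C f → t ≡ -1ℤ ℤ.* + 2 ℤ.* C ℤ.* f ℤ.+ (+ 2 ℤ.* C ℤ.* f ℤ.+ t)
            lem = ℤR.solve-∀
  go : (∃ λ k → ∃ λ g₁ → ∃ λ h₁ → g ≡ k * g₁ × h ≡ k * h₁ × Coprime g₁ h₁ × 0 < k) → ⊥
  go (k , g₁ , h₁ , eg , eh , cgh , 0<k) = go₂ (gcd-split w C (Odd-pos {C} oC))
    where
    h₁∣h : h₁ ∣ h
    h₁∣h = divides k eh
    oh₁ : Odd h₁
    oh₁ = Odd-∣ h₁∣h oh
    S = 2 * (h₁ * f * (h₁ * f)) + C * (X₀ * g₁ * (X₀ * g₁))
    A = h₁ * e
    B = E * g₁
    -- The conic multiplied by `h²`, with `T h²` replaced by `X² + E²`, and then divided by the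
    -- square of `k = gcd g h`.
    A²≡ : A * A ≡ B * B + C * S
    A²≡ = cancelˡ {k * k} (*-pos 0<k 0<k) (trans (l1 k h₁ e) (trans (cong₂ _*_ (sym (cong (λ z → z * z) eh)) eqn) (trans (l2 h f g (2 * C) T) (trans (cong₂ (λ u v → 2 * C * (h * h) * (f * f) + u * v) eT (cong (λ z → z * z) eg))
       (trans (cong₂ (λ u v → 2 * C * (u * u) * (f * f) + (v * v + E * E) * (k * g₁ * (k * g₁))) eh eX) (l3 C k h₁ f X₀ E g₁))))))
      where
      l1 : ∀ k h e → k * k * (h * e * (h * e)) ≡ k * h * (k * h) * (e * e)
      l1 = solve-∀
      l2 : ∀ h f g B T → h * h * (B * (f * f) + T * (g * g)) ≡ B * (h * h) * (f * f) + T * (h * h) * (g * g)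
      l2 = solve-∀
      l3 : ∀ C k h f X E g → 2 * C * (k * h * (k * h)) * (f * f) + (C * X * (C * X) + E * E) * (k * g * (k * g)) ≡ k * k * (E * g * (E * g) + C * (2 * (h * f * (h * f)) + C * (X * g * (X * g))))
      l3 = solve-∀
    B≤A : B ≤ A
    B≤A = ℕP.≮⇒≥ λ A<B → ℕP.<⇒≱ (ℕP.*-mono-< A<B A<B) (subst (B * B ≤_) (sym A²≡) (ℕP.m≤m+n (B * B) (C * S)))
    w̄ = A ∸ B
    w̄+B : w̄ + B ≡ A
    w̄+B = ℕP.m∸n+n≡m B≤A
    w = A + B
    ww̄ : w * w̄ ≡ C * S
    ww̄ = ℕP.+-cancelˡ-≡ (B * B) _ _ (trans (cong (λ z → B * B + (z + B) * w̄) (sym w̄+B)) (trans (lem w̄ B) (trans (cong (λ z → z * z) w̄+B) A²≡)))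
      where lem : ∀ v b → b * b + (v + b + b) * v ≡ (v + b) * (v + b)
            lem = solve-∀
    oA : Odd A
    oA = Odd-* {h₁} {e} oh₁ oe
    8∣B : 8 ∣ B
    8∣B = ∣m⇒∣m*n g₁ 8∣E
    -- Divisibility of `E` by 8 enters here: `w` and `h₁ e` have the same symbol of -2.
    w8 : w % 8 ≡ A % 8
    w8 = %-remove-+ʳ A 8∣B
    ow : Odd w
    ow = trans (%-remove-+ʳ A (∣-trans (divides 4 refl) 8∣B)) oA
    go₂ : (∃ λ Cb → ∃ λ w' → ∃ λ Ca → w ≡ Cb * w' × C ≡ Cb * Ca × Coprime w' Ca × 0 < Cb) → ⊥
    -- `Cb` is the gcd of `w` and `C`; the cofactor `Ca` is prime to `w'` and hence divides `w̄`.
    -- Square-freeness of `C` makes `Ca` and `Cb` coprime, so the symbol between them is nonzero.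
    go₂ (Cb , w' , Ca , ew , eC , cw'Ca , 0<Cb) = go₃ (coprime-divisor {Ca} {w'} {w̄} (coprime-sym {w'} {Ca} cw'Ca) (divides S (trans w'w̄ (ℕP.*-comm Ca S))))
      where
      w'w̄ : w' * w̄ ≡ Ca * S
      w'w̄ = cancelˡ {Cb} 0<Cb (trans (sym (ℕP.*-assoc Cb w' w̄)) (trans (cong (_* w̄) (sym ew)) (trans ww̄ (trans (cong (_* S) eC) (ℕP.*-assoc Cb Ca S)))))
      oCC : Odd (Cb * Ca)
      oCC = subst Odd eC oC
      oCa : Odd Ca
      oCa = Odd-*ʳ {Cb} {Ca} oCC
      oCb : Odd Cb
      oCb = Odd-*ˡ {Cb} {Ca} oCC
      Cb∣C : Cb ∣ C
      Cb∣C = divides Ca (trans eC (ℕP.*-comm Cb Ca))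
      cCbCa : Coprime Cb Ca
      cCbCa {d} (d∣b , d∣a) = sC (subst (d * d ∣_) (sym eC) (*-pres-∣ d∣b d∣a))
      ow' : Odd w'
      ow' = Odd-*ʳ {Cb} {w'} (subst Odd ew ow)
      go₃ : Ca ∣ w̄ → ⊥
      go₃ (divides w'' ew̄) = sign-clash (J (+ Cb) Ca) (J (+ w') Ca) (J (+ w') Cb) (J (+ w'') Cb) (J (+ h₁) Ca) (J (+ h₁) Cb) (J (+ e) Ca) (J (+ e) Cb) (J (+ 2) Ca) (J (+ 2) Cb) (J₋₂ w') (J₋₂ h₁) (J₋₂ e)
           (trans (cong (J₋₂ w' ℤ.*_) (sym (split w' ow'))) Jw') eq-b eq-c eq-d eq-g (trans (cong (J₋₂ h₁ ℤ.*_) (sym (split h₁ oh₁))) (Jh h₁∣h)) (trans (cong (J₋₂ e ℤ.*_) (sym (split e oe))) Je)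
           (trans (sym (J-bottom (+ 2) {Cb} {Ca} oCb oCa)) (trans (cong (J (+ 2)) (sym eC)) (trans (J-two {C} oC) (cong χ C5))))
           (J-sq (+ Cb) {Ca} oCa cCbCa) (unit-factor {J (+ w') Cb} (J-trit (+ w'') Cb) eq-d (J-sq (+ 2) {Cb} oCb (coprime-2 {Cb} oCb)))
        where
        split : ∀ y → Odd y → J (+ C) y ≡ J (+ y) Cb ℤ.* J (+ y) Ca
        split y oy = trans (J-recip {C} {y} C4' oy) (trans (cong (J (+ y)) eC) (J-bottom (+ y) {Cb} {Ca} oCb oCa))
        w'w'' : w' * w'' ≡ S
        w'w'' = cancelˡ {Ca} (Odd-pos {Ca} oCa) (trans (lem Ca w' w'') (trans (cong (w' *_) (sym ew̄)) w'w̄))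
          where lem : ∀ a b c → a * (b * c) ≡ b * (c * a)
                lem = solve-∀
        w'∣S : w' ∣ S
        w'∣S = divides w'' (trans (sym w'w'') (ℕP.*-comm w' w''))
        CX₀g : ∀ {d} → d ∣ w' → d ∣ h₁ * f → d ∣ C * (X₀ * g₁ * (X₀ * g₁))
        CX₀g d∣w' d∣hf = ∣m+n∣m⇒∣n (∣-trans d∣w' w'∣S) (∣n⇒∣m*n 2 (∣m⇒∣m*n (h₁ * f) d∣hf))
        into : ∀ {d} → Coprime d g₁ → d ∣ C * (X₀ * g₁ * (X₀ * g₁)) → d ∣ X * X
        into {d} cd dd = ∣-trans (coprime-divisorʳ {d} {g₁ * g₁} {C * (X₀ * X₀)} (coprime-*ʳ {d} {g₁} {g₁} cd cd) (subst (d ∣_) (lem C X₀ g₁) dd)) (subst (C * (X₀ * X₀) ∣_) (sym (trans (cong₂ _*_ eX eX) (lem2 C X₀))) (n∣m*n C))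
          where
          lem : ∀ C X g → C * (X * g * (X * g)) ≡ C * (X * X) * (g * g)
          lem = solve-∀
          lem2 : ∀ C X → C * X * (C * X) ≡ C * (C * (X * X))
          lem2 = solve-∀
        cw'h : Coprime w' h₁
        cw'h {d} (d∣w' , d∣h) = chX (∣-trans d∣h h₁∣h , coprime-divisor {d} {X} {X} cdX (into cdg (CX₀g d∣w' (∣m⇒∣m*n f d∣h))))
          where
          cdg : Coprime d g₁
          cdg = coprime-∣ˡ {h₁} {d} {g₁} (coprime-sym {g₁} {h₁} cgh) d∣h
          cdX : Coprime d X
          cdX = coprime-∣ˡ {h} {d} {X} chX (∣-trans d∣h h₁∣h)
        -- A common divisor divides `S`, hence `C X₀² g₁²`, hence `X²`, while the chosen point has
        -- `f` prime to `X`.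
        cw'f : Coprime w' f
        cw'f {d} (d∣w' , d∣f) = cfX (d∣f , coprime-divisor {d} {X} {X} (coprime-∣ˡ {f} {d} {X} cfX d∣f) (into (coprime-∣ˡ {f} {d} {g₁} (coprime-∣ʳ {f} {g₁} {g} c-fg (divides k eg)) d∣f) (CX₀g d∣w' (∣n⇒∣m*n h₁ d∣f))))
        chf : Coprime (h₁ * f) w'
        chf = coprime-*ˡ {h₁} {f} {w'} (coprime-sym {w'} {h₁} cw'h) (coprime-sym {w'} {f} cw'f)
        -- `S ≡ 0` modulo `w'` says `2 (h₁ f)² ≡ -C (X₀ g₁)²`; the square on the right is removed by
        -- `trit-strip`.
        J2w' : J (+ 2) w' ≡ J (-1ℤ ℤ.* + C) w'
        J2w' = trit-strip (J-trit (+ (X₀ * g₁)) w') (trans (sym (J-times-square (+ 2) (h₁ * f) {w'} ow' chf)) (trans (J-resp {w'} ow' congr) (trans (J-mul (-1ℤ ℤ.* + C) (+ (X₀ * g₁ * (X₀ * g₁))) w') (cong (J (-1ℤ ℤ.* + C) w' ℤ.*_) (J-nat-* (X₀ * g₁) (X₀ * g₁) w'))))) (J-sq (+ 2) {w'} ow' (coprime-2 {w'} ow'))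
          where
          congr : Cong w' (+ 2 ℤ.* + (h₁ * f * (h₁ * f))) (-1ℤ ℤ.* + C ℤ.* + (X₀ * g₁ * (X₀ * g₁)))
          congr = cong0-sub⁻ (cong-trans (cong-≡ (trans (lem (+ 2 ℤ.* + (h₁ * f * (h₁ * f))) (+ C) (+ (X₀ * g₁ * (X₀ * g₁)))) (sym (trans (ℤP.pos-+ (2 * (h₁ * f * (h₁ * f))) _) (cong₂ ℤ._+_ (ℤP.pos-* 2 (h₁ * f * (h₁ * f))) (ℤP.pos-* C _)))))) (∣⇒Cong0 w'∣S))
            where lem : ∀ a C b → a ℤ.- -1ℤ ℤ.* C ℤ.* b ≡ a ℤ.+ C ℤ.* b
                  lem = ℤR.solve-∀
        Jw' : J₋₂ w' ℤ.* J (+ C) w' ≡ 1ℤ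
        Jw' = trans (lem (J -1ℤ w') (J (+ 2) w') (J (+ C) w')) (trans (cong (J (+ 2) w' ℤ.*_) (trans (sym (J-mul -1ℤ (+ C) w')) (sym J2w'))) (J-sq (+ 2) {w'} ow' (coprime-2 {w'} ow')))
          where lem : ∀ a b c → a ℤ.* b ℤ.* c ≡ b ℤ.* (a ℤ.* c)
                lem = ℤR.solve-∀
        J2he : ∀ n → J (+ (2 * (h₁ * e))) n ≡ J (+ 2) n ℤ.* (J (+ h₁) n ℤ.* J (+ e) n)
        J2he n = trans (J-nat-* 2 (h₁ * e) n) (cong (J (+ 2) n ℤ.*_) (J-nat-* h₁ e n))
        sumA : w + w̄ ≡ 2 * A
        sumA = trans (lem A B w̄) (trans (cong (_+_ A) w̄+B) (cong (_+_ A) (sym (ℕP.+-identityʳ A))))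
          where lem : ∀ a b v → a + b + v ≡ a + (v + b)
                lem = solve-∀
        -- From `w + w̄ = 2 h₁ e`: `Ca` divides `w̄`, which gives this relation, and `Cb` divides
        -- `w`, which gives the next.
        eq-b : J (+ Cb) Ca ℤ.* J (+ w') Ca ≡ J (+ 2) Ca ℤ.* (J (+ h₁) Ca ℤ.* J (+ e) Ca)
        eq-b = trans (sym (J-nat-* Cb w' Ca)) (trans (J-resp {Ca} oCa (cong-sym (nat-by {Ca} {2 * A} {Cb * w'} w'' (trans (sym sumA) (cong₂ _+_ ew ew̄))))) (J2he Ca))
        eq-c : J (+ Cb) Ca ℤ.* J (+ w'') Cb ≡ J (+ 2) Cb ℤ.* (J (+ h₁) Cb ℤ.* J (+ e) Cb)
        eq-c = trans (cong (ℤ._* J (+ w'') Cb) (J-recip {Cb} {Ca} (C4 Cb∣C) oCa)) (trans (sym (J-nat-* Ca w'' Cb)) (trans (J-resp {Cb} oCb (cong-sym (nat-by {Cb} {2 * A} {Ca * w''} w' (trans (sym sumA) (trans (ℕP.+-comm w w̄) (cong₂ _+_ (trans ew̄ (ℕP.*-comm w'' Ca)) (trans ew (ℕP.*-comm Cb w')))))))) (J2he Cb)))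
        eq-d : J (+ w') Cb ℤ.* J (+ w'') Cb ≡ J (+ 2) Cb
        eq-d = trans (sym (J-nat-* w' w'' Cb)) (trans (cong (λ z → J (+ z) Cb) w'w'') (trans (J-resp {Cb} oCb (cong-trans (nat-by {Cb} {S} {2 * (h₁ * f * (h₁ * f))} (Ca * (X₀ * g₁ * (X₀ * g₁))) (cong (_+_ (2 * (h₁ * f * (h₁ * f)))) (trans (cong (_* (X₀ * g₁ * (X₀ * g₁))) eC) (lem Cb Ca (X₀ * g₁ * (X₀ * g₁)))))) (cong-≡ (ℤP.pos-* 2 (h₁ * f * (h₁ * f)))))) (J-times-square (+ 2) (h₁ * f) {Cb} oCb chfC)))
          where
          lem : ∀ b a x → b * a * x ≡ a * x * b
          lem = solve-∀
          Cb∣X : Cb ∣ X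
          Cb∣X = ∣-trans Cb∣C C∣X
          chfC : Coprime (h₁ * f) Cb
          chfC = coprime-*ˡ {h₁} {f} {Cb} (coprime-∣ʳ {h₁} {Cb} {X} (coprime-∣ˡ {h} {h₁} {X} chX h₁∣h) Cb∣X) (coprime-∣ʳ {f} {Cb} {X} cfX Cb∣X)
        -- The symbols of -2 at `w = Cb w'` and at `h₁ e` agree, and -1 has symbol 1 at `Cb`.
        eq-g : J (+ 2) Cb ℤ.* J₋₂ w' ≡ J₋₂ h₁ ℤ.* J₋₂ e
        eq-g = trans (cong (ℤ._* J₋₂ w') (sym (trans (cong (ℤ._* J (+ 2) Cb) (J-neg1-1mod4 {Cb} (C4 Cb∣C))) (ℤP.*-identityˡ (J (+ 2) Cb))))) (trans (sym (J₋₂-* {Cb} {w'} oCb ow')) (trans (cong J₋₂ (sym ew)) (trans (J₋₂-mod8 {w} {A} ow oA w8) (J₋₂-* {h₁} {e} oh₁ oe))))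

-- A case of rational quartic reciprocity: modulo T the number C ≡ 8 is a quartic residue, since (1+i)⁶ = −8i, whereas
-- T ^ x = C ^ 2Z + E² forces its quartic character to be (2/C) = −1.
quartic-obstruction : ∀ {C T E} k l R → C % 8 ≡ 5 → (∀ {d} → d ∣ C → d % 4 ≡ 1) → C ≡ 8 + T * R →
  T ^ odd k ≡ C ^ odd l * C ^ odd l + E * E → Coprime C E → 8 ∣ E → ⊥
quartic-obstruction {C} {T} {E} k l R C5 C4 eR eT cCE 8∣E = go (square-free-part C 0<C) (square-free-part T 0<T)
  where
  oC : Odd C
  oC = mod8⇒odd {C} C5 refl
  0<C = Odd-pos {C} oC
  1<C : 1 < C
  1<C = ℕP.≤∧≢⇒< 0<C λ { refl → contradiction C5 λ () }
  oT : Odd T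
  oT = Odd-*ˡ {T} {R} (trans (sym (trans (cong (_% 2) eR) (%-remove-+ˡ (T * R) {2} (divides 4 refl)))) oC)
  0<T = Odd-pos {T} oT
  X = C ^ odd l
  oX : Odd X
  oX = Odd-^ {C} (odd l) oC
  cXE : Coprime X E
  cXE = coprime-^ˡ {C} {E} (odd l) cCE
  go : (∃ λ C₀ → ∃ λ c → C ≡ C₀ * (c * c) × SquareFree C₀) → (∃ λ T₀ → ∃ λ τ → T ≡ T₀ * (τ * τ) × SquareFree T₀) → ⊥
  go (C₀ , c , eC , sC) (T₀ , τ , eτ , sT) = finish (legendre-conic {C₀} {T₀} {c} {4} {h} {E} oC₀ oT₀ (coprime-sym {T₀} {C₀} (coprime-∣ʳ {T₀} {C₀} {X} cTX C₀∣X)) (coprime-sym {T₀} {c} (coprime-∣ʳ {T₀} {c} {X} cTX c∣X)) congTℤ (coprime-∣ʳ {h} {C₀} {X} chX C₀∣X) congC)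
    where
    oCC : Odd (C₀ * (c * c))
    oCC = subst Odd eC oC
    oC₀ : Odd C₀
    oC₀ = Odd-*ˡ {C₀} {c * c} oCC
    oc : Odd c
    oc = Odd-*ˡ {c} {c} (Odd-*ʳ {C₀} {c * c} oCC)
    oTT : Odd (T₀ * (τ * τ))
    oTT = subst Odd eτ oT
    oT₀ : Odd T₀
    oT₀ = Odd-*ˡ {T₀} {τ * τ} oTT
    oτ : Odd τ
    oτ = Odd-*ˡ {τ} {τ} (Odd-*ʳ {T₀} {τ * τ} oTT)
    -- Chosen so that the odd power of `T` becomes `T₀ h²`: only the square class of `T` enters the
    -- conic.
    h = T₀ ^ k * τ ^ odd k
    oh : Odd h
    oh = Odd-* {T₀ ^ k} {τ ^ odd k} (Odd-^ {T₀} k oT₀) (Odd-^ {τ} (odd k) oτ)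
    X₀ = c * c * C ^ (2 * l)
    eX : X ≡ C₀ * X₀
    eX = trans (cong (_* C ^ (2 * l)) eC) (ℕP.*-assoc C₀ (c * c) _)
    Th : T ^ odd k ≡ T₀ * (h * h)
    Th = trans (cong (_^ odd k) eτ) (trans (pow-* T₀ (τ * τ) (odd k)) (trans (cong₂ _*_ (cong (T₀ *_) (pow-2* T₀ k)) (pow-* τ τ (odd k))) (lem T₀ (T₀ ^ k) (τ ^ odd k))))
      where lem : ∀ a b c → a * (b * b) * (c * c) ≡ a * (b * c * (b * c))
            lem = solve-∀
    eTh : T₀ * (h * h) ≡ X * X + E * E
    eTh = trans (sym Th) eT
    T₀∣ : T₀ ∣ X * X + E * E
    T₀∣ = subst (T₀ ∣_) eTh (m∣m*n (h * h))
    h∣ : h ∣ X * X + E * E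
    h∣ = subst (h ∣_) eTh (∣n⇒∣m*n T₀ (m∣m*n h))
    cTX : Coprime T₀ X
    cTX = proj₁ (sum-of-squares-coprime {X} {E} {T₀} cXE T₀∣)
    chX : Coprime h X
    chX = proj₁ (sum-of-squares-coprime {X} {E} {h} cXE h∣)
    C₀∣X : C₀ ∣ X
    C₀∣X = subst (C₀ ∣_) (sym eX) (m∣m*n X₀)
    c∣X : c ∣ X
    c∣X = subst (c ∣_) (sym eX) (∣n⇒∣m*n C₀ (∣m⇒∣m*n (C ^ (2 * l)) (m∣m*n c)))
    C₀5 : C₀ % 8 ≡ 5
    C₀5 = trans (sym (trans (mod8-cong-* {C₀} {c * c} {C₀} {1} refl (odd-sq-mod8 {c} oc)) (cong (_% 8) (ℕP.*-identityʳ C₀)))) (trans (cong (_% 8) (sym eC)) C5)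
    T₀1 : T₀ % 8 ≡ 1
    T₀1 = trans (sym (trans (mod8-cong-* {T₀} {h * h} {T₀} {1} refl (odd-sq-mod8 {h} oh)) (cong (_% 8) (ℕP.*-identityʳ T₀)))) (trans (cong (_% 8) eTh) (trans (%-remove-+ʳ (X * X) {E * E} {8} (∣m⇒∣m*n E 8∣E)) (odd-sq-mod8 {X} oX)))
    T₀4 : T₀ % 4 ≡ 1
    T₀4 = mod8⇒mod4 {T₀} T₀1
    2C≡ : 2 * C₀ * (c * c) ≡ 2 * C
    2C≡ = trans (ℕP.*-assoc 2 C₀ (c * c)) (cong (2 *_) (sym eC))
    2C16 : 2 * C ≡ 16 + 2 * R * T
    2C16 = trans (cong (2 *_) eR) (lem T R)
      where lem : ∀ T R → 2 * (8 + T * R) ≡ 16 + 2 * R * T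
            lem = solve-∀
    -- `2C ≡ 16` modulo `T`, so 4 is the square root that `legendre-conic` asks for.
    congT : Cong T₀ (+ (2 * C₀ * (c * c))) (+ 16)
    congT = nat-by {T₀} {2 * C₀ * (c * c)} {16} (2 * R * (τ * τ)) (trans 2C≡ (trans 2C16 (cong (_+_ 16) (trans (cong (2 * R *_) eτ) (lem (2 * R) T₀ (τ * τ))))))
      where lem : ∀ a b c → a * (b * c) ≡ a * c * b
            lem = solve-∀
    congTℤ : Cong T₀ (+ 2 ℤ.* + C₀ ℤ.* (+ c ℤ.* + c)) (+ 4 ℤ.* + 4)
    congTℤ = cong-trans (cong-≡ (sym (trans (ℤP.pos-* (2 * C₀) (c * c)) (cong₂ ℤ._*_ (ℤP.pos-* 2 C₀) (ℤP.pos-* c c))))) congT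
    congC′ : ∀ {m} → m ∣ X → Cong m (+ T₀ ℤ.* + (h * h)) (1ℤ ℤ.* + (E * E))
    congC′ {m} (divides q e) = cong-trans (cong-≡ (sym (ℤP.pos-* T₀ (h * h)))) (cong-trans (nat-by {m} {T₀ * (h * h)} {E * E} (X * q) (trans eTh (trans (ℕP.+-comm (X * X) (E * E)) (cong (_+_ (E * E)) (trans (cong (X *_) e) (sym (ℕP.*-assoc X q m))))))) (cong-≡ (sym (ℤP.*-identityˡ _))))
    congC : Cong C₀ (+ T₀ ℤ.* (+ h ℤ.* + h)) (+ E ℤ.* + E)
    congC = cong-trans (cong-≡ (cong (+ T₀ ℤ.*_) (sym (ℤP.pos-* h h)))) (cong-trans (congC′ C₀∣X) (cong-≡ (trans (ℤP.*-identityˡ _) (ℤP.pos-* E E))))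
    Jc : J (+ c) T₀ ≡ 1ℤ
    Jc = trans (sym (J-recip {T₀} {c} T₀4 oc)) (trans (J-square-class (+ T₀) 1ℤ h E {c} oc (coprime-∣ʳ {h} {c} {X} chX c∣X) (coprime-sym {c} {E} (coprime-∣ˡ {X} {c} {E} cXE c∣X)) (congC′ c∣X)) (J-one c))
    -- Since 16 is a square, `(2C/d) = 1` for `d ∣ T`. Divisors of `h` divide only a power of `T`,
    -- which `dvd-power-ind` covers.
    J2C : ∀ {d} → d ∣ T ^ odd k → Odd d × J (+ (2 * C)) d ≡ 1ℤ
    J2C {d} = dvd-power-ind (λ d → Odd d × J (+ (2 * C)) d ≡ 1ℤ) (refl , J-modulo-1 (+ (2 * C))) (λ {a} {b} (oa , ea) (ob , eb) → Odd-* {a} {b} oa ob , trans (J-bottom (+ (2 * C)) {a} {b} oa ob) (cong₂ ℤ._*_ ea eb)) 0<T base (odd k)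
      where
      base : ∀ {d} → d ∣ T → Odd d × J (+ (2 * C)) d ≡ 1ℤ
      base {d} (divides q e) = od , trans (J-resp {d} od (nat-by {d} {2 * C} {16} (2 * R * q) (trans 2C16 (cong (_+_ 16) (trans (cong (2 * R *_) e) (sym (ℕP.*-assoc (2 * R) q d))))))) (J-square 4 {d} od (coprime-*ˡ {2} {2} {d} (coprime-2 {d} od) (coprime-2 {d} od)))
        where od : Odd d
              od = Odd-∣ (divides q e) oT
    Jh : ∀ {d} → d ∣ h → J₋₂ d ℤ.* J (+ C₀) d ≡ 1ℤ
    Jh {d} d∣h = use (J2C (∣-trans d∣h (subst (h ∣_) (sym Th) (∣n⇒∣m*n T₀ (m∣m*n h)))))
      where
      use : Odd d × J (+ (2 * C)) d ≡ 1ℤ → J₋₂ d ℤ.* J (+ C₀) d ≡ 1ℤ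
      use (od , e) = trans (cong (λ z → z ℤ.* J (+ 2) d ℤ.* J (+ C₀) d) (sum-of-squares-minus-one {X} {E} {d} od cXE (∣-trans d∣h h∣)))
        (trans (cong (ℤ._* J (+ C₀) d) (ℤP.*-identityˡ (J (+ 2) d))) (trans (sym (J-nat-* 2 C₀ d)) (trans (sym (J-times-square (+ (2 * C₀)) c {d} od (coprime-sym {d} {c} (coprime-∣ˡ {h} {d} {c} (coprime-∣ʳ {h} {c} {X} chX c∣X) d∣h)))) (trans (cong (λ z → J z d) (trans (sym (ℤP.pos-* (2 * C₀) (c * c))) (cong +_ 2C≡))) e))))
    finish : Solution (2 * C₀) T₀ → ⊥
    -- The first reduction provides the coprime `e` and `f` that `move-off` starts from. The rotated
    -- point may have common factors again and is reduced a second time.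
    finish s₀ = step (primitive-solution sq2C sT s₀)
      where
      sq2C : SquareFree (2 * C₀)
      sq2C = SquareFree-2* {C₀} oC₀ sC
      last : (s : Solution (2 * C₀) T₀) → Coprime (Solution.f s) C → (Σ (Primitive (2 * C₀) T₀) λ p → Primitive.f p ∣ Solution.f s) → ⊥
      last s cs (p , f∣) = conic-obstruction {C₀} {T₀} {X} {X₀} {E} {h} {c} eX C₀5 T₀1 sC oh 8∣E (λ d∣ → C4 (∣-trans d∣ (subst (C₀ ∣_) (sym eC) (m∣m*n (c * c))))) eTh cXE Jc congT Jh p cpX
        where
        cpX : Coprime (Primitive.f p) X
        cpX = coprime-^ʳ {Primitive.f p} {C} (odd l) (coprime-∣ˡ {Solution.f s} {Primitive.f p} {C} cs f∣)
      moved : (Σ (Solution (2 * C₀) T₀) λ s → Coprime (Solution.f s) C) → ⊥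
      moved (s , cs) = last s cs (primitive-solution sq2C sT s)
      step : (Σ (Primitive (2 * C₀) T₀) λ p → Primitive.f p ∣ Solution.f s₀) → ⊥
      step (p , _) = moved (move-off {2 * C₀} {T₀} {C} (*-pos {2} (s≤s z≤n) (Odd-pos {C₀} oC₀)) (Odd-pos {T₀} oT₀) 1<C oC p)

-- Square classes and Legendre symbols

-- Equality up to squares of units. It passes to every divisor of the modulus, and at a prime it
-- determines the Legendre symbol, the value 0 included.
record SquareClass (n a b : ℕ) : Set where
  constructor sqc
  field
    r s : ℕ
    cr : Coprime r n
    cs : Coprime s n
    eq : Cong n (+ (a * (r * r))) (+ (b * (s * s)))

sqc-sym : ∀ {n a b} → SquareClass n a b → SquareClass n b a
sqc-sym (sqc r s cr cs eq) = sqc s r cs cr (cong-sym eq)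

sqc-trans : ∀ {n a b c} → SquareClass n a b → SquareClass n b c → SquareClass n a c
sqc-trans {n} {a} {b} {c} (sqc r s cr cs e) (sqc p q cp cq f) = sqc (r * p) (q * s) (coprime-*ˡ {r} {p} {n} cr cp) (coprime-*ˡ {q} {s} {n} cq cs)
  (cong-trans (cong-≡ (cong +_ (l1 a r p))) (cong-trans (nat-cong-* (a * (r * r)) (b * (s * s)) (p * p) (p * p) e cong-refl)
    (cong-trans (cong-≡ (cong +_ (l2 b s p))) (cong-trans (nat-cong-* (b * (p * p)) (c * (q * q)) (s * s) (s * s) f cong-refl) (cong-≡ (cong +_ (l3 c q s)))))))
  where
  l1 : ∀ a r p → a * (r * p * (r * p)) ≡ a * (r * r) * (p * p)
  l1 = solve-∀
  l2 : ∀ b s p → b * (s * s) * (p * p) ≡ b * (p * p) * (s * s)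
  l2 = solve-∀
  l3 : ∀ c q s → c * (q * q) * (s * s) ≡ c * (q * s * (q * s))
  l3 = solve-∀

sqc-* : ∀ {n a b c d} → SquareClass n a b → SquareClass n c d → SquareClass n (a * c) (b * d)
sqc-* {n} {a} {b} {c} {d} (sqc r s cr cs e) (sqc p q cp cq f) = sqc (r * p) (s * q) (coprime-*ˡ {r} {p} {n} cr cp) (coprime-*ˡ {s} {q} {n} cs cq)
  (cong-trans (cong-≡ (cong +_ (l a c r p))) (cong-trans (nat-cong-* (a * (r * r)) (b * (s * s)) (c * (p * p)) (d * (q * q)) e f) (cong-≡ (cong +_ (sym (l b d s q))))))
  where
  l : ∀ a c r p → a * c * (r * p * (r * p)) ≡ a * (r * r) * (c * (p * p))
  l = solve-∀

sqc-cong : ∀ {n a b} → Cong n (+ a) (+ b) → SquareClass n a b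
sqc-cong {n} {a} {b} e = sqc 1 1 (coprime-1 n) (coprime-1 n) (nat-cong-* a b 1 1 e cong-refl)

sqc-≡ : ∀ {n a b} → a ≡ b → SquareClass n a b
sqc-≡ refl = sqc-cong cong-refl

sqc-refl : ∀ {n a} → SquareClass n a a
sqc-refl = sqc-≡ refl

sqc-square : ∀ {n} r → Coprime r n → SquareClass n (r * r) 1
sqc-square {n} r c = sqc 1 r (coprime-1 n) c (cong-≡ (cong +_ (lem r)))
  where lem : ∀ r → r * r * 1 ≡ 1 * (r * r)
        lem = solve-∀

sqc-even-pow : ∀ {n} a k → Coprime a n → SquareClass n (a ^ (2 * k)) 1
sqc-even-pow {n} a k c = sqc-trans (sqc-≡ (pow-2* a k)) (sqc-square (a ^ k) (coprime-^ˡ {a} {n} k c))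

sqc-odd-pow : ∀ {n} a k → Coprime a n → SquareClass n (a ^ odd k) a
sqc-odd-pow {n} a k c = sqc-trans (sqc-* (sqc-refl {n} {a}) (sqc-even-pow a k c)) (sqc-≡ (ℕP.*-identityʳ a))

sqc-times-1 : ∀ {n a b} → SquareClass n b 1 → SquareClass n (a * b) a
sqc-times-1 {n} {a} e = sqc-trans (sqc-* (sqc-refl {n} {a}) e) (sqc-≡ (ℕP.*-identityʳ a))

sqc-1-times : ∀ {n a b} → SquareClass n b 1 → SquareClass n (b * a) a
sqc-1-times {n} {a} {b} e = sqc-trans (sqc-≡ (ℕP.*-comm b a)) (sqc-times-1 e)

sqc-∣ : ∀ {m n a b} → m ∣ n → SquareClass n a b → SquareClass m a b
sqc-∣ {m} {n} m∣n (sqc r s cr cs e) = sqc r s (coprime-∣ʳ {r} {m} {n} cr m∣n) (coprime-∣ʳ {s} {m} {n} cs m∣n) (cong-∣ m∣n e)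

J-sqc : ∀ {n a b} → Odd n → SquareClass n a b → J (+ a) n ≡ J (+ b) n
J-sqc {n} {a} {b} o (sqc r s cr cs e) = J-square-class (+ a) (+ b) r s {n} o cr cs (cong-trans (cong-≡ (sym (ℤP.pos-* a (r * r)))) (cong-trans e (cong-≡ (ℤP.pos-* b (s * s)))))

cong⇒% : ∀ {n} .{{_ : NonZero n}} a b → Cong n (+ a) (+ b) → a % n ≡ b % n
cong⇒% {n} a b (by (+ m) e) = trans (cong (_% n) (ℤP.+-injective (trans e (trans (cong (ℤ._+_ (+ b)) (sym (ℤP.pos-* m n))) (sym (ℤP.pos-+ b (m * n))))))) ([m+kn]%n≡m%n b m n)
cong⇒% {n} a b (by -[1+ m ] e) = sym (trans (cong (_% n) (ℤP.+-injective (trans (lem (+ b) (+ suc m) (+ n)) (trans (cong (ℤ._+ + suc m ℤ.* + n) (sym e)) (trans (cong (ℤ._+_ (+ a)) (sym (ℤP.pos-* (suc m) n))) (sym (ℤP.pos-+ a (suc m * n)))))))) ([m+kn]%n≡m%n a (suc m) n))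
  where lem : ∀ b m n → b ≡ b ℤ.+ (ℤ.- m) ℤ.* n ℤ.+ m ℤ.* n
        lem = ℤR.solve-∀

%⇒cong : ∀ {n} .{{_ : NonZero n}} a b → a % n ≡ b % n → Cong n (+ a) (+ b)
%⇒cong {n} a b e = cong0-sub⁻ (cong-mod n {+ a} {+ b} e)

sqc-dvd : ∀ {p a b} → SquareClass p a b → p ∣ a → p ∣ b
sqc-dvd {p} {a} {b} (sqc r s cr cs e) p∣a = coprime-divisorʳ {p} {s * s} {b} (coprime-sym {s * s} {p} (coprime-*ˡ {s} {s} {p} cs cs))
   (Cong0⇒∣ {p} {+ (b * (s * s))} (cong-trans (cong-sym e) (∣⇒Cong0 {p} {+ (a * (r * r))} (∣m⇒∣m*n (r * r) p∣a))))

IsSquareMod : (p a : ℕ) → .{{NonZero p}} → Set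
IsSquareMod p a = ∃ λ (x : Fin p) → (toℕ x * toℕ x) % p ≡ a % p

-- From `x² ≡ a` the number `x r / s` is a square root of `b`. The inverse of `s` may be replaced by
-- its absolute value, as only its square occurs.
sqc-is-square : ∀ {p a b} .{{_ : NonZero p}} → SquareClass p a b → IsSquareMod p a → IsSquareMod p b
sqc-is-square {p} {a} {b} (sqc r s cr cs e) (x , ex) = build (coprime⇒inv s p cs)
  where
  build : Inv p (+ s) → IsSquareMod p b
  build (s' , inv) = fromℕ< (m%n<n y p) , trans (cong (λ z → (z * z) % p) (toℕ-fromℕ< (m%n<n y p))) (trans (sym (%-distribˡ-* y y p)) (cong⇒% (y * y) b congr))
    where
    t = abs s'
    y = toℕ x * r * t
    inv² : Cong p (+ (s * s * (t * t))) 1ℤ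
    inv² = cong-trans (cong-≡ (trans (ℤP.pos-* (s * s) (t * t)) (trans (cong₂ ℤ._*_ (ℤP.pos-* s s) (abs-sq s')) (lem (+ s) s')))) (cong-* inv inv)
      where lem : ∀ s t → s ℤ.* s ℤ.* (t ℤ.* t) ≡ t ℤ.* s ℤ.* (t ℤ.* s)
            lem = ℤR.solve-∀
    congr : Cong p (+ (y * y)) (+ b)
    congr = cong-trans (cong-≡ (cong +_ (l1 (toℕ x) r t))) (cong-trans (nat-cong-* (toℕ x * toℕ x * (r * r)) (b * (s * s)) (t * t) (t * t) (cong-trans (nat-cong-* (toℕ x * toℕ x) a (r * r) (r * r) (%⇒cong _ a ex) cong-refl) e) cong-refl)
       (cong-trans (cong-≡ (cong +_ (l2 b s t))) (cong-trans (nat-cong-* b b (s * s * (t * t)) 1 cong-refl inv²) (cong-≡ (cong +_ (ℕP.*-identityʳ b))))))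
      where
      l1 : ∀ x r t → x * r * t * (x * r * t) ≡ x * x * (r * r) * (t * t)
      l1 = solve-∀
      l2 : ∀ b s t → b * (s * s) * (t * t) ≡ b * (s * s * (t * t))
      l2 = solve-∀

legendre-cong : ∀ q a b → (suc q ∣ a → suc q ∣ b) → (suc q ∣ b → suc q ∣ a) → (IsSquareMod (suc q) a → IsSquareMod (suc q) b) → (IsSquareMod (suc q) b → IsSquareMod (suc q) a) →
  legendre a (suc q) ≡ legendre b (suc q)
legendre-cong q a b d d' s s' with suc q ∣? a | suc q ∣? b
... | yes _ | yes _ = refl
... | yes x | no y = contradiction (d x) y
... | no x | yes y = contradiction (d' y) x
... | no _ | no _ with any? (λ (x : Fin (suc q)) → (toℕ x * toℕ x) % suc q ℕP.≟ a % suc q) | any? (λ (x : Fin (suc q)) → (toℕ x * toℕ x) % suc q ℕP.≟ b % suc q)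
... | yes _ | yes _ = refl
... | yes x | no y = contradiction (s x) y
... | no x | yes y = contradiction (s' y) x
... | no _ | no _ = refl

legendre-sqc : ∀ {p a b} → 0 < p → SquareClass p a b → legendre a p ≡ legendre b p
legendre-sqc {suc q} {a} {b} _ e = legendre-cong q a b (sqc-dvd e) (sqc-dvd (sqc-sym e)) (sqc-is-square {suc q} e) (sqc-is-square {suc q} (sqc-sym e))

legendre-one : ∀ {p} → 1 < p → legendre 1 p ≡ 1ℤ
legendre-one {suc zero} (s≤s ())
legendre-one {suc (suc q)} _ with suc (suc q) ∣? 1
... | yes d = contradiction (∣1⇒≡1 d) λ ()
... | no _ with any? (λ (x : Fin (suc (suc q))) → (toℕ x * toℕ x) % suc (suc q) ℕP.≟ 1 % suc (suc q))
... | yes _ = refl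
... | no none = ⊥-elim (none (Fin.suc Fin.zero , refl))

χ₈-* : ∀ {a b} → Odd a → Odd b → χ₈ (a * b) ≡ χ₈ a ℤ.* χ₈ b
χ₈-* {a} {b} oa ob = trans (sym (J-two {a * b} (Odd-* {a} {b} oa ob))) (trans (J-bottom (+ 2) {a} {b} oa ob) (cong₂ ℤ._*_ (J-two {a} oa) (J-two {b} ob)))

χ₈-unit : ∀ {a} → Odd a → χ₈ a ℤ.* χ₈ a ≡ 1ℤ
χ₈-unit {a} o = trans (cong (λ z → z ℤ.* z) (sym (J-two {a} o))) (J-sq (+ 2) {a} o (coprime-2 {a} o))

χ₈-mod8 : ∀ {a b} → a % 8 ≡ b % 8 → χ₈ a ≡ χ₈ b
χ₈-mod8 e = cong χ e

χ₈-plus : ∀ {a} → Odd a → χ₈ a ≡ 1ℤ → a % 8 ≡ 1 ⊎ a % 8 ≡ 7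
χ₈-plus {a} o e = go (a % 8) refl (odd-res {a} o)
  where
  go : ∀ r → a % 8 ≡ r → OddRes r → a % 8 ≡ 1 ⊎ a % 8 ≡ 7
  go _ f r1 = inj₁ f
  go _ f r7 = inj₂ f
  go _ f r3 = contradiction (trans (sym (cong χ f)) e) λ ()
  go _ f r5 = contradiction (trans (sym (cong χ f)) e) λ ()

χ₈-minus : ∀ {a} → Odd a → χ₈ a ≡ -1ℤ → a % 8 ≡ 3 ⊎ a % 8 ≡ 5
χ₈-minus {a} o e = go (a % 8) refl (odd-res {a} o)
  where
  go : ∀ r → a % 8 ≡ r → OddRes r → a % 8 ≡ 3 ⊎ a % 8 ≡ 5
  go _ f r3 = inj₁ f
  go _ f r5 = inj₂ f
  go _ f r1 = contradiction (trans (sym (cong χ f)) e) λ ()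
  go _ f r7 = contradiction (trans (sym (cong χ f)) e) λ ()

nat-mod : ∀ {n} a b i j → a + i * n ≡ b + j * n → Cong n (+ a) (+ b)
nat-mod {n} a b i j e = cong-trans (cong-sym (nat-by {n} {a + i * n} {a} i refl)) (cong-trans (cong-≡ (cong +_ e)) (nat-by {n} {b + j * n} {b} j refl))

-- u is a square root of −4 modulo C, so numbers with sum 0 modulo C lie in the same class.
sqc-neg : ∀ {u C a b} q → C ≡ u * u + 4 → Odd u → a + b ≡ q * C → SquareClass C a b
sqc-neg {u} {C} {a} {b} q eC ou e = sqc u 2 cuC (coprime-2 {C} oC) (nat-mod (a * (u * u)) (b * (2 * 2)) (4 * q) a
    (trans (cong (_+_ (a * (u * u))) (trans (ℕP.*-assoc 4 q C) (cong (4 *_) (sym e)))) (trans (lem a b (u * u)) (cong (λ z → b * 4 + a * z) (sym eC)))))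
  where
  lem : ∀ a b v → a * v + 4 * (a + b) ≡ b * 4 + a * (v + 4)
  lem = solve-∀
  oC : Odd C
  oC = trans (cong (_% 2) eC) (trans (%-remove-+ʳ (u * u) {4} {2} (divides 2 refl)) (Odd-* {u} {u} ou ou))
  cuC : Coprime u C
  cuC {d} (d∣u , d∣C) = coprime-*ˡ {2} {2} {u} (coprime-2 {u} ou) (coprime-2 {u} ou) (∣m+n∣m⇒∣n (subst (d ∣_) eC d∣C) (∣m⇒∣m*n u d∣u) , d∣u)

-- Exceptional solutions

-- The exceptional solution with C = u² + 4, z = x + d and y = x + d + k.
record Exceptional (u C u₁ u₂ n x d k : ℕ) : Set where
  field
    pu  : Prime u
    ou  : Odd u
    eC  : C ≡ u * u + 4
    eu  : C ≡ u₁ * u₂ + 8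
    cnC : Coprime n C
    c12 : Coprime u₁ u₂
    0<x : 0 < x
    0<d : 0 < d
    0<k : 0 < k
    eq  : C ^ (x + d) ≡ u₁ ^ x + (4 * u) ^ (x + d + k) * n ^ k
    en  : n ^ d ≡ u₂ ^ x

Odd-root : ∀ {a} k → 0 < k → Odd (a ^ k) → Odd a
Odd-root {a} (suc k) _ o = Odd-*ˡ {a} {a ^ k} o

prime-coprime : ∀ {p m} → Prime p → ¬ (p ∣ m) → Coprime p m
prime-coprime {p} pp p∤m (d∣p , d∣m) with prime⇒irreducible pp d∣p
... | inj₁ e = e
... | inj₂ refl = contradiction d∣m p∤m

module Facts {u C u₁ u₂ n x d k : ℕ} (S : Exceptional u C u₁ u₂ n x d k) where
  open Exceptional S

  C5 : C % 8 ≡ 5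
  C5 = trans (cong (_% 8) eC) (trans (%-distribˡ-+ (u * u) 4 8) (cong (λ z → (z + 4) % 8) (odd-sq-mod8 {u} ou)))

  oC : Odd C
  oC = mod8⇒odd {C} C5 refl

  -- `C` is the sum of the coprime squares of `u` and 2, so -1 has symbol 1 at each of its divisors.
  C4 : ∀ {t} → t ∣ C → t % 4 ≡ 1
  C4 {t} t∣C = J-minus-one⇒1mod4 {t} ot (sum-of-squares-minus-one {u} {2} {t} ot (λ {e} (a , b) → coprime-2 {u} ou (b , a)) (subst (t ∣_) eC t∣C))
    where ot : Odd t
          ot = Odd-∣ t∣C oC

  ou₁u₂ : Odd (u₁ * u₂)
  ou₁u₂ = trans (sym (trans (cong (_% 2) eu) (%-remove-+ʳ (u₁ * u₂) {8} {2} (divides 4 refl)))) oC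

  ou₁ : Odd u₁
  ou₁ = Odd-*ˡ {u₁} {u₂} ou₁u₂

  ou₂ : Odd u₂
  ou₂ = Odd-*ʳ {u₁} {u₂} ou₁u₂

  on : Odd n
  on = Odd-root {n} d 0<d (subst Odd (sym en) (Odd-^ {u₂} x ou₂))

  0<n : 0 < n
  0<n = Odd-pos {n} on

  u₁u₂≡5 : (u₁ * u₂) % 8 ≡ 5
  u₁u₂≡5 = trans (sym (%-remove-+ʳ (u₁ * u₂) {8} {8} (divides 1 refl))) (trans (cong (_% 8) (sym eu)) C5)

  -- C ≡ 8 modulo t, hence (t/C) = (C/t) = (2/t).
  J-divisor : ∀ {t} q → C ≡ t * q + 8 → Odd t × J (+ t) C ≡ χ₈ t
  J-divisor {t} q e = ot , trans (sym (J-recip {C} {t} (mod8⇒mod4 {C} C5) ot)) (trans (J-resp {t} ot (nat-by {t} {C} {8} q (trans e (trans (ℕP.+-comm (t * q) 8) (cong (_+_ 8) (ℕP.*-comm t q))))))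
       (trans (J-times-square (+ 2) 2 {t} ot (coprime-2 {t} ot)) (J-two {t} ot)))
    where ot : Odd t
          ot = Odd-*ˡ {t} {q} (trans (sym (trans (cong (_% 2) e) (%-remove-+ʳ (t * q) {8} {2} (divides 4 refl)))) oC)

  J-∣u₁ : ∀ {t} → t ∣ u₁ → Odd t × J (+ t) C ≡ χ₈ t
  J-∣u₁ {t} (divides q e) = J-divisor {t} (q * u₂) (trans eu (cong (_+ 8) (trans (cong (_* u₂) e) (lem q t u₂))))
    where lem : ∀ q t v → q * t * v ≡ t * (q * v)
          lem = solve-∀

  J-∣u₂ : ∀ {t} → t ∣ u₂ → Odd t × J (+ t) C ≡ χ₈ t
  J-∣u₂ {t} (divides q e) = J-divisor {t} (q * u₁) (trans eu (cong (_+ 8) (trans (cong (u₁ *_) e) (lem q t u₁))))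
    where lem : ∀ q t v → v * (q * t) ≡ t * (q * v)
          lem = solve-∀

  n∣u₂^x : n ∣ u₂ ^ x
  n∣u₂^x = subst (n ∣_) en (base d 0<d)
    where base : ∀ d → 0 < d → n ∣ n ^ d
          base (suc d) _ = m∣m*n (n ^ d)

  -- A divisor of `n` divides `u₂ ^ x` but perhaps not `u₂`. Both sides are multiplicative in `t`,
  -- so the rule passes from divisors of `u₂` to those of its powers.
  J-∣n : ∀ {t} → t ∣ n → Odd t × J (+ t) C ≡ χ₈ t
  J-∣n {t} t∣n = dvd-power-ind (λ t → Odd t × J (+ t) C ≡ χ₈ t) (refl , J-one C)
     (λ {a} {b} (oa , ea) (ob , eb) → Odd-* {a} {b} oa ob , trans (J-nat-* a b C) (trans (cong₂ ℤ._*_ ea eb) (sym (χ₈-* {a} {b} oa ob))))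
     (Odd-pos {u₂} ou₂) J-∣u₂ x (∣-trans t∣n n∣u₂^x)

  J-two-C : J (+ 2) C ≡ -1ℤ
  J-two-C = trans (J-two {C} oC) (cong χ C5)

  cuC : Coprime u C
  cuC {e} (e∣u , e∣C) = coprime-*ˡ {2} {2} {u} (coprime-2 {u} ou) (coprime-2 {u} ou) (∣m+n∣m⇒∣n (subst (e ∣_) eC e∣C) (∣m⇒∣m*n u e∣u) , e∣u)

  c2C : Coprime 2 C
  c2C = coprime-2 {C} oC

  c4 : ∀ {m} → Odd m → Coprime 4 m
  c4 {m} om = coprime-*ˡ {2} {2} {m} (coprime-2 {m} om) (coprime-2 {m} om)

  -- (u + 2)² = C + 4u
  sqc-u : SquareClass C u 1
  sqc-u = sqc 2 (u + 2) c2C cu2 (cong-sym (nat-by {C} {1 * ((u + 2) * (u + 2))} {u * (2 * 2)} 1 (trans (lem u) (cong (λ z → u * 4 + 1 * z) (sym eC)))))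
    where
    lem : ∀ u → 1 * ((u + 2) * (u + 2)) ≡ u * 4 + 1 * (u * u + 4)
    lem = solve-∀
    lem2 : ∀ u → (u + 2) * (u + 2) ≡ u * u + 4 + 4 * u
    lem2 = solve-∀
    cu2 : Coprime (u + 2) C
    cu2 {e} (e∣u2 , e∣C) = coprime-*ˡ {4} {u} {C} (c4 {C} oC) cuC (∣m+n∣m⇒∣n (subst (e ∣_) (trans (lem2 u) (cong (_+ 4 * u) (sym eC))) (∣m⇒∣m*n (u + 2) e∣u2)) e∣C , e∣C)

  sqc-4u^ : ∀ y → SquareClass C ((4 * u) ^ y) 1
  sqc-4u^ zero = sqc-refl
  sqc-4u^ (suc y) = sqc-trans (sqc-1-times (sqc-trans (sqc-* (sqc-square 2 c2C) sqc-u) (sqc-≡ refl))) (sqc-4u^ y)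

  sqc-u^ : ∀ y → SquareClass C (u ^ y) 1
  sqc-u^ zero = sqc-refl
  sqc-u^ (suc y) = sqc-trans (sqc-1-times sqc-u) (sqc-u^ y)

  uu≡ : u * u ≡ u₁ * u₂ + 4
  uu≡ = ℕP.+-cancelʳ-≡ 4 _ _ (trans (sym eC) (trans eu (sym (ℕP.+-assoc (u₁ * u₂) 4 4))))

  cuu₁ : Coprime u u₁
  cuu₁ {e} (e∣u , e∣u₁) = c4 {u} ou (∣m+n∣m⇒∣n {_} {u₁ * u₂} (subst (e ∣_) uu≡ (∣m⇒∣m*n u e∣u)) (∣m⇒∣m*n u₂ e∣u₁) , e∣u)

  cCu₁ : Coprime C u₁
  cCu₁ {e} (e∣C , e∣u₁) = coprime-*ˡ {2} {4} {C} c2C (c4 {C} oC) (∣m+n∣m⇒∣n (subst (e ∣_) eu e∣C) (∣m⇒∣m*n u₂ e∣u₁) , e∣C)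

  cuu₂ : Coprime u u₂
  cuu₂ {e} (e∣u , e∣u₂) = c4 {u} ou (∣m+n∣m⇒∣n {_} {u₁ * u₂} (subst (e ∣_) uu≡ (∣m⇒∣m*n u e∣u)) (∣n⇒∣m*n u₁ e∣u₂) , e∣u)

  cnu₁ : Coprime n u₁
  cnu₁ = coprime-∣ˡ {u₂ ^ x} {n} {u₁} (coprime-^ˡ {u₂} {u₁} x (λ (a , b) → c12 (b , a))) n∣u₂^x

  8∣P : 8 ∣ (4 * u) ^ (x + d + k) * n ^ k
  8∣P = ∣m⇒∣m*n (n ^ k) (go x d k 0<x 0<d)
    where
    go : ∀ x d k → 0 < x → 0 < d → 8 ∣ (4 * u) ^ (x + d + k)
    go (suc x) (suc d) k _ _ = subst (λ z → 8 ∣ (4 * u) ^ (suc z + k)) (sym (ℕP.+-suc x d)) (subst (8 ∣_) (lem u ((4 * u) ^ (x + d + k))) (m∣m*n (2 * u * u * (4 * u) ^ (x + d + k))))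
      where lem : ∀ u w → 8 * (2 * u * u * w) ≡ 4 * u * (4 * u * w)
            lem = solve-∀

  mod8 : (C ^ (x + d)) % 8 ≡ (u₁ ^ x) % 8
  mod8 = trans (cong (_% 8) eq) (%-remove-+ʳ (u₁ ^ x) 8∣P)

-- Odd x

V₂-of : ∀ {t a} j → t ≡ 2 ^ a * odd j → V₂ t a
V₂-of {t} {a} j e = subst (λ z → V₂ z a) (sym e) (V₂-intro a j)

prime-pos : ∀ {p} → Prime p → 0 < p
prime-pos {p} pp = >-nonZero⁻¹ p {{prime⇒nonZero pp}}

even-two-adic : ∀ t → 0 < t → ∃ λ a → V₂ (2 * t) (suc a)
even-two-adic t 0<t with two-adic t 0<t
... | a , j , e = a , V₂-of {2 * t} {suc a} j (trans (cong (2 *_) e) (sym (ℕP.*-assoc 2 (2 ^ a) (odd j))))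

root-coprime : ∀ {w n m} i j → w ^ odd i ≡ n ^ odd j → Coprime n m → Coprime w m
root-coprime {w} {n} {m} i j e c = coprime-∣ˡ {n ^ odd j} {w} {m} (coprime-^ˡ {n} {m} (odd j) c) (subst (w ∣_) e (m∣m*n (w ^ (2 * i))))

-- Odd powers preserve square classes. This transfers to `w` what the equation says about `n`.
root-sqc : ∀ {w n m} i j → w ^ odd i ≡ n ^ odd j → Coprime n m → SquareClass m w n
root-sqc {w} {n} {m} i j e c = sqc-trans (sqc-sym (sqc-odd-pow w i (root-coprime {w} {n} {m} i j e c))) (sqc-trans (sqc-≡ e) (sqc-odd-pow n j c))

even-∤odd : ∀ {m} k l → m ≡ 2 * k → m ≡ odd l → ⊥
even-∤odd k l e f = 2∤odd l (subst (2 ∣_) (trans (sym e) f) (m∣m*n k))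

OddExponent₂ : (u C x y z u₁ w : ℕ) → Set
OddExponent₂ u C x y z u₁ w = (w % 8 ≡ 3 ⊎ w % 8 ≡ 5) × x % 2 ≡ 1 × z % 2 ≡ 1 × (∃[ k ] (1 ≤ k × V₂ y k)) × u % 4 ≡ 1
  × (∀ p → Prime p → p ∣ C → legendre u₁ p ≡ legendre w p)
  × (∀ p → Prime p → p ∣ u₁ → legendre w p ≡ legendre C p)

module OddExponent {u C u₁ u₂ n x d k : ℕ} (S : Exceptional u C u₁ u₂ n x d k) (i : ℕ) (ex : x ≡ odd i) where
  open Exceptional S
  open Facts S

  P : ℕ
  P = (4 * u) ^ (x + d + k) * n ^ k

  u₁x~u₁ : ∀ {m} → Coprime u₁ m → SquareClass m (u₁ ^ x) u₁
  u₁x~u₁ c = sqc-trans (sqc-≡ (cong (u₁ ^_) ex)) (sqc-odd-pow u₁ i c)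

  -- Modulo `C` the equation makes `u₁ ^ x` the negative of `(4u) ^ y n ^ k`; both the sign and `4u`
  -- are squares.
  u₁~nᵏ : SquareClass C u₁ (n ^ k)
  u₁~nᵏ = sqc-trans (sqc-sym (u₁x~u₁ (λ (a , b) → cCu₁ (b , a)))) (sqc-trans (sqc-neg {u} (C ^ (2 * i + d)) eC ou (trans (sym eq) (trans (cong (λ t → C ^ (t + d)) ex) (ℕP.*-comm C (C ^ (2 * i + d)))))) (sqc-1-times (sqc-4u^ (x + d + k))))

  Ju₁ : J (+ u₁) C ≡ χ₈ u₁
  Ju₁ = proj₂ (J-∣u₁ ∣-refl)

  Jn : J (+ n) C ≡ χ₈ n
  Jn = proj₂ (J-∣n ∣-refl)

  u₁ˣ%8 : (u₁ ^ x) % 8 ≡ u₁ % 8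
  u₁ˣ%8 = trans (cong (λ t → (u₁ ^ t) % 8) ex) (odd-pow-mod8 {u₁} i ou₁)

  module OddZ (l : ℕ) (ez : x + d ≡ odd l) where

    u₁5 : u₁ % 8 ≡ 5
    u₁5 = trans (sym u₁ˣ%8) (trans (sym mod8) (trans (cong (λ t → (C ^ t) % 8) ez) (trans (odd-pow-mod8 {C} l oC) C5)))

    -- For even `k` the number `u₁` would be a square class modulo `C` equal to 1, against
    -- `(u₁/C) = χ₈ u₁ = -1`.
    k-odd : ∃ λ k' → k ≡ odd k'
    k-odd with halves k
    ... | k' , inj₂ e = k' , e
    ... | k' , inj₁ e = contradiction (trans (sym (trans Ju₁ (cong χ u₁5))) (trans (J-sqc {C} oC (sqc-trans u₁~nᵏ (sqc-trans (sqc-≡ (cong (n ^_) e)) (sqc-even-pow n k' cnC)))) (J-one C))) λ ()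

    u₁~n : SquareClass C u₁ n
    u₁~n = sqc-trans u₁~nᵏ (sqc-trans (sqc-≡ (cong (n ^_) (proj₂ k-odd))) (sqc-odd-pow n (proj₁ k-odd) cnC))

    χn : χ₈ n ≡ -1ℤ
    χn = trans (sym Jn) (trans (sym (J-sqc {C} oC u₁~n)) (trans Ju₁ (cong χ u₁5)))

    y≡ : x + d + k ≡ 2 * (suc (l + proj₁ k-odd))
    y≡ = trans (cong₂ _+_ ez (proj₂ k-odd)) (lem l (proj₁ k-odd))
      where lem : ∀ l k → suc (2 * l) + suc (2 * k) ≡ 2 * (suc (l + k))
            lem = solve-∀

    y-even : ∃[ t ] (1 ≤ t × V₂ (x + d + k) t)
    y-even with even-two-adic (suc (l + proj₁ k-odd)) (s≤s z≤n)
    ... | a , v = suc a , s≤s z≤n , subst (λ t → V₂ t (suc a)) (sym y≡) v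

    -- Modulo `u₁` the equation reads `C ^ z ≡ (4u) ^ y n ^ k` with `z` and `k` odd and `y` even.
    C~n : SquareClass u₁ C n
    C~n = sqc-trans (sqc-sym (sqc-trans (sqc-≡ (cong (C ^_) ez)) (sqc-odd-pow C l cCu₁)))
       (sqc-trans (sqc-cong (nat-by {u₁} {C ^ (x + d)} {P} (u₁ ^ (2 * i)) (trans eq (trans (ℕP.+-comm (u₁ ^ x) P) (cong (_+_ P) (trans (cong (u₁ ^_) ex) (ℕP.*-comm u₁ (u₁ ^ (2 * i)))))))))
       (sqc-trans (sqc-1-times (sqc-trans (sqc-≡ (cong ((4 * u) ^_) y≡)) (sqc-even-pow (4 * u) (suc (l + proj₁ k-odd)) (coprime-*ˡ {4} {u} {u₁} (c4 {u₁} ou₁) cuu₁))))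
       (sqc-trans (sqc-≡ (cong (n ^_) (proj₂ k-odd))) (sqc-odd-pow n (proj₁ k-odd) cnu₁))))

    -- Modulo u the class of u₁ is that of C ≡ 4, while u₁ v² = u² − 4 for u₂ = v².
    u1mod4 : ∀ v → u₂ ≡ v * v → u % 4 ≡ 1
    u1mod4 v ev = J-minus-one⇒1mod4 {u} ou (trans (sym J₁) (trans (J-sqc {u} ou u₁~1) (J-one u)))
      where
      cvu : Coprime v u
      cvu {e} (a , b) = cuu₂ (b , subst (e ∣_) (sym ev) (∣m⇒∣m*n v a))
      J₁ : J (+ u₁) u ≡ J -1ℤ u
      J₁ = J-square-class (+ u₁) -1ℤ v 2 {u} ou cvu (coprime-2 {u} ou) (by (+ u) (trans (lem (+ u₁ ℤ.* + (v * v))) (cong (λ z → -1ℤ ℤ.* + 4 ℤ.+ z) (trans (trans (cong (ℤ._+ + 4) (sym (ℤP.pos-* u₁ (v * v)))) (trans (sym (ℤP.pos-+ (u₁ * (v * v)) 4)) (cong +_ (trans (cong (λ z → u₁ * z + 4) (sym ev)) (sym uu≡))))) (ℤP.pos-* u u)))))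
        where lem : ∀ a → a ≡ -1ℤ ℤ.* + 4 ℤ.+ (a ℤ.+ + 4)
              lem = ℤR.solve-∀
      C≡4 : Cong u (+ C) (+ 4)
      C≡4 = nat-by {u} {C} {4} u (trans eC (ℕP.+-comm (u * u) 4))
      u₁~1 : SquareClass u u₁ 1
      u₁~1 = sqc-trans (sqc-sym (u₁x~u₁ (λ (a , b) → cuu₁ (b , a)))) (sqc-trans (sqc-cong (cong-sym (nat-by {u} {C ^ (x + d)} {u₁ ^ x} (4 * (4 * u) ^ (2 * l + k) * n ^ k) (trans eq (cong (_+_ (u₁ ^ x)) (trans (cong (λ t → (4 * u) ^ (t + k) * n ^ k) ez) (lem u ((4 * u) ^ (2 * l + k)) (n ^ k))))))))
           (sqc-trans (sqc-≡ (cong (C ^_) ez)) (sqc-trans (sqc-cong (nat-cong-^ C 4 (odd l) C≡4)) (sqc-trans (sqc-odd-pow 4 l (c4 {u} ou)) (sqc-square 2 (coprime-2 {u} ou))))))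
        where lem : ∀ u a b → 4 * u * a * b ≡ 4 * a * b * u
              lem = solve-∀

    conclusion : ∃[ a ] ∃[ b ] ∃[ w ] (V₂ d a × V₂ x b × b ≤ a × 0 < w × u₂ ≡ w ^ (2 ^ (a ∸ b)) × OddExponent₂ u C x (x + d + k) (x + d) u₁ w)
    conclusion with two-adic d 0<d
    ... | zero , j , ed = ⊥-elim (even-∤odd (suc (i + j)) l (trans (cong₂ _+_ ex (trans ed (ℕP.*-identityˡ (odd j)))) (lem i j)) ez)
      where lem : ∀ i j → suc (2 * i) + suc (2 * j) ≡ 2 * (suc (i + j))
            lem = solve-∀
    ... | suc a , j , ed with root-2^s (suc a) {u₂} {n ^ odd j} i (Odd-pos {u₂} ou₂) (trans (cong (u₂ ^_) (sym ex)) (trans (sym en) (trans (cong (n ^_) (trans ed (ℕP.*-comm (2 ^ suc a) (odd j)))) (sym (ℕP.^-*-assoc n (odd j) (2 ^ suc a))))))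
    ... | w , eu₂ , ew = suc a , 0 , w , V₂-of {d} {suc a} j ed , V₂-of {x} {0} i (trans ex (sym (ℕP.*-identityˡ (odd i)))) , z≤n , Odd-pos {w} ow , eu₂
        , χ₈-minus {w} ow χw , trans (cong (_% 2) ex) (odd-Odd i) , trans (cong (_% 2) ez) (odd-Odd l) , y-even , u1mod4 (w ^ (2 ^ a)) (trans eu₂ (pow-2* w (2 ^ a)))
        , (λ p pp p∣C → legendre-sqc (prime-pos pp) (sqc-∣ p∣C (sqc-trans u₁~n (sqc-sym (root-sqc i j ew cnC)))))
        , (λ p pp p∣u₁ → legendre-sqc (prime-pos pp) (sqc-∣ p∣u₁ (sqc-trans (root-sqc i j ew cnu₁) (sqc-sym C~n))))
      where
      ow : Odd w
      ow = Odd-root {w} (odd i) (s≤s z≤n) (subst Odd (sym ew) (Odd-^ {n} (odd j) on))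
      χw : χ₈ w ≡ -1ℤ
      χw = trans (χ₈-mod8 {w} {n} (trans (sym (odd-pow-mod8 {w} i ow)) (trans (cong (_% 8) ew) (odd-pow-mod8 {n} j on)))) χn

  module EvenZ (Z : ℕ) (ez : x + d ≡ 2 * Z) where

    d-odd : ∃ λ j → d ≡ odd j
    d-odd with halves d
    ... | j , inj₂ e = j , e
    ... | j , inj₁ e = ⊥-elim (even-∤odd Z (i + j) ez (trans (cong₂ _+_ ex e) (lem i j)))
      where lem : ∀ i j → suc (2 * i) + 2 * j ≡ suc (2 * (i + j))
            lem = solve-∀

    0<Z : 0 < Z
    0<Z = pos-*ʳ 2 (subst (0 <_) ez (ℕP.<-≤-trans 0<x (ℕP.m≤m+n x d)))

    u₁1 : u₁ % 8 ≡ 1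
    u₁1 = trans (sym u₁ˣ%8) (trans (sym mod8) (trans (cong (λ t → (C ^ t) % 8) ez) (even-pow-mod8 {C} Z oC)))

    -- All exponents are odd, so modulo 8 `n ≡ n ^ d = u₂ ^ x ≡ u₂ ≡ u₁ u₂ = C - 8 ≡ 5`.
    n5 : n % 8 ≡ 5
    n5 = trans (sym (odd-pow-mod8 {n} (proj₁ d-odd) on)) (trans (cong (λ t → (n ^ t) % 8) (sym (proj₂ d-odd))) (trans (cong (_% 8) en)
         (trans (cong (λ t → (u₂ ^ t) % 8) ex) (trans (odd-pow-mod8 {u₂} i ou₂) (trans (cong (_% 8) (sym (ℕP.*-identityˡ u₂))) (trans (mod8-cong-* {1} {u₂} {u₁} {u₂} (sym u₁1) refl) u₁u₂≡5))))))

    Jn≡-1 : J (+ n) C ≡ -1ℤ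
    Jn≡-1 = trans Jn (cong χ n5)

    -- For odd `k` the symbols of `u₁ ≡ 1` and `n ≡ 5` (mod 8) at `C` would agree, but they are 1
    -- and -1.
    k-even : ∃ λ N → k ≡ 2 * N
    k-even with halves k
    ... | N , inj₁ e = N , e
    ... | N , inj₂ e = contradiction (trans (sym Jn≡-1) (trans (sym (J-sqc {C} oC (sqc-trans u₁~nᵏ (sqc-trans (sqc-≡ (cong (n ^_) e)) (sqc-odd-pow n N cnC))))) (trans Ju₁ (cong χ u₁1)))) λ ()

    -- With `x + d` and `k` even, `P` is the square of such a number; halving both arguments takes a
    -- further root.
    D : ℕ → ℕ → ℕ
    D Y N = (4 * u) ^ Y * n ^ N

    D-double : ∀ Y N → D (2 * Y) (2 * N) ≡ D Y N * D Y N
    D-double Y N = trans (cong₂ _*_ (pow-2* (4 * u) Y) (pow-2* n N)) (lem ((4 * u) ^ Y) (n ^ N))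
      where lem : ∀ a b → a * a * (b * b) ≡ a * b * (a * b)
            lem = solve-∀

    16∣D : ∀ Y N → 2 ≤ Y → 16 ∣ D Y N
    16∣D (suc (suc Y)) N _ = subst (16 ∣_) (lem u ((4 * u) ^ Y) (n ^ N)) (m∣m*n (u * u * (4 * u) ^ Y * n ^ N))
      where lem : ∀ u a b → 16 * (u * u * a * b) ≡ 4 * u * (4 * u * a) * b
            lem = solve-∀
    16∣D (suc zero) N (s≤s ())

    8∣D : ∀ Y N → 2 ≤ Y → 8 ∣ D Y N
    8∣D Y N h = ∣-trans (divides 2 refl) (16∣D Y N h)

    record Split (V A D : ℕ) : Set where
      field
        t₁ t₂ : ℕ
        prod  : t₁ * t₂ ≡ V
        cop   : Coprime t₁ t₂
        low   : t₁ ^ x + D ≡ A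
        high  : t₂ ^ x ≡ A + D
        mod₁  : t₁ % 8 ≡ A % 8
        mod₂  : t₂ % 8 ≡ A % 8

    -- `A - D` and `A + D` are coprime because `V` is odd and prime to `A`, so each is an x-th
    -- power. For odd `x` and `8 ∣ D` their bases are congruent to `A` modulo 8.
    split : ∀ {V A D} → V ∣ u₁ → Coprime V A → Odd A → 8 ∣ D → V ^ x + D * D ≡ A * A → Split V A D
    split {V} {A} {D} V∣u₁ cVA oA 8∣D e = finish (coprime-power-split {A ∸ D} {A + D} {V} {x} 0<x (Odd-pos {V} oV) cop prod)
      where
      oV : Odd V
      oV = Odd-∣ V∣u₁ ou₁
      D≤A : D ≤ A
      D≤A = ℕP.≮⇒≥ λ A<D → ℕP.<⇒≱ (ℕP.*-mono-< A<D A<D) (subst (D * D ≤_) e (ℕP.m≤n+m (D * D) (V ^ x)))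
      low : A ∸ D + D ≡ A
      low = ℕP.m∸n+n≡m D≤A
      prod : (A ∸ D) * (A + D) ≡ V ^ x
      prod = ℕP.+-cancelʳ-≡ (D * D) _ _ (trans (cong (λ z → (A ∸ D) * (z + D) + D * D) (sym low)) (trans (lem (A ∸ D) D) (trans (cong (λ z → z * z) low) (sym e))))
        where lem : ∀ a d → a * (a + d + d) + d * d ≡ (a + d) * (a + d)
              lem = solve-∀
      cop : Coprime (A ∸ D) (A + D)
      cop {f} (p , q) = coprime-^ˡ {V} {2 * A} x (coprime-*ʳ {V} {2} {A} (λ (a , b) → coprime-2 {V} oV (b , a)) cVA) (subst (f ∣_) prod (∣m⇒∣m*n (A + D) p)
          , subst (f ∣_) (trans (lem (A ∸ D) A D) (trans (cong (_+ A) low) (cong (_+_ A) (sym (ℕP.+-identityʳ A))))) (∣m∣n⇒∣m+n p q))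
        where lem : ∀ a A D → a + (A + D) ≡ a + D + A
              lem = solve-∀
      finish : (∃ λ a → ∃ λ b → A ∸ D ≡ a ^ x × A + D ≡ b ^ x × a * b ≡ V) → Split V A D
      finish (a , b , ea , eb , eab) = record { t₁ = a ; t₂ = b ; prod = eab
         ; cop = λ {f} (p , q) → cop (subst (f ∣_) (sym ea) (∣-trans p (∣-x a)) , subst (f ∣_) (sym eb) (∣-trans q (∣-x b)))
         ; low = low' ; high = sym eb
         ; mod₁ = trans (sym (x-mod8 a (Odd-*ˡ {a} {b} (subst Odd (sym eab) oV)))) (trans (sym (%-remove-+ʳ (a ^ x) 8∣D)) (cong (_% 8) low'))
         ; mod₂ = trans (sym (x-mod8 b (Odd-*ʳ {a} {b} (subst Odd (sym eab) oV)))) (trans (cong (_% 8) (sym eb)) (%-remove-+ʳ A 8∣D)) }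
        where
        low' : a ^ x + D ≡ A
        low' = trans (cong (_+ D) (sym ea)) low
        ∣-x : ∀ t → t ∣ t ^ x
        ∣-x t = subst (λ y → t ∣ t ^ y) (sym ex) (m∣m*n (t ^ (2 * i)))
        x-mod8 : ∀ t → Odd t → (t ^ x) % 8 ≡ t % 8
        x-mod8 t ot = trans (cong (λ y → (t ^ y) % 8) ex) (odd-pow-mod8 {t} i ot)

    -- (t₂/C) = (D/C) = (n/C)^N
    high-class : ∀ {t A D} Z Y N → 0 < Z → A ≡ C ^ Z → D ≡ (4 * u) ^ Y * n ^ N → t ∣ u₁ → t ^ x ≡ A + D → SquareClass C t (n ^ N)
    high-class {t} {A} {D'} (suc Z) Y N _ eA eD t∣u₁ e = sqc-trans (sqc-sym (sqc-trans (sqc-≡ (cong (t ^_) ex)) (sqc-odd-pow t i (coprime-∣ˡ {u₁} {t} {C} (λ (a , b) → cCu₁ (b , a)) t∣u₁))))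
       (sqc-trans (sqc-cong (nat-by {C} {t ^ x} {D'} (C ^ Z) (trans e (trans (ℕP.+-comm A D') (cong (_+_ D') (trans eA (ℕP.*-comm C (C ^ Z)))))))) (sqc-trans (sqc-≡ eD) (sqc-1-times (sqc-4u^ Y))))

    J-even : ∀ {t} N' → SquareClass C t (n ^ (2 * N')) → J (+ t) C ≡ 1ℤ
    J-even N' e = trans (J-sqc {C} oC (sqc-trans e (sqc-even-pow n N' cnC))) (J-one C)

    J-odd : ∀ {t} N' → SquareClass C t (n ^ odd N') → J (+ t) C ≡ -1ℤ
    J-odd N' e = trans (J-sqc {C} oC (sqc-trans e (sqc-odd-pow n N' cnC))) Jn≡-1

    cVC : ∀ {V} Z → V ∣ u₁ → Coprime V (C ^ Z)
    cVC {V} Z V∣ = coprime-^ʳ {V} {C} Z (coprime-∣ˡ {u₁} {V} {C} (λ (a , b) → cCu₁ (b , a)) V∣)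

    oCZ : ∀ Z → Odd (C ^ Z)
    oCZ Z = Odd-^ {C} Z oC

    -- The case `4 ∣ z`, where initially `z = 4 Z`. After splitting, `t₂ ≡ 1` modulo 8 forces `N`
    -- even, so `D` is itself a square. For even `Z` the smaller base `t₁` satisfies the equation
    -- again with `Z` halved; for odd `Z` the larger base `t₂` meets `quartic-obstruction`.
    descent : ∀ Z N V → 0 < Z → 0 < N → V ∣ u₁ → V ^ x + D (2 * Z + N) N * D (2 * Z + N) N ≡ C ^ (2 * Z) * C ^ (2 * Z) → ⊥
    descent = <-rec _ go
      where
      go : ∀ Z → (∀ {Z'} → Z' < Z → ∀ N V → 0 < Z' → 0 < N → V ∣ u₁ → V ^ x + D (2 * Z' + N) N * D (2 * Z' + N) N ≡ C ^ (2 * Z') * C ^ (2 * Z') → ⊥) →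
           ∀ N V → 0 < Z → 0 < N → V ∣ u₁ → V ^ x + D (2 * Z + N) N * D (2 * Z + N) N ≡ C ^ (2 * Z) * C ^ (2 * Z) → ⊥
      go Z rec N V 0<Z 0<N V∣ e = step (split {V} {C ^ (2 * Z)} {D (2 * Z + N) N} V∣ (cVC (2 * Z) V∣) (oCZ (2 * Z)) (8∣D (2 * Z + N) N (ℕP.≤-trans (ℕP.*-monoʳ-≤ 2 0<Z) (ℕP.m≤m+n (2 * Z) N))) e) (halves N)
        where
        step : Split V (C ^ (2 * Z)) (D (2 * Z + N) N) → (∃ λ N' → N ≡ 2 * N' ⊎ N ≡ odd N') → ⊥
        step s (N' , h) = byN h
          where
          open Split s
          t₁∣ : t₁ ∣ u₁
          t₁∣ = ∣-trans (divides t₂ (trans (sym prod) (ℕP.*-comm t₁ t₂))) V∣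
          t₂∣ : t₂ ∣ u₁
          t₂∣ = ∣-trans (divides t₁ (sym prod)) V∣
          cls : SquareClass C t₂ (n ^ N)
          cls = high-class (2 * Z) (2 * Z + N) N (*-pos {2} (s≤s z≤n) 0<Z) refl refl t₂∣ high
          Jt : J (+ t₂) C ≡ 1ℤ
          Jt = trans (proj₂ (J-∣u₁ t₂∣)) (cong χ (trans mod₂ (even-pow-mod8 {C} Z oC)))
          byN : N ≡ 2 * N' ⊎ N ≡ odd N' → ⊥
          byN (inj₂ eN) = contradiction (trans (sym Jt) (J-odd N' (subst (λ m → SquareClass C t₂ (n ^ m)) eN cls))) λ ()
          byN (inj₁ eN) = byZ (halves Z)
            where
            0<N' : 0 < N'
            0<N' = pos-*ʳ 2 (subst (0 <_) eN 0<N)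
            D₁ = D (Z + N') N'
            eD : D (2 * Z + N) N ≡ D₁ * D₁
            eD = trans (cong (λ m → D (2 * Z + m) m) eN) (trans (cong (λ m → D m (2 * N')) (sym (ℕP.*-distribˡ-+ 2 Z N'))) (D-double (Z + N') N'))
            byZ : (∃ λ Z' → Z ≡ 2 * Z' ⊎ Z ≡ odd Z') → ⊥
            byZ (Z' , inj₁ eZ) = rec {Z'} (subst (Z' <_) (sym eZ) (ℕP.m<m+n Z' (ℕP.≤-trans 0<Z' (ℕP.m≤m+n Z' 0)))) N' t₁ 0<Z' 0<N' t₁∣
                (subst (λ z → t₁ ^ x + D (z + N') N' * D (z + N') N' ≡ C ^ z * C ^ z) eZ (trans (cong (_+_ (t₁ ^ x)) (sym eD)) (trans low (pow-2* C Z))))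
              where 0<Z' : 0 < Z'
                    0<Z' = pos-*ʳ 2 (subst (0 <_) eZ 0<Z)
            byZ (Z' , inj₂ eZ) = quartic-obstruction {C} {t₂} {D₁} i Z' (quotient t₂∣ * u₂) C5 C4 eC₈
                (subst₂ (λ X z → t₂ ^ X ≡ C ^ z * C ^ z + D₁ * D₁) ex eZ (trans high (cong₂ _+_ (pow-2* C Z) eD))) cCD (8∣D (Z + N') N' (ℕP.+-mono-≤ 0<Z 0<N'))
              where
              eC₈ : C ≡ 8 + t₂ * (quotient t₂∣ * u₂)
              eC₈ = trans eu (trans (ℕP.+-comm (u₁ * u₂) 8) (cong (_+_ 8) (trans (cong (_* u₂) (m∣n⇒n≡m*quotient t₂∣)) (ℕP.*-assoc t₂ _ u₂))))
              cCD : Coprime C D₁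
              cCD = coprime-*ʳ {C} {(4 * u) ^ (Z + N')} {n ^ N'} (coprime-^ʳ {C} {4 * u} (Z + N') (λ (a , b) → coprime-*ˡ {4} {u} {C} (c4 {C} oC) cuC (b , a))) (coprime-^ʳ {C} {n} N' (λ (a , b) → cnC (b , a)))

    0<N : 0 < proj₁ k-even
    0<N = pos-*ʳ 2 (subst (0 <_) (proj₂ k-even) 0<k)

    y≡ : x + d + k ≡ 2 * (Z + proj₁ k-even)
    y≡ = trans (cong₂ _+_ ez (proj₂ k-even)) (sym (ℕP.*-distribˡ-+ 2 Z (proj₁ k-even)))

    P≡ : P ≡ D (Z + proj₁ k-even) (proj₁ k-even) * D (Z + proj₁ k-even) (proj₁ k-even)
    P≡ = trans (cong₂ (λ a b → (4 * u) ^ a * n ^ b) y≡ (proj₂ k-even)) (D-double (Z + proj₁ k-even) (proj₁ k-even))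

    base : ∀ {Z'} → Z ≡ Z' → u₁ ^ x + D (Z' + proj₁ k-even) (proj₁ k-even) * D (Z' + proj₁ k-even) (proj₁ k-even) ≡ C ^ Z' * C ^ Z'
    base refl = trans (cong (_+_ (u₁ ^ x)) (sym P≡)) (trans (sym eq) (trans (cong (C ^_) ez) (pow-2* C Z)))

    Z-odd : ∃ λ l → Z ≡ odd l
    Z-odd with halves Z
    ... | l , inj₂ e = l , e
    ... | l , inj₁ e = ⊥-elim (descent l (proj₁ k-even) u₁ (pos-*ʳ 2 (subst (0 <_) e 0<Z)) 0<N ∣-refl (base e))

    N = proj₁ k-even
    l = proj₁ Z-odd

    2≤Z+N : 2 ≤ Z + N
    2≤Z+N = ℕP.+-mono-≤ 0<Z 0<N

    top : Split u₁ (C ^ Z) (D (Z + N) N)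
    top = split {u₁} {C ^ Z} {D (Z + N) N} ∣-refl (cVC Z ∣-refl) (oCZ Z) (8∣D (Z + N) N 2≤Z+N) (base refl)

    open Split top public

    C^Z5 : (C ^ Z) % 8 ≡ 5
    C^Z5 = trans (cong (λ z → (C ^ z) % 8) (proj₂ Z-odd)) (trans (odd-pow-mod8 {C} l oC) C5)

    -- Here `t₂ ≡ C ^ Z ≡ 5` modulo 8, hence `(t₂/C) = -1`, whereas `t₂` has the class of `n ^ N`.
    N-odd : ∃ λ N' → N ≡ odd N'
    N-odd with halves N
    ... | N' , inj₂ e = N' , e
    ... | N' , inj₁ e = contradiction (trans (sym (trans (proj₂ (J-∣u₁ t₂∣)) (cong χ (trans mod₂ C^Z5)))) (J-even N' (subst (λ m → SquareClass C t₂ (n ^ m)) e cls))) λ ()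
      where
      t₂∣ : t₂ ∣ u₁
      t₂∣ = divides t₁ (sym prod)
      cls : SquareClass C t₂ (n ^ N)
      cls = high-class Z (Z + N) N 0<Z refl refl t₂∣ high

    y-val : ∃[ t ] (2 ≤ t × V₂ (x + d + k) t)
    y-val with two-adic (suc (l + proj₁ N-odd)) (s≤s z≤n)
    ... | b , j , e = 2 + b , s≤s (s≤s z≤n) , V₂-of {x + d + k} {2 + b} j (trans y≡ (trans (cong (2 *_) (trans (cong₂ _+_ (proj₂ Z-odd) (proj₂ N-odd)) (lem l (proj₁ N-odd)))) (trans (cong (λ z → 2 * (2 * z)) e) (lem2 (2 ^ b) (odd j)))))
      where
      lem : ∀ l k → suc (2 * l) + suc (2 * k) ≡ 2 * (suc (l + k))
      lem = solve-∀
      lem2 : ∀ a b → 2 * (2 * (a * b)) ≡ 2 * (2 * a) * b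
      lem2 = solve-∀

    %8-split : ∀ a → a % 8 ≡ 1 → ∃ λ q → a ≡ 1 + q * 8
    %8-split a e = a / 8 , trans (m≡m%n+[m/n]*n a 8) (cong (_+ (a / 8) * 8) e)

    -- If 16 divided `u₁ - 1`, then `u₁ ^ x + P ≡ 1` modulo 16, while `C ^ z` is the square of a
    -- number that is 5 or 13 modulo 16, hence 9.
    u₁-val : V₂ (u₁ ∸ 1) 3
    u₁-val with %8-split u₁ u₁1
    ... | q , e with halves q
    ... | m , inj₂ eq' = V₂-of {u₁ ∸ 1} {3} m (trans (cong (_∸ 1) e) (trans (cong (_* 8) eq') (ℕP.*-comm (odd m) 8)))
    ... | m , inj₁ eq' = contradiction (trans (sym u16) (trans (cong (_% 16) (sym (ℕP.+-identityʳ (u₁ ^ x)))) (trans (sym (%-remove-+ʳ (u₁ ^ x + 0) 16∣P)) (trans (cong (_% 16) (trans (cong (_+ P) (ℕP.+-identityʳ _)) (trans (sym eq) (trans (cong (C ^_) ez) (pow-2* C Z))))) A16)))) λ ()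
      where
      16∣P : 16 ∣ P
      16∣P = subst (16 ∣_) (sym P≡) (∣m⇒∣m*n (D (Z + N) N) (16∣D (Z + N) N 2≤Z+N))
      u₁16 : u₁ % 16 ≡ 1
      u₁16 = trans (cong (_% 16) (trans e (trans (cong (λ z → 1 + z * 8) eq') (cong (_+_ 1) (trans (cong (_* 8) (ℕP.*-comm 2 m)) (ℕP.*-assoc m 2 8)))))) (%-remove-+ʳ 1 {m * 16} {16} (n∣m*n m))
      pow1 : ∀ j → (u₁ ^ j) % 16 ≡ 1
      pow1 zero = refl
      pow1 (suc j) = trans (%-distribˡ-* u₁ (u₁ ^ j) 16) (cong₂ (λ a b → (a * b) % 16) u₁16 (pow1 j))
      u16 : (u₁ ^ x) % 16 ≡ 1
      u16 = pow1 x
      A16 : (C ^ Z * C ^ Z) % 16 ≡ 9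
      A16 = trans (%-distribˡ-* (C ^ Z) (C ^ Z) 16) (res16 (C ^ Z % 16) (m%n<n (C ^ Z) 16) (trans (m∣n⇒o%n%m≡o%m 8 16 (C ^ Z) (divides 2 refl)) C^Z5))
        where
        res16 : ∀ r → r < 16 → r % 8 ≡ 5 → (r * r) % 16 ≡ 9
        res16 5 _ _ = refl
        res16 13 _ _ = refl
        res16 0 _ ()
        res16 1 _ ()
        res16 2 _ ()
        res16 3 _ ()
        res16 4 _ ()
        res16 6 _ ()
        res16 7 _ ()
        res16 8 _ ()
        res16 9 _ ()
        res16 10 _ ()
        res16 11 _ ()
        res16 12 _ ()
        res16 14 _ ()
        res16 15 _ ()
        res16 (suc (suc (suc (suc (suc (suc (suc (suc (suc (suc (suc (suc (suc (suc (suc (suc r)))))))))))))))) lt _ = contradiction lt (ℕP.m+n≮m 16 r)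

    five⇒>1 : ∀ t → t % 8 ≡ 5 → 1 < t
    five⇒>1 zero ()
    five⇒>1 (suc zero) ()
    five⇒>1 (suc (suc t)) _ = s≤s (s≤s z≤n)

    half : ∀ m → (2 * m) / 2 ≡ m
    half m = trans (cong (_/ 2) (ℕP.*-comm 2 m)) (m*n/n≡m m 2)

    D≡ : 2 ^ (x + d + k + 1) * u ^ ((x + d + k) / 2) * n ^ (k / 2) ≡ 2 * D (Z + N) N
    D≡ = trans (cong₂ (λ a b → 2 ^ (a + 1) * u ^ (a / 2) * n ^ (b / 2)) y≡ (proj₂ k-even)) (trans (cong₂ (λ a b → 2 ^ (2 * (Z + N) + 1) * u ^ a * n ^ b) (half (Z + N)) (half N))
         (trans (cong (λ t → t * u ^ (Z + N) * n ^ N) (trans (cong (2 ^_) (ℕP.+-comm (2 * (Z + N)) 1)) (cong (2 *_) (sym (ℕP.^-*-assoc 2 2 (Z + N))))))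
         (trans (lem (4 ^ (Z + N)) (u ^ (Z + N)) (n ^ N)) (cong (λ t → 2 * (t * n ^ N)) (sym (pow-* 4 u (Z + N)))))))
      where lem : ∀ a b c → 2 * a * b * c ≡ 2 * (a * b * c)
            lem = solve-∀

    conclusion : V₂ (u₁ ∸ 1) 3 × x % 2 ≡ 1 × (∃[ t ] (2 ≤ t × V₂ (x + d + k) t)) × V₂ (x + d) 1
      × (∃[ t₁ ] ∃[ t₂ ] (1 < t₁ × 1 < t₂ × Coprime t₁ t₂ × t₁ * t₂ ≡ u₁ × t₁ % 8 ≡ 5 × t₂ % 8 ≡ 5
          × t₂ ^ x + t₁ ^ x ≡ 2 * C ^ ((x + d) / 2)
          × t₂ ^ x ∸ t₁ ^ x ≡ 2 ^ (x + d + k + 1) * u ^ ((x + d + k) / 2) * n ^ (k / 2)))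
    conclusion = u₁-val , trans (cong (_% 2) ex) (odd-Odd i) , y-val , V₂-of {x + d} {1} l (trans ez (cong (2 *_) (proj₂ Z-odd)))
      , t₁ , t₂ , five⇒>1 t₁ (trans mod₁ C^Z5) , five⇒>1 t₂ (trans mod₂ C^Z5) , cop , prod , trans mod₁ C^Z5 , trans mod₂ C^Z5 , sum , difference
      where
      sum : t₂ ^ x + t₁ ^ x ≡ 2 * C ^ ((x + d) / 2)
      sum = trans (cong (_+ t₁ ^ x) high) (trans (ℕP.+-assoc (C ^ Z) (D (Z + N) N) (t₁ ^ x)) (trans (cong (_+_ (C ^ Z)) (trans (ℕP.+-comm (D (Z + N) N) (t₁ ^ x)) low)) (trans (cong (_+_ (C ^ Z)) (sym (ℕP.+-identityʳ (C ^ Z)))) (cong (λ z → 2 * C ^ z) (sym (trans (cong (_/ 2) ez) (half Z)))))))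
      difference : t₂ ^ x ∸ t₁ ^ x ≡ 2 ^ (x + d + k + 1) * u ^ ((x + d + k) / 2) * n ^ (k / 2)
      difference = trans (cong (_∸ t₁ ^ x) (trans high (trans (cong (_+ D (Z + N) N) (sym low)) (lem (t₁ ^ x) (D (Z + N) N))))) (trans (ℕP.m+n∸n≡m (2 * D (Z + N) N) (t₁ ^ x)) (sym D≡))
        where lem : ∀ t d → t + d + d ≡ 2 * d + t
              lem = solve-∀

-- Even x

prime->1 : ∀ {p} → Prime p → 1 < p
prime->1 {p} pp = nonTrivial⇒n>1 p {{prime⇒nonTrivial pp}}

odd-difference : ∀ {X U} → Odd X → Odd U → U ≤ X → ∃ λ a → X ≡ U + 2 * a
odd-difference {X} {U} oX oU le with halves (X ∸ U)
... | a , inj₁ e = a , trans (sym (ℕP.m+[n∸m]≡n le)) (cong (_+_ U) e)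
... | a , inj₂ e = ⊥-elim (even-∤odd (suc (U / 2 + a)) (X / 2) (trans (sym (ℕP.m+[n∸m]≡n le)) (trans (cong₂ _+_ (odd-half {U} oU) e) (lem (U / 2) a))) (odd-half {X} oX))
  where lem : ∀ i j → suc (2 * i) + suc (2 * j) ≡ 2 * suc (i + j)
        lem = solve-∀

-- The symbol of 2 does not change under `r ↦ -r` modulo 8.
χ₈-opposite : ∀ {a b} → Odd a → Odd b → 8 ∣ a + b → χ₈ a ≡ χ₈ b
χ₈-opposite {a} {b} oa ob d = go (a % 8) (b % 8) (odd-res {a} oa) (odd-res {b} ob) (trans (sym (%-distribˡ-+ a b 8)) (n∣m⇒m%n≡0 (a + b) 8 d))
  where
  go : ∀ r s → OddRes r → OddRes s → (r + s) % 8 ≡ 0 → χ r ≡ χ s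
  go _ _ r1 r7 _ = refl
  go _ _ r7 r1 _ = refl
  go _ _ r3 r5 _ = refl
  go _ _ r5 r3 _ = refl
  go _ _ r1 r1 ()
  go _ _ r1 r3 ()
  go _ _ r1 r5 ()
  go _ _ r3 r1 ()
  go _ _ r3 r3 ()
  go _ _ r3 r7 ()
  go _ _ r5 r1 ()
  go _ _ r5 r5 ()
  go _ _ r5 r7 ()
  go _ _ r7 r3 ()
  go _ _ r7 r5 ()
  go _ _ r7 r7 ()

coprime-odd : ∀ {a b} → Coprime a b → Odd a ⊎ Odd b
coprime-odd {a} {b} c with halves a | halves b
... | i , inj₂ refl | _ = inj₁ (odd-Odd i)
... | _ , inj₁ _ | j , inj₂ refl = inj₂ (odd-Odd j)
... | i , inj₁ refl | j , inj₁ refl = contradiction (c {2} (m∣m*n i , m∣m*n j)) λ ()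

coprime-square-factor : ∀ {a b r} → 0 < r → Coprime a b → a * b ≡ r * r → ∃ λ s → a ≡ s * s
coprime-square-factor {a} {b} {r} 0<r c e with coprime-power-split {a} {b} {r} {2} (s≤s z≤n) 0<r c (trans e (cong (r *_) (sym (ℕP.*-identityʳ r))))
... | s , _ , ea , _ , _ = s , trans ea (cong (s *_) (ℕP.*-identityʳ s))

EvenExponent₂ : (u C x y z u₁ w : ℕ) → Set
EvenExponent₂ u C x y z u₁ w = (w % 8 ≡ 1 ⊎ w % 8 ≡ 7) × (∃[ β ] (1 ≤ β × V₂ x β × V₂ z β)) × y % 2 ≡ 1 × (u % 8 ≡ 3 ⊎ u % 8 ≡ 5)
  × (∀ p → Prime p → p ∣ C → legendre w p ≡ 1ℤ)
  × (∀ p → Prime p → p ∣ u₁ → legendre w p ≡ legendre u p)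
  × (u % 8 ≡ 3 → ¬ (∃[ k ] (w ≡ k * k)))

module EvenExponent {u C u₁ u₂ n x d k : ℕ} (S : Exceptional u C u₁ u₂ n x d k) (p q : ℕ) (ex : x ≡ 2 * p) (ez : x + d ≡ 2 * q) where
  open Exceptional S
  open Facts S

  P : ℕ
  P = (4 * u) ^ (x + d + k) * n ^ k

  J-pow-u₁ : ∀ j → J (+ (u₁ ^ j)) C ≡ χ₈ (u₁ ^ j)
  J-pow-u₁ zero = J-one C
  J-pow-u₁ (suc j) = trans (J-nat-* u₁ (u₁ ^ j) C) (trans (cong₂ ℤ._*_ (proj₂ (J-∣u₁ ∣-refl)) (J-pow-u₁ j)) (sym (χ₈-* {u₁} {u₁ ^ j} ou₁ (Odd-^ {u₁} j ou₁))))

  -- C ^ (j + 1) and u₁ ^ i differ by twice a, so a and b = u₁ ^ i + a are opposite modulo C.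
  record Opposite (j i a b : ℕ) : Set where
    field
      sum  : C ^ suc j ≡ u₁ ^ i + 2 * a
      b≡   : b ≡ u₁ ^ i + a

    a+b : a + b ≡ C ^ suc j
    a+b = trans (cong (_+_ a) b≡) (trans (lem a (u₁ ^ i)) (sym sum))
      where lem : ∀ a v → a + (v + a) ≡ v + 2 * a
            lem = solve-∀

    coprime-ab : Coprime (a * b) C → Coprime a b
    coprime-ab c {f} (f∣a , f∣b) = coprime-^ʳ {a * b} {C} (suc j) c (∣m⇒∣m*n b f∣a , subst (f ∣_) a+b (∣m∣n⇒∣m+n f∣a f∣b))

    a~b : SquareClass C a b
    a~b = sqc-neg {u} (C ^ j) eC ou (trans a+b (ℕP.*-comm C (C ^ j)))

    U~2a : SquareClass C (u₁ ^ i) (2 * a)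
    U~2a = sqc-neg {u} (C ^ j) eC ou (trans (sym sum) (ℕP.*-comm C (C ^ j)))

    χ-odd-b : 8 ∣ a → χ₈ (u₁ ^ i) ≡ χ₈ b
    χ-odd-b 8∣a = χ₈-mod8 {u₁ ^ i} {b} (trans (sym (%-remove-+ʳ (u₁ ^ i) 8∣a)) (cong (_% 8) (sym b≡)))

    χ-odd-a : Odd a → 8 ∣ b → χ₈ (u₁ ^ i) ≡ χ₈ a
    χ-odd-a oa 8∣b = χ₈-opposite {u₁ ^ i} {a} (Odd-^ {u₁} i ou₁) oa (subst (8 ∣_) b≡ 8∣b)

    -- o is whichever of a, b is odd
    χ-opposite : ∀ {o} → (o ≡ a × Odd a × 8 ∣ b) ⊎ (o ≡ b × 8 ∣ a) → χ₈ (u₁ ^ i) ≡ χ₈ o × χ₈ (u₁ ^ i) ≡ -1ℤ ℤ.* J (+ o) C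
    -- Modulo 8 the power of `u₁` is `o` or `-o`, according to which of the two is odd. Modulo `C`
    -- it has the class of `2 o`, and `(2/C) = -1`.
    χ-opposite (inj₁ (refl , oa , 8∣b)) = χ-odd-a oa 8∣b , trans (sym (J-pow-u₁ i)) (trans (J-sqc {C} oC U~2a) (trans (J-nat-* 2 a C) (cong (ℤ._* J (+ a) C) J-two-C)))
    χ-opposite (inj₂ (refl , 8∣a)) = χ-odd-b 8∣a , trans (sym (J-pow-u₁ i)) (trans (J-sqc {C} oC (sqc-trans U~2a (sqc-* (sqc-refl {C} {2}) a~b))) (trans (J-nat-* 2 b C) (cong (ℤ._* J (+ b) C) J-two-C)))

  0<p : 0 < p
  0<p = pos-*ʳ 2 (subst (0 <_) ex 0<x)

  p<q : p < q
  p<q = ℕP.*-cancelˡ-< 2 p q (subst₂ _<_ ex ez (ℕP.m<m+n x 0<d))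

  y' : ℕ
  y' = pred (x + d + k)

  y≡ : x + d + k ≡ suc y'
  y≡ = sym (ℕP.suc-pred (x + d + k) {{>-nonZero (ℕP.<-≤-trans 0<k (ℕP.m≤n+m k (x + d)))}})

  z≤y' : x + d ≤ y'
  z≤y' = ℕP.≤-pred (subst (suc (x + d) ≤_) y≡ (ℕP.m<m+n (x + d) 0<k))

  4≤y' : 4 ≤ y'
  4≤y' = ℕP.≤-trans (subst (4 ≤_) (sym ez) (ℕP.*-monoʳ-≤ 2 {2} {q} (ℕP.≤-trans (s≤s 0<p) p<q))) z≤y'

  1<C : 1 < C
  1<C = subst (1 <_) (sym eC) (ℕP.≤-trans (s≤s (s≤s z≤n)) (ℕP.m≤n+m 4 (u * u)))

  -- C ^ z < (4u) ^ 2y', so one factor cannot carry both 4 ^ y' and u ^ y.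
  too-big : ∀ {a} → a ≤ C ^ q → 0 < a → ¬ (4 ^ y' * u ^ suc y' ∣ a)
  too-big {a} a≤X 0<a dv = ℕP.<⇒≱ (ℕP.<-≤-trans X<W W≤) (ℕP.≤-trans (∣⇒≤ {{>-nonZero 0<a}} dv) a≤X)
    where
    X = C ^ q
    W = (4 * u) ^ y'
    0<u : 0 < u
    0<u = Odd-pos {u} ou
    W≤ : W ≤ 4 ^ y' * u ^ suc y'
    W≤ = subst (_≤ 4 ^ y' * u ^ suc y') (sym (pow-* 4 u y')) (ℕP.*-monoʳ-≤ (4 ^ y') (ℕP.m≤n*m (u ^ y') u {{>-nonZero 0<u}}))
    C<16uu : C < 4 * u * (4 * u)
    C<16uu = subst₂ _<_ (sym eC) (lem u) (ℕP.+-monoʳ-< (u * u) (ℕP.<-≤-trans (ℕP.m<m+n 4 {11} (s≤s z≤n)) (ℕP.m≤m*n 15 (u * u) {{>-nonZero (*-pos 0<u 0<u)}})))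
      where lem : ∀ u → u * u + 15 * (u * u) ≡ 4 * u * (4 * u)
            lem = solve-∀
    XX<WW : X * X < W * W
    XX<WW = ℕP.≤-<-trans (subst (_≤ C ^ y') (trans (cong (C ^_) ez) (pow-2* C q)) (ℕP.^-monoʳ-≤ C {{>-nonZero (ℕP.<-trans (s≤s z≤n) 1<C)}} z≤y'))
       (subst (C ^ y' <_) (pow-* (4 * u) (4 * u) y') (ℕP.^-monoˡ-< y' {{>-nonZero (ℕP.≤-trans (s≤s z≤n) 4≤y')}} C<16uu))
    X<W : X < W
    X<W = ℕP.≰⇒> λ W≤X → ℕP.<⇒≱ XX<WW (ℕP.*-mono-≤ W≤X W≤X)

  -- `a` and `b` are half of `C ^ q - u₁ ^ p` and half of `C ^ q + u₁ ^ p`, with product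
  -- `4 ^ y' * u ^ suc y' * n ^ k`. They are not interchangeable, so `MV` records which of them is
  -- even.
  record Factors : Set where
    field
      n₁ n₂ a b : ℕ
      n₁n₂ : n₁ * n₂ ≡ n
      cop  : Coprime n₁ n₂
      opp  : Opposite (pred q) p a b
      MV   : (a ≡ 4 ^ y' * n₁ ^ k × b ≡ u ^ suc y' * n₂ ^ k) ⊎ (b ≡ 4 ^ y' * n₁ ^ k × a ≡ u ^ suc y' * n₂ ^ k)

  q≡ : suc (pred q) ≡ q
  q≡ = ℕP.suc-pred q {{>-nonZero (ℕP.≤-<-trans z≤n p<q)}}

  base-^∣ : ∀ t → t ∣ t ^ k
  base-^∣ t = go k 0<k
    where go : ∀ k → 0 < k → t ∣ t ^ k
          go (suc k) _ = m∣m*n (t ^ k)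

  even-part : ∀ {a b} e → Coprime a b → a * b ≡ 4 ^ y' * u ^ suc y' * n ^ k → e ∣ 4 ^ y' * u ^ suc y' * n ^ k → Coprime e b → e ∣ a
  even-part {a} {b} e c ab e∣ ceb = coprime-divisorʳ {e} {b} {a} ceb (subst (e ∣_) (sym ab) e∣)

  4∣ : 4 ^ y' ∣ 4 ^ y' * u ^ suc y' * n ^ k
  4∣ = ∣m⇒∣m*n (n ^ k) (m∣m*n (u ^ suc y'))

  u∣ : u ^ suc y' ∣ 4 ^ y' * u ^ suc y' * n ^ k
  u∣ = ∣m⇒∣m*n (n ^ k) (n∣m*n (4 ^ y'))

  c4u : Coprime (4 ^ y') (u ^ suc y')
  c4u = coprime-^ˡ {4} {u ^ suc y'} y' (coprime-^ʳ {4} {u} (suc y') (c4 {u} ou))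

  Ordered : ℕ → ℕ → Set
  Ordered a b = ∃ λ n₁ → ∃ λ n₂ → a ≡ 4 ^ y' * n₁ ^ k × b ≡ u ^ suc y' * n₂ ^ k × n₁ * n₂ ≡ n × Coprime n₁ n₂

  ordered : ∀ {a b} → Coprime a b → a * b ≡ 4 ^ y' * u ^ suc y' * n ^ k → 4 ^ y' ∣ a → u ^ suc y' ∣ b →
    Ordered a b
  ordered {a} {b} c ab (divides m em) (divides v ev) = finish (coprime-power-split {m} {v} {n} {k} 0<k 0<n cmv mv)
    where
    cmv : Coprime m v
    cmv {f} (p , q) = c (subst (f ∣_) (sym em) (∣m⇒∣m*n (4 ^ y') p) , subst (f ∣_) (sym ev) (∣m⇒∣m*n (u ^ suc y') q))
    mv : m * v ≡ n ^ k
    mv = cancelˡ {4 ^ y' * u ^ suc y'} (*-pos (pow-pos {4} y' (s≤s z≤n)) (pow-pos {u} (suc y') (Odd-pos {u} ou))) (trans (lem (4 ^ y') (u ^ suc y') m v) (trans (cong₂ _*_ (sym em) (sym ev)) ab))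
      where lem : ∀ a b m v → a * b * (m * v) ≡ m * a * (v * b)
            lem = solve-∀
    finish : (∃ λ n₁ → ∃ λ n₂ → m ≡ n₁ ^ k × v ≡ n₂ ^ k × n₁ * n₂ ≡ n) → Ordered a b
    finish (n₁ , n₂ , e₁ , e₂ , e) = n₁ , n₂ , trans em (trans (ℕP.*-comm m (4 ^ y')) (cong (4 ^ y' *_) e₁)) , trans ev (trans (ℕP.*-comm v (u ^ suc y')) (cong (u ^ suc y' *_) e₂)) , e
       , λ {f} (p , q) → cmv (subst (f ∣_) (sym e₁) (∣-trans p (base-^∣ n₁)) , subst (f ∣_) (sym e₂) (∣-trans q (base-^∣ n₂)))

  factors : Factors
  factors = start (odd-difference {C ^ q} {u₁ ^ p} (Odd-^ {C} q oC) (Odd-^ {u₁} p ou₁) U≤X)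
    where
    XX : C ^ q * C ^ q ≡ u₁ ^ p * u₁ ^ p + P
    XX = trans (sym (pow-2* C q)) (trans (cong (C ^_) (sym ez)) (trans eq (cong (_+ P) (trans (cong (u₁ ^_) ex) (pow-2* u₁ p)))))
    U≤X : u₁ ^ p ≤ C ^ q
    U≤X = ℕP.≮⇒≥ λ X<U → ℕP.<⇒≱ (ℕP.*-mono-< X<U X<U) (subst (u₁ ^ p * u₁ ^ p ≤_) (sym XX) (ℕP.m≤m+n (u₁ ^ p * u₁ ^ p) P))
    start : (∃ λ a → C ^ q ≡ u₁ ^ p + 2 * a) → Factors
    start (a , ea) = choose (coprime-odd cab) u-side
      where
      b = u₁ ^ p + a
      opp : Opposite (pred q) p a b
      opp = record { sum = trans (cong (C ^_) q≡) ea ; b≡ = refl }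
      ab : a * b ≡ 4 ^ y' * u ^ suc y' * n ^ k
      ab = cancelˡ {4} (s≤s z≤n) (ℕP.+-cancelˡ-≡ (u₁ ^ p * u₁ ^ p) _ _ (trans (lem (u₁ ^ p) a) (trans (cong (λ z → z * z) (sym ea)) (trans XX (cong (_+_ (u₁ ^ p * u₁ ^ p)) (trans (cong (λ t → (4 * u) ^ t * n ^ k) y≡) (trans (cong (_* n ^ k) (pow-* 4 u (suc y'))) (lem2 (4 ^ y') (u ^ suc y') (n ^ k)))))))))
        where
        lem : ∀ v a → v * v + 4 * (a * (v + a)) ≡ (v + 2 * a) * (v + 2 * a)
        lem = solve-∀
        lem2 : ∀ a b c → 4 * a * b * c ≡ 4 * (a * b * c)
        lem2 = solve-∀
      cabC : Coprime (a * b) C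
      cabC = subst (λ z → Coprime z C) (sym ab) (coprime-*ˡ {4 ^ y' * u ^ suc y'} {n ^ k} {C} (coprime-*ˡ {4 ^ y'} {u ^ suc y'} {C} (coprime-^ˡ {4} {C} y' (c4 {C} oC)) (coprime-^ˡ {u} {C} (suc y') cuC)) (coprime-^ˡ {n} {C} k cnC))
      cab : Coprime a b
      cab = Opposite.coprime-ab opp cabC
      cba : Coprime b a
      cba = coprime-sym {a} {b} cab
      ba : b * a ≡ 4 ^ y' * u ^ suc y' * n ^ k
      ba = trans (ℕP.*-comm b a) ab
      0<ab : 0 < a * b
      0<ab = subst (0 <_) (sym ab) (*-pos (*-pos (pow-pos {4} y' (s≤s z≤n)) (pow-pos {u} (suc y') (Odd-pos {u} ou))) (pow-pos k 0<n))
      a≤X : a ≤ C ^ q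
      a≤X = subst (a ≤_) (trans (Opposite.a+b opp) (cong (C ^_) q≡)) (ℕP.m≤m+n a b)
      b≤X : b ≤ C ^ q
      b≤X = subst (b ≤_) (trans (Opposite.a+b opp) (cong (C ^_) q≡)) (ℕP.m≤n+m b a)
      c4o : ∀ {t} → Odd t → Coprime (4 ^ y') t
      c4o {t} ot = coprime-^ˡ {4} {t} y' (c4 {t} ot)
      u-side : Coprime u a ⊎ Coprime u b
      u-side with u ∣? a
      ... | no u∤a = inj₁ (prime-coprime pu u∤a)
      ... | yes u∣a = inj₂ (prime-coprime pu λ u∣b → contradiction (cab (u∣a , u∣b)) (λ { refl → contradiction (prime->1 pu) (λ { (s≤s ()) }) }))
      choose : Odd a ⊎ Odd b → Coprime u a ⊎ Coprime u b → Factors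
      choose (inj₂ ob) (inj₁ ca) = result (ordered cab ab (even-part {a} {b} (4 ^ y') cab ab 4∣ (c4o ob)) (even-part {b} {a} (u ^ suc y') cba ba u∣ (coprime-^ˡ {u} {a} (suc y') ca)))
        where result : Ordered a b → Factors
              result (n₁ , n₂ , e₁ , e₂ , e , c) = record { n₁ = n₁ ; n₂ = n₂ ; a = a ; b = b ; n₁n₂ = e ; cop = c ; opp = opp ; MV = inj₁ (e₁ , e₂) }
      choose (inj₁ oa) (inj₂ cb) = result (ordered cba ba (even-part {b} {a} (4 ^ y') cba ba 4∣ (c4o oa)) (even-part {a} {b} (u ^ suc y') cab ab u∣ (coprime-^ˡ {u} {b} (suc y') cb)))
        where result : Ordered b a → Factors
              result (n₁ , n₂ , e₁ , e₂ , e , c) = record { n₁ = n₁ ; n₂ = n₂ ; a = a ; b = b ; n₁n₂ = e ; cop = c ; opp = opp ; MV = inj₂ (e₁ , e₂) }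
      -- The power of 4 and the power of `u` would divide the same factor, here `a` and in the last
      -- clause `b`; size forbids it.
      choose (inj₂ ob) (inj₂ cb) = ⊥-elim (too-big a≤X (pos-*ˡ 0<ab) (coprime-lcm {4 ^ y'} {u ^ suc y'} c4u (even-part {a} {b} (4 ^ y') cab ab 4∣ (c4o ob)) (even-part {a} {b} (u ^ suc y') cab ab u∣ (coprime-^ˡ {u} {b} (suc y') cb))))
      choose (inj₁ oa) (inj₁ ca) = ⊥-elim (too-big b≤X (pos-*ʳ a 0<ab) (coprime-lcm {4 ^ y'} {u ^ suc y'} c4u (even-part {b} {a} (4 ^ y') cba ba 4∣ (c4o oa)) (even-part {b} {a} (u ^ suc y') cba ba u∣ (coprime-^ˡ {u} {a} (suc y') ca))))

  module Split (F : Factors) where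
    open Factors F

    M V : ℕ
    M = 4 ^ y' * n₁ ^ k
    V = u ^ suc y' * n₂ ^ k

    8∣4^ : ∀ t → 2 ≤ t → 8 ∣ 4 ^ t
    8∣4^ (suc (suc t)) _ = subst (8 ∣_) (lem (4 ^ t)) (m∣m*n (2 * 4 ^ t))
      where lem : ∀ a → 8 * (2 * a) ≡ 4 * (4 * a)
            lem = solve-∀
    8∣4^ (suc zero) (s≤s ())

    8∣M : 8 ∣ M
    8∣M = ∣m⇒∣m*n (n₁ ^ k) (8∣4^ y' (ℕP.≤-trans (s≤s (s≤s z≤n)) 4≤y'))

    n₁∣n : n₁ ∣ n
    n₁∣n = divides n₂ (trans (sym n₁n₂) (ℕP.*-comm n₁ n₂))

    n₂∣n : n₂ ∣ n
    n₂∣n = divides n₁ (sym n₁n₂)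

    on₁ : Odd n₁
    on₁ = proj₁ (J-∣n n₁∣n)

    on₂ : Odd n₂
    on₂ = proj₁ (J-∣n n₂∣n)

    oV : Odd V
    oV = Odd-* {u ^ suc y'} {n₂ ^ k} (Odd-^ {u} (suc y') ou) (Odd-^ {n₂} k on₂)

    U = u₁ ^ p

    χU : χ₈ U ≡ χ₈ V × χ₈ U ≡ -1ℤ ℤ.* J (+ V) C
    χU = go MV
      where
      go : (a ≡ M × b ≡ V) ⊎ (b ≡ M × a ≡ V) → χ₈ U ≡ χ₈ V × χ₈ U ≡ -1ℤ ℤ.* J (+ V) C
      go (inj₁ (ea , eb)) = Opposite.χ-opposite opp (inj₂ (sym eb , subst (8 ∣_) (sym ea) 8∣M))
      go (inj₂ (eb , ea)) = Opposite.χ-opposite opp (inj₁ (sym ea , subst Odd (sym ea) oV , subst (8 ∣_) (sym eb) 8∣M))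

    V~ : SquareClass C V (n₂ ^ k)
    V~ = sqc-1-times (sqc-u^ (suc y'))

    X%8 : (C ^ q) % 8 ≡ V % 8
    X%8 = trans (cong (_% 8) (trans (sym (cong (C ^_) q≡)) (trans (sym (Opposite.a+b opp)) (sumMV MV)))) (%-remove-+ˡ V 8∣M)
      where
      sumMV : (a ≡ M × b ≡ V) ⊎ (b ≡ M × a ≡ V) → a + b ≡ M + V
      sumMV (inj₁ (ea , eb)) = cong₂ _+_ ea eb
      sumMV (inj₂ (eb , ea)) = trans (ℕP.+-comm a b) (cong₂ _+_ eb ea)

    -- For even `k` also `y` is even, and `V` is a square. Then the two values of `χ₈ U` in `χU` are
    -- 1 and -1.
    y-not-even : ∀ l → k ≡ 2 * l → ⊥
    y-not-even l ek = contradiction (trans (sym χV) (trans (sym (proj₁ χU)) (trans (proj₂ χU) (cong (-1ℤ ℤ.*_) JV)))) λ ()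
      where
      ey : suc y' ≡ 2 * (q + l)
      ey = trans (sym y≡) (trans (cong₂ _+_ ez ek) (sym (ℕP.*-distribˡ-+ 2 q l)))
      χV : χ₈ V ≡ 1ℤ
      χV = χ₈-mod8 {V} {1} (trans (cong₂ (λ s t → (u ^ s * n₂ ^ t) % 8) ey ek) (mod8-cong-* {u ^ (2 * (q + l))} {n₂ ^ (2 * l)} {1} {1} (even-pow-mod8 {u} (q + l) ou) (even-pow-mod8 {n₂} l on₂)))
      JV : J (+ V) C ≡ 1ℤ
      JV = trans (J-sqc {C} oC (sqc-trans V~ (sqc-trans (sqc-≡ (cong (n₂ ^_) ek)) (sqc-even-pow n₂ l (coprime-∣ˡ {n} {n₂} {C} cnC n₂∣n))))) (J-one C)

    k-odd : ∃ λ l → k ≡ odd l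
    k-odd with halves k
    ... | l , inj₂ e = l , e
    ... | l , inj₁ e = ⊥-elim (y-not-even l e)

    y-odd : ∃ λ l → suc y' ≡ odd l
    y-odd = q + proj₁ k-odd , trans (sym y≡) (trans (cong₂ _+_ ez (proj₂ k-odd)) (lem q (proj₁ k-odd)))
      where lem : ∀ q l → 2 * q + suc (2 * l) ≡ suc (2 * (q + l))
            lem = solve-∀

    pow-k : ∀ {m t} → Coprime t m → SquareClass m (t ^ k) t
    pow-k {m} {t} c = sqc-trans (sqc-≡ (cong (t ^_) (proj₂ k-odd))) (sqc-odd-pow t (proj₁ k-odd) c)

    pow-k-mod8 : ∀ {t} → Odd t → (t ^ k) % 8 ≡ t % 8
    pow-k-mod8 {t} ot = trans (cong (λ l → (t ^ l) % 8) (proj₂ k-odd)) (odd-pow-mod8 {t} (proj₁ k-odd) ot)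

    cn₁ : ∀ {m} → Coprime n m → Coprime n₁ m
    cn₁ {m} c = coprime-∣ˡ {n} {n₁} {m} c n₁∣n

    cn₂ : ∀ {m} → Coprime n m → Coprime n₂ m
    cn₂ {m} c = coprime-∣ˡ {n} {n₂} {m} c n₂∣n

    M~ : ∀ {m} → Odd m → Coprime n m → SquareClass m M n₁
    M~ {m} om c = sqc-trans (sqc-1-times (sqc-trans (sqc-≡ (trans (ℕP.^-*-assoc 2 2 y') refl)) (sqc-even-pow 2 y' (coprime-2 {m} om)))) (pow-k {m} {n₁} (cn₁ c))

    -- Modulo `C` the factors `M` and `V` are opposite, hence of one class; with `u` and 4 squares
    -- and `k` odd they reduce to `n₁` and `n₂`.
    n₁~n₂ : SquareClass C n₁ n₂
    n₁~n₂ = sqc-trans (sqc-sym (M~ oC cnC)) (sqc-trans (M~V MV) (sqc-trans V~ (pow-k (cn₂ cnC))))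
      where
      M~V : (a ≡ M × b ≡ V) ⊎ (b ≡ M × a ≡ V) → SquareClass C M V
      M~V (inj₁ (ea , eb)) = subst₂ (SquareClass C) ea eb (Opposite.a~b opp)
      M~V (inj₂ (eb , ea)) = sqc-sym (subst₂ (SquareClass C) ea eb (Opposite.a~b opp))

    n~1 : SquareClass C n 1
    n~1 = sqc-trans (sqc-≡ (sym n₁n₂)) (sqc-trans (sqc-* n₁~n₂ sqc-refl) (sqc-square n₂ (cn₂ cnC)))

    -- Modulo `u₁` the factors are congruent, as `b - a` is a power of `u₁`. So `n₁` has the class
    -- of `u n₂`, and `n` that of `u n₂²`.
    n~u : SquareClass u₁ n u
    n~u = sqc-trans (sqc-≡ (sym n₁n₂)) (sqc-trans (sqc-* (sqc-trans (sqc-sym (M~ ou₁ cnu₁)) (sqc-trans (M~V MV) (sqc-* u^~u (pow-k (cn₂ cnu₁))))) (sqc-refl {u₁} {n₂})) (sqc-trans (sqc-≡ (ℕP.*-assoc u n₂ n₂)) (sqc-times-1 (sqc-square n₂ (cn₂ cnu₁)))))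
      where
      u^~u : SquareClass u₁ (u ^ suc y') u
      u^~u = sqc-trans (sqc-≡ (cong (u ^_) (proj₂ y-odd))) (sqc-odd-pow u (proj₁ y-odd) cuu₁)
      u₁∣U : u₁ ∣ U
      u₁∣U = go p 0<p
        where go : ∀ p → 0 < p → u₁ ∣ u₁ ^ p
              go (suc p) _ = m∣m*n (u₁ ^ p)
      b~a : SquareClass u₁ b a
      b~a = sqc-cong (nat-by {u₁} {b} {a} (quotient u₁∣U) (trans (Opposite.b≡ opp) (trans (ℕP.+-comm U a) (cong (_+_ a) (m∣n⇒n≡quotient*m u₁∣U)))))
      M~V : (a ≡ M × b ≡ V) ⊎ (b ≡ M × a ≡ V) → SquareClass u₁ M V
      M~V (inj₁ (ea , eb)) = sqc-sym (subst₂ (SquareClass u₁) eb ea b~a)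
      M~V (inj₂ (eb , ea)) = subst₂ (SquareClass u₁) eb ea b~a

    χn : χ₈ n ≡ 1ℤ
    χn = trans (sym (proj₂ (J-∣n ∣-refl))) (trans (J-sqc {C} oC n~1) (J-one C))

    χn₁≡χn₂ : χ₈ n₁ ≡ χ₈ n₂
    χn₁≡χn₂ = trans (sym (proj₂ (J-∣n n₁∣n))) (trans (J-sqc {C} oC n₁~n₂) (proj₂ (J-∣n n₂∣n)))

    χU≡-χn₁ : χ₈ U ≡ -1ℤ ℤ.* χ₈ n₁
    χU≡-χn₁ = trans (proj₂ χU) (cong (-1ℤ ℤ.*_) (trans (J-sqc {C} oC (sqc-trans V~ (pow-k (cn₂ cnC)))) (trans (proj₂ (J-∣n n₂∣n)) (sym χn₁≡χn₂))))

    V%8 : V % 8 ≡ (u * n₂) % 8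
    V%8 = mod8-cong-* {u ^ suc y'} {n₂ ^ k} {u} {n₂} (trans (cong (λ t → (u ^ t) % 8) (proj₂ y-odd)) (odd-pow-mod8 {u} (proj₁ y-odd) ou)) (pow-k-mod8 {n₂} on₂)

    -- `χ₈ V` equals `χ₈ u χ₈ n₂` because `y` and `k` are odd, and it equals `-χ₈ n₂` through `U`.
    χu : χ₈ u ≡ -1ℤ
    χu = trans (sym (trans (cong (χ₈ u ℤ.*_) (χ₈-unit {n₂} on₂)) (ℤP.*-identityʳ (χ₈ u)))) (trans (sym (ℤP.*-assoc (χ₈ u) (χ₈ n₂) (χ₈ n₂)))
         (trans (cong (ℤ._* χ₈ n₂) (trans (sym (χ₈-* {u} {n₂} ou on₂)) (trans (sym (χ₈-mod8 {V} {u * n₂} V%8)) (trans (sym (proj₁ χU)) (trans χU≡-χn₁ (cong (-1ℤ ℤ.*_) χn₁≡χn₂))))))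
         (trans (ℤP.*-assoc -1ℤ (χ₈ n₂) (χ₈ n₂)) (cong (-1ℤ ℤ.*_) (χ₈-unit {n₂} on₂)))))

    χ-square : ∀ {m} r → Odd m → m ≡ r * r → χ₈ m ≡ 1ℤ
    χ-square {m} r om refl = χ₈-mod8 {r * r} {1} (odd-sq-mod8 {r} (Odd-*ˡ {r} {r} om))

    n₁-square : ∀ {r} → n ≡ r * r → χ₈ n₁ ≡ 1ℤ
    n₁-square {r} e with coprime-square-factor {n₁} {n₂} {r} (pos-*ˡ (subst (0 <_) e 0<n)) cop (trans n₁n₂ e)
    ... | s , es = χ-square s on₁ es

    n₂-square : ∀ {r} → n ≡ r * r → n₂ % 8 ≡ 1
    n₂-square {r} e with coprime-square-factor {n₂} {n₁} {r} (pos-*ˡ (subst (0 <_) e 0<n)) (coprime-sym {n₁} {n₂} cop) (trans (ℕP.*-comm n₂ n₁) (trans n₁n₂ e))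
    ... | s , refl = odd-sq-mod8 {s} (Odd-*ˡ {s} {s} on₂)

    -- `U` is then a square, so `χ₈ U = 1`.
    p-even : ∀ {p'} → p ≡ 2 * p' → χ₈ n₁ ≡ -1ℤ
    p-even {p'} ep = trans (sym (ℤP.neg-involutive (χ₈ n₁))) (cong ℤ.-_ (trans (sym (ℤP.-1*i≡-i (χ₈ n₁))) (trans (sym χU≡-χn₁) (χ-square (u₁ ^ p') (Odd-^ {u₁} p ou₁) (trans (cong (u₁ ^_) ep) (pow-2* u₁ p'))))))

    -- If `n` is a square, so is `n₂`, and `C ^ q ≡ u n₂ ≡ 3` modulo 8. Powers of `C` are only 1 or
    -- 5.
    u-not-3-or-n-not-square : u % 8 ≡ 3 → ∀ r → n ≡ r * r → ⊥
    u-not-3-or-n-not-square u3 r e = absurd (halves q)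
      where
      X3 : (C ^ q) % 8 ≡ 3
      X3 = trans X%8 (trans V%8 (trans (mod8-cong-* {u} {n₂} {3} {1} u3 (n₂-square {r} e)) refl))
      absurd : (∃ λ t → q ≡ 2 * t ⊎ q ≡ odd t) → ⊥
      absurd (t , inj₁ eq) = contradiction (trans (sym X3) (trans (cong (λ z → (C ^ z) % 8) eq) (even-pow-mod8 {C} t oC))) λ ()
      absurd (t , inj₂ eq) = contradiction (trans (sym X3) (trans (cong (λ z → (C ^ z) % 8) eq) (trans (odd-pow-mod8 {C} t oC) C5))) λ ()

    pow-split : ∀ t c e m → t ^ (2 ^ (c + e) * m) ≡ ((t ^ m) ^ (2 ^ e)) ^ (2 ^ c)
    pow-split t c e m = trans (cong (t ^_) (trans (cong (_* m) (ℕP.^-distribˡ-+-* 2 c e)) (lem (2 ^ c) (2 ^ e) m))) (sym (trans (ℕP.^-*-assoc (t ^ m) (2 ^ e) (2 ^ c)) (ℕP.^-*-assoc t m (2 ^ e * 2 ^ c))))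
      where lem : ∀ a b m → a * b * m ≡ m * (b * a)
            lem = solve-∀

    -- With `ν₂(x) > ν₂(d)` the relation `n ^ d ≡ u₂ ^ x` makes `n` a square, hence also `n₁`, and
    -- `χ₈ n₁ = 1`. But `4 ∣ x`, so `p-even` gives -1.
    ν-small : ∀ a s i j → x ≡ 2 ^ (suc a + suc s) * odd i → d ≡ 2 ^ suc a * odd j → ⊥
    ν-small a s i j ei ej = use (odd-power-square {n} {(u₂ ^ odd i) ^ (2 ^ s)} j 0<n n-pow)
      where
      n-pow : n ^ odd j ≡ (u₂ ^ odd i) ^ (2 ^ s) * (u₂ ^ odd i) ^ (2 ^ s)
      n-pow = trans (pow-injective {n ^ odd j} {(u₂ ^ odd i) ^ (2 ^ suc s)} {2 ^ suc a} (ℕP.m^n>0 2 (suc a)) (trans (ℕP.^-*-assoc n (odd j) (2 ^ suc a)) (trans (cong (n ^_) (trans (ℕP.*-comm (odd j) (2 ^ suc a)) (sym ej))) (trans en (trans (cong (u₂ ^_) ei) (pow-split u₂ (suc a) (suc s) (odd i))))))) (pow-2* (u₂ ^ odd i) (2 ^ s))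
      lem : ∀ a m → 2 * (2 * a) * m ≡ 2 * (2 * (a * m))
      lem = solve-∀
      ep : p ≡ 2 * (2 ^ (a + s) * odd i)
      ep = cancelˡ {2} (s≤s z≤n) (trans (sym ex) (trans ei (trans (cong (λ t → 2 ^ suc t * odd i) (ℕP.+-suc a s)) (lem (2 ^ (a + s)) (odd i)))))
      use : (∃ λ v → n ≡ v * v × (u₂ ^ odd i) ^ (2 ^ s) ≡ v ^ odd j) → ⊥
      use (v , en' , _) = contradiction (trans (sym (n₁-square {v} en')) (p-even {2 ^ (a + s) * odd i} ep)) λ ()

    -- Half of each exponent is even again, so `C ^ q - u₁ ^ p` is itself a difference of squares
    -- and yields another opposite pair, with product `E2 * n₁ ^ k`. Its odd member has symbol 1 by
    -- both readings in `χ-opposite`, which differ by a sign.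
    second-split : ∀ p' q'' → p ≡ 2 * p' → q ≡ 2 * (2 * q'') → ⊥
    second-split p' q'' ep eq'' = start MV
      where
      q' = 2 * q''
      A = C ^ q'
      B = u₁ ^ p'
      oB : Odd B
      oB = Odd-^ {u₁} p' ou₁
      oA : Odd A
      oA = Odd-^ {C} q' oC
      A%8 : A % 8 ≡ 1
      A%8 = even-pow-mod8 {C} q'' oC
      U≡ : U ≡ B * B
      U≡ = trans (cong (u₁ ^_) ep) (pow-2* u₁ p')
      X≡ : C ^ q ≡ A * A
      X≡ = trans (cong (C ^_) eq'') (pow-2* C q')
      U%8 : U % 8 ≡ 1
      U%8 = trans (cong (_% 8) U≡) (odd-sq-mod8 {B} oB)
      V1 : V % 8 ≡ 1
      V1 = trans (sym X%8) (trans (cong (_% 8) X≡) (odd-sq-mod8 {A} oA))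
      start : (a ≡ M × b ≡ V) ⊎ (b ≡ M × a ≡ V) → ⊥
      -- If `b` is the even factor, then `M = U + V ≡ 2` modulo 8, against `8 ∣ M`.
      start (inj₂ (eb , ea)) = contradiction (trans (sym (n∣m⇒m%n≡0 M 8 8∣M)) (trans (cong (_% 8) (trans (sym eb) (trans (Opposite.b≡ opp) (cong (_+_ U) ea)))) (trans (%-distribˡ-+ U V 8) (cong₂ (λ s t → (s + t) % 8) U%8 V1)))) λ ()
      start (inj₁ (ea , _)) = go (odd-difference {A} {B} oA oB B≤A)
        where
        AA : A * A ≡ B * B + 2 * M
        AA = trans (sym X≡) (trans (cong (C ^_) (sym q≡)) (trans (Opposite.sum opp) (cong₂ (λ s t → s + 2 * t) U≡ ea)))
        B≤A : B ≤ A
        B≤A = ℕP.≮⇒≥ λ A<B → ℕP.<⇒≱ (ℕP.*-mono-< A<B A<B) (subst (B * B ≤_) (sym AA) (ℕP.m≤m+n (B * B) (2 * M)))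
        y'' = pred y'
        ey' : y' ≡ suc y''
        ey' = sym (ℕP.suc-pred y' {{>-nonZero (ℕP.≤-trans (s≤s z≤n) 4≤y')}})
        0<q' : 0 < q'
        0<q' = pos-*ʳ 2 (subst (0 <_) eq'' (ℕP.≤-<-trans z≤n p<q))
        -- Four times the product of the new pair is `2 M`, which leaves one factor 2 beside the
        -- power of 4.
        E2 = 2 * 4 ^ y''
        8∣E2 : 8 ∣ E2
        8∣E2 = ∣n⇒∣m*n 2 (8∣4^ y'' (ℕP.≤-pred (subst (3 ≤_) ey' (ℕP.≤-trans (s≤s (s≤s (s≤s z≤n))) 4≤y'))))
        go : (∃ λ a₂ → A ≡ B + 2 * a₂) → ⊥
        go (a₂ , eA) = choose (coprime-odd cab)
          where
          b₂ = B + a₂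
          opp₂ : Opposite (pred q') p' a₂ b₂
          opp₂ = record { sum = trans (cong (C ^_) (ℕP.suc-pred q' {{>-nonZero 0<q'}})) eA ; b≡ = refl }
          ab : a₂ * b₂ ≡ E2 * n₁ ^ k
          ab = cancelˡ {4} (s≤s z≤n) (ℕP.+-cancelˡ-≡ (B * B) _ _ (trans (lem B a₂) (trans (cong (λ z → z * z) (sym eA)) (trans AA (cong (_+_ (B * B)) (trans (cong (λ t → 2 * (4 ^ t * n₁ ^ k)) ey') (lem2 (4 ^ y'') (n₁ ^ k))))))))
            where
            lem : ∀ v a → v * v + 4 * (a * (v + a)) ≡ (v + 2 * a) * (v + 2 * a)
            lem = solve-∀
            lem2 : ∀ a b → 2 * (4 * a * b) ≡ 4 * (2 * a * b)
            lem2 = solve-∀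
          cab : Coprime a₂ b₂
          cab = Opposite.coprime-ab opp₂ (subst (λ z → Coprime z C) (sym ab) (coprime-*ˡ {E2} {n₁ ^ k} {C} (coprime-*ˡ {2} {4 ^ y''} {C} c2C (coprime-^ˡ {4} {C} y'' (c4 {C} oC))) (coprime-^ˡ {n₁} {C} k (cn₁ cnC))))
          -- the odd factor o is a k-th power, and o ≡ C ^ q' ≡ 1 (mod 8)
          odd-factor : ∀ {o e} → Odd o → Coprime o e → o * e ≡ E2 * n₁ ^ k → o + e ≡ A → 8 ∣ e × χ₈ o ≡ 1ℤ × J (+ o) C ≡ 1ℤ
          odd-factor {o} {e} oo coe oe sm = finish (coprime-divisor {E2} {o} {e} (coprime-*ˡ {2} {4 ^ y''} {o} (coprime-2 {o} oo) (coprime-^ˡ {4} {o} y'' (c4 {o} oo))) (subst (E2 ∣_) (sym oe) (m∣m*n (n₁ ^ k))))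
            where
            finish : E2 ∣ e → 8 ∣ e × χ₈ o ≡ 1ℤ × J (+ o) C ≡ 1ℤ
            finish (divides m em) = 8∣e , χo , Jo (coprime-power-split {o} {m} {n₁} {k} 0<k (Odd-pos {n₁} on₁) (λ {f} (s , t) → coe (s , subst (f ∣_) (sym em) (∣m⇒∣m*n E2 t))) om)
              where
              8∣e : 8 ∣ e
              8∣e = subst (8 ∣_) (sym em) (∣n⇒∣m*n m 8∣E2)
              o%8 : o % 8 ≡ 1
              o%8 = trans (sym (%-remove-+ʳ o 8∣e)) (trans (cong (_% 8) sm) A%8)
              χo : χ₈ o ≡ 1ℤ
              χo = cong χ o%8
              om : o * m ≡ n₁ ^ k
              om = cancelˡ {E2} (*-pos {2} (s≤s z≤n) (pow-pos {4} y'' (s≤s z≤n))) (trans (lem E2 o m) (trans (cong (o *_) (sym em)) oe))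
                where lem : ∀ e o m → e * (o * m) ≡ o * (m * e)
                      lem = solve-∀
              Jo : (∃ λ r → ∃ λ t → o ≡ r ^ k × m ≡ t ^ k × r * t ≡ n₁) → J (+ o) C ≡ 1ℤ
              Jo (r , t , er , _ , ert) = trans (cong (λ z → J (+ z) C) er) (trans (J-sqc {C} oC (pow-k (coprime-∣ˡ {n} {r} {C} cnC r∣n))) (trans (proj₂ (J-∣n r∣n)) (trans (sym (χ₈-mod8 {o} {r} (trans (cong (_% 8) er) (pow-k-mod8 {r} (proj₁ (J-∣n r∣n)))))) χo)))
                where r∣n : r ∣ n
                      r∣n = ∣-trans (divides t (trans (sym ert) (ℕP.*-comm r t))) n₁∣n
          clash : ∀ {o} → χ₈ B ≡ χ₈ o × χ₈ B ≡ -1ℤ ℤ.* J (+ o) C → χ₈ o ≡ 1ℤ → J (+ o) C ≡ 1ℤ → ⊥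
          clash (e₁ , e₂) c j = contradiction (trans (sym (trans e₁ c)) (trans e₂ (cong (-1ℤ ℤ.*_) j))) λ ()
          sum₂ : a₂ + b₂ ≡ A
          sum₂ = trans (Opposite.a+b opp₂) (cong (C ^_) (ℕP.suc-pred q' {{>-nonZero 0<q'}}))
          choose : Odd a₂ ⊎ Odd b₂ → ⊥
          choose (inj₁ oa) = use (odd-factor {a₂} {b₂} oa cab ab sum₂)
            where use : 8 ∣ b₂ × χ₈ a₂ ≡ 1ℤ × J (+ a₂) C ≡ 1ℤ → ⊥
                  use (8∣b , χo , Jo) = clash {a₂} (Opposite.χ-opposite opp₂ (inj₁ (refl , oa , 8∣b))) χo Jo
          choose (inj₂ ob) = use (odd-factor {b₂} {a₂} ob (coprime-sym {a₂} {b₂} cab) (trans (ℕP.*-comm b₂ a₂) ab) (trans (ℕP.+-comm b₂ a₂) sum₂))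
            where use : 8 ∣ a₂ × χ₈ b₂ ≡ 1ℤ × J (+ b₂) C ≡ 1ℤ → ⊥
                  use (8∣a , χo , Jo) = clash {b₂} (Opposite.χ-opposite opp₂ (inj₂ (refl , 8∣a))) χo Jo

    -- Equal valuations give `n ^ odd j ≡ u₂ ^ odd i`, so `χ₈ u₂ = 1` and `χ₈ u₁ = -1`. As `q` is
    -- even, `χ₈ U = 1`, which excludes odd `p`. For even `p` the sum `x + d` gains one more factor
    -- 2, so `4 ∣ q` and `second-split` applies.
    ν-equal : ∀ a i j → x ≡ 2 ^ suc a * odd i → d ≡ 2 ^ suc a * odd j → ⊥
    ν-equal a i j ei ej = go (halves p)
      where
      roots : n ^ odd j ≡ u₂ ^ odd i
      roots = pow-injective {_} {_} {2 ^ suc a} (ℕP.m^n>0 2 (suc a)) (trans (ℕP.^-*-assoc n (odd j) (2 ^ suc a)) (trans (cong (n ^_) (trans (ℕP.*-comm (odd j) (2 ^ suc a)) (sym ej))) (trans en (trans (cong (u₂ ^_) (trans ei (ℕP.*-comm (2 ^ suc a) (odd i)))) (sym (ℕP.^-*-assoc u₂ (odd i) (2 ^ suc a)))))))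
      χu₂ : χ₈ u₂ ≡ 1ℤ
      χu₂ = trans (χ₈-mod8 {u₂} {n} (trans (sym (odd-pow-mod8 {u₂} i ou₂)) (trans (cong (_% 8) (sym roots)) (odd-pow-mod8 {n} j on)))) χn
      χu₁ : χ₈ u₁ ≡ -1ℤ
      χu₁ = trans (sym (trans (cong (χ₈ u₁ ℤ.*_) χu₂) (ℤP.*-identityʳ (χ₈ u₁)))) (trans (sym (χ₈-* {u₁} {u₂} ou₁ ou₂)) (cong χ u₁u₂≡5))
      eq' : q ≡ 2 * (2 ^ a * suc (i + j))
      eq' = cancelˡ {2} (s≤s z≤n) (trans (sym ez) (trans (cong₂ _+_ ei ej) (lem (2 ^ a) i j)))
        where lem : ∀ a i j → 2 * a * suc (2 * i) + 2 * a * suc (2 * j) ≡ 2 * (2 * (a * suc (i + j)))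
              lem = solve-∀
      χU1 : χ₈ U ≡ 1ℤ
      χU1 = trans (proj₁ χU) (χ₈-mod8 {V} {1} (trans (sym X%8) (trans (cong (λ t → (C ^ t) % 8) eq') (even-pow-mod8 {C} (2 ^ a * suc (i + j)) oC))))
      ep : p ≡ 2 ^ a * odd i
      ep = cancelˡ {2} (s≤s z≤n) (trans (sym ex) (trans ei (ℕP.*-assoc 2 (2 ^ a) (odd i))))
      go : (∃ λ t → p ≡ 2 * t ⊎ p ≡ odd t) → ⊥
      go (t , inj₂ e) = contradiction (trans (sym χU1) (trans (χ₈-mod8 {U} {u₁} (trans (cong (λ r → (u₁ ^ r) % 8) e) (odd-pow-mod8 {u₁} t ou₁))) χu₁)) λ ()
      go (t , inj₁ e) = at a ep eq'
        where
        at : ∀ a → p ≡ 2 ^ a * odd i → q ≡ 2 * (2 ^ a * suc (i + j)) → ⊥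
        at zero ep _ = even-∤odd t i e (trans ep (ℕP.*-identityˡ (odd i)))
        at (suc a) _ eq' = second-split t (2 ^ a * suc (i + j)) e (trans eq' (cong (2 *_) (ℕP.*-assoc 2 (2 ^ a) (suc (i + j)))))

    Conclusion : Set
    Conclusion = u₁ % 8 ≡ 5 × (∃[ a ] ∃[ c ] ∃[ w ] (V₂ d a × V₂ x c × c ≤ a × 0 < w × u₂ ≡ w ^ (2 ^ (a ∸ c)) × EvenExponent₂ u C x (x + d + k) (x + d) u₁ w))

    -- The surviving case. `u₂` is a proper power of 2-power exponent, so `u₂ ≡ 1` and `u₁ ≡ 5`
    -- modulo 8; `x + d` keeps the valuation of `x`. A square `w` would make `n` a square.
    ν-large : ∀ b s i j → x ≡ 2 ^ suc b * odd i → d ≡ 2 ^ (suc b + suc s) * odd j →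
      Conclusion
    ν-large b s i j ei ej = go (root-2^s (suc s) {u₂} {n ^ odd j} i (Odd-pos {u₂} ou₂) roots)
      where
      roots : u₂ ^ odd i ≡ (n ^ odd j) ^ (2 ^ suc s)
      roots = sym (pow-injective {_} {_} {2 ^ suc b} (ℕP.m^n>0 2 (suc b)) (trans (sym (pow-split n (suc b) (suc s) (odd j))) (trans (cong (n ^_) (sym ej)) (trans en (trans (cong (u₂ ^_) (trans ei (ℕP.*-comm (2 ^ suc b) (odd i)))) (sym (ℕP.^-*-assoc u₂ (odd i) (2 ^ suc b))))))))
      go : (∃ λ w → u₂ ≡ w ^ (2 ^ suc s) × w ^ odd i ≡ n ^ odd j) → Conclusion
      go (w , eu₂ , ew) = u₁5 , suc b + suc s , suc b , w , V₂-of {d} {suc b + suc s} j ej , V₂-of {x} {suc b} i ei , ℕP.m≤m+n (suc b) (suc s) , Odd-pos {w} ow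
          , trans eu₂ (cong (λ t → w ^ (2 ^ t)) (sym (ℕP.m+n∸m≡n (suc b) (suc s))))
          , χ₈-plus {w} ow χw , (suc b , s≤s z≤n , V₂-of {x} {suc b} i ei , V₂-of {x + d} {suc b} (i + 2 ^ s * odd j) ez') , trans (cong (_% 2) (trans y≡ (proj₂ y-odd))) (odd-Odd (proj₁ y-odd)) , χ₈-minus {u} ou χu
          , (λ r pr r∣C → trans (legendre-sqc (prime-pos pr) (sqc-∣ r∣C (sqc-trans (root-sqc i j ew cnC) n~1))) (legendre-one (prime->1 pr)))
          , (λ r pr r∣u₁ → legendre-sqc (prime-pos pr) (sqc-∣ r∣u₁ (sqc-trans (root-sqc i j ew cnu₁) n~u)))
          , not-square
        where
        ow : Odd w
        ow = Odd-root {w} (odd i) (s≤s z≤n) (subst Odd (sym ew) (Odd-^ {n} (odd j) on))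
        χw : χ₈ w ≡ 1ℤ
        χw = trans (χ₈-mod8 {w} {n} (trans (sym (odd-pow-mod8 {w} i ow)) (trans (cong (_% 8) ew) (odd-pow-mod8 {n} j on)))) χn
        u₂1 : u₂ % 8 ≡ 1
        u₂1 = trans (cong (_% 8) eu₂) (even-pow-mod8 {w} (2 ^ s) ow)
        u₁5 : u₁ % 8 ≡ 5
        u₁5 = trans (cong (_% 8) (sym (ℕP.*-identityʳ u₁))) (trans (mod8-cong-* {u₁} {1} {u₁} {u₂} refl (sym u₂1)) u₁u₂≡5)
        ez' : x + d ≡ 2 ^ suc b * odd (i + 2 ^ s * odd j)
        ez' = trans (cong₂ _+_ ei (trans ej (cong (_* odd j) (ℕP.^-distribˡ-+-* 2 (suc b) (suc s))))) (lem (2 ^ suc b) (2 ^ s) i j)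
          where lem : ∀ b s i j → b * suc (2 * i) + b * (2 * s) * suc (2 * j) ≡ b * suc (2 * (i + s * suc (2 * j)))
                lem = solve-∀
        not-square : u % 8 ≡ 3 → ¬ (∃[ h ] (w ≡ h * h))
        not-square u3 (h , eh) = use (odd-power-square {n} {h ^ odd i} j 0<n (trans (sym ew) (trans (cong (_^ odd i) eh) (pow-* h h (odd i)))))
          where use : (∃ λ v → n ≡ v * v × h ^ odd i ≡ v ^ odd j) → ⊥
                use (v , en' , _) = u-not-3-or-n-not-square u3 v en'

    by-valuations : ∀ b i a j → x ≡ 2 ^ b * odd i → d ≡ 2 ^ a * odd j → Conclusion
    by-valuations zero i a j ei ej = ⊥-elim (even-∤odd p i ex (trans ei (ℕP.*-identityˡ (odd i))))
    by-valuations (suc b) i zero j ei ej = ⊥-elim (even-∤odd q (p + j) ez (trans (cong₂ _+_ ex (trans ej (ℕP.*-identityˡ (odd j)))) (lem p j)))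
      where lem : ∀ i j → 2 * i + suc (2 * j) ≡ suc (2 * (i + j))
            lem = solve-∀
    by-valuations (suc b) i (suc a) j ei ej = by-order (ℕP.<-cmp a b)
      where
      below : (∃ λ s → suc a + s ≡ b) → Conclusion
      below (s , e) = ⊥-elim (ν-small a s i j (trans ei (cong (λ t → 2 ^ t * odd i) (cong suc (trans (sym e) (sym (ℕP.+-suc a s)))))) ej)
      above : (∃ λ s → suc b + s ≡ a) → Conclusion
      above (s , e) = ν-large b s i j ei (trans ej (cong (λ t → 2 ^ t * odd j) (cong suc (trans (sym e) (sym (ℕP.+-suc b s))))))
      by-order : Tri (a < b) (a ≡ b) (b < a) → Conclusion
      by-order (tri< a<b _ _) = below (ℕP.m≤n⇒∃[o]m+o≡n a<b)
      by-order (tri≈ _ a≡b _) = ⊥-elim (ν-equal a i j (trans ei (cong (λ t → 2 ^ suc t * odd i) (sym a≡b))) ej)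
      by-order (tri> _ _ b<a) = above (ℕP.m≤n⇒∃[o]m+o≡n b<a)

    conclusion : Conclusion
    conclusion = start (two-adic x 0<x) (two-adic d 0<d)
      where
      start : (∃ λ b → ∃ λ i → x ≡ 2 ^ b * odd i) → (∃ λ a → ∃ λ j → d ≡ 2 ^ a * odd j) → Conclusion
      start (b , i , ei) (a , j , ej) = by-valuations b i a j ei ej

-- Assembly by the parities of `x` and `z`

Conclusion : (u C x y z d k n u₁ u₂ : ℕ) → Set
Conclusion u C x y z d k n u₁ u₂ =
  ( V₂ (u₁ ∸ 1) 3
    × x % 2 ≡ 1 × (∃[ k ] (2 ≤ k × V₂ y k)) × V₂ z 1
    × (∃[ t₁ ] ∃[ t₂ ] (1 < t₁ × 1 < t₂ × Coprime t₁ t₂ × t₁ * t₂ ≡ u₁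
        × t₁ % 8 ≡ 5 × t₂ % 8 ≡ 5
        × t₂ ^ x + t₁ ^ x ≡ 2 * C ^ (z / 2)
        × t₂ ^ x ∸ t₁ ^ x ≡ 2 ^ (y + 1) * u ^ (y / 2) * n ^ (k / 2))) )
  ⊎ ( u₁ % 8 ≡ 5
    × (∃[ a ] ∃[ b ] ∃[ w ] (V₂ d a × V₂ x b × b ≤ a × 0 < w × u₂ ≡ w ^ (2 ^ (a ∸ b))
        × (OddExponent₂ u C x y z u₁ w ⊎ EvenExponent₂ u C x y z u₁ w))) )

by-parity : ∀ {u C n u₁ u₂ x d k} → Exceptional u C u₁ u₂ n x d k → Conclusion u C x (x + d + k) (x + d) d k n u₁ u₂
by-parity {u} {C} {n} {u₁} {u₂} {x} {d} {k} S = go (halves x) (halves (x + d))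
  where
  from-odd : u₁ % 8 ≡ 5 → (∃[ a ] ∃[ b ] ∃[ w ] (V₂ d a × V₂ x b × b ≤ a × 0 < w × u₂ ≡ w ^ (2 ^ (a ∸ b)) × OddExponent₂ u C x (x + d + k) (x + d) u₁ w)) →
    Conclusion u C x (x + d + k) (x + d) d k n u₁ u₂
  from-odd u₁5 (a , b , w , va , vb , b≤a , 0<w , e , rest) = inj₂ (u₁5 , a , b , w , va , vb , b≤a , 0<w , e , inj₁ rest)
  from-even : u₁ % 8 ≡ 5 × (∃[ a ] ∃[ b ] ∃[ w ] (V₂ d a × V₂ x b × b ≤ a × 0 < w × u₂ ≡ w ^ (2 ^ (a ∸ b)) × EvenExponent₂ u C x (x + d + k) (x + d) u₁ w)) →
    Conclusion u C x (x + d + k) (x + d) d k n u₁ u₂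
  from-even (u₁5 , a , b , w , va , vb , b≤a , 0<w , e , rest) = inj₂ (u₁5 , a , b , w , va , vb , b≤a , 0<w , e , inj₂ rest)
  go : (∃ λ i → x ≡ 2 * i ⊎ x ≡ odd i) → (∃ λ j → x + d ≡ 2 * j ⊎ x + d ≡ odd j) → Conclusion u C x (x + d + k) (x + d) d k n u₁ u₂
  go (i , inj₂ ex) (Z , inj₁ ez) = inj₁ (OddExponent.EvenZ.conclusion S i ex Z ez)
  go (i , inj₂ ex) (l , inj₂ ez) = from-odd (OddExponent.OddZ.u₁5 S i ex l ez) (OddExponent.OddZ.conclusion S i ex l ez)
  go (p , inj₁ ex) (q , inj₁ ez) = from-even (EvenExponent.Split.conclusion S p q ex ez (EvenExponent.factors S p q ex ez))
  -- Modulo 8 an odd power of `C` is 5, while an even power of `u₁` is 1.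
  go (p , inj₁ ex) (l , inj₂ ez) = contradiction (trans (sym (trans (cong (λ t → (C ^ t) % 8) ez) (trans (odd-pow-mod8 {C} l (Facts.oC S)) (Facts.C5 S))))
     (trans (Facts.mod8 S) (trans (cong (λ t → (u₁ ^ t) % 8) ex) (even-pow-mod8 {u₁} p (Facts.ou₁ S))))) λ ()

difference : ∀ {m n} → m < n → ∃ λ d → m + d ≡ n × 0 < d
difference {m} m<n with ℕP.m≤n⇒∃[o]m+o≡n m<n
... | o , e = suc o , trans (ℕP.+-suc m o) e , s≤s z≤n

-- A positive result shows that the subtraction was not truncated.
undo-∸ : ∀ {a b c} → a ∸ b ≡ c → 0 < c → a ≡ c + b
undo-∸ {a} {b} refl 0<c = sym (ℕP.m∸n+n≡m {a} {b} (ℕP.≮⇒≥ λ a<b → ℕP.<⇒≢ 0<c (sym (ℕP.m≤n⇒m∸n≡0 (ℕP.<⇒≤ a<b)))))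

theorem1p4 : ∀ (u x y z n u₁ u₂ : ℕ) →
    Prime u → u % 2 ≡ 1 →
    0 < x → 0 < y → 0 < z → 1 < n →
    ¬ (x ≡ 2 × y ≡ 2 × z ≡ 2) →
    ((u ^ 2 ∸ 4) * n) ^ x + (4 * u * n) ^ y ≡ ((u ^ 2 + 4) * n) ^ z →
    x < z → z < y → Coprime n (u ^ 2 + 4) →
    0 < u₁ → 0 < u₂ → Coprime u₁ u₂ → u₁ * u₂ ≡ u ^ 2 ∸ 4 →
    (u ^ 2 + 4) ^ z ∸ (4 * u) ^ y * n ^ (y ∸ z) ≡ u₁ ^ x →
    n ^ (z ∸ x) ≡ u₂ ^ x →
    ( V₂ (u₁ ∸ 1) 3
    × x % 2 ≡ 1 × (∃[ k ] (2 ≤ k × V₂ y k)) × V₂ z 1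
    × (∃[ t₁ ] ∃[ t₂ ] (1 < t₁ × 1 < t₂ × Coprime t₁ t₂ × t₁ * t₂ ≡ u₁
    × t₁ % 8 ≡ 5 × t₂ % 8 ≡ 5
    × t₂ ^ x + t₁ ^ x ≡ 2 * (u ^ 2 + 4) ^ (z / 2)
    × t₂ ^ x ∸ t₁ ^ x ≡ 2 ^ (y + 1) * u ^ (y / 2) * n ^ ((y ∸ z) / 2))) )
    ⊎
    ( u₁ % 8 ≡ 5
    × (∃[ a ] ∃[ b ] ∃[ w ] (V₂ (z ∸ x) a × V₂ x b × b ≤ a × 0 < w
    × u₂ ≡ w ^ (2 ^ (a ∸ b))
    × (
    ( (w % 8 ≡ 3 ⊎ w % 8 ≡ 5)
    × x % 2 ≡ 1 × z % 2 ≡ 1 × (∃[ k ] (1 ≤ k × V₂ y k))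
    × u % 4 ≡ 1
    × (∀ p → Prime p → p ∣ u ^ 2 + 4 → legendre u₁ p ≡ legendre w p)
    × (∀ p → Prime p → p ∣ u₁ → legendre w p ≡ legendre (u ^ 2 + 4) p) )
    ⊎
    ( (w % 8 ≡ 1 ⊎ w % 8 ≡ 7)
    × (∃[ β ] (1 ≤ β × V₂ x β × V₂ z β)) × y % 2 ≡ 1
    × (u % 8 ≡ 3 ⊎ u % 8 ≡ 5)
    × (∀ p → Prime p → p ∣ u ^ 2 + 4 → legendre w p ≡ 1ℤ)
    × (∀ p → Prime p → p ∣ u₁ → legendre w p ≡ legendre u p)
    × (u % 8 ≡ 3 → ¬ (∃[ k ] (w ≡ k * k))) ) ) )) )
theorem1p4 u x y z n u₁ u₂ pu ou 0<x _ _ _ _ _ x<z z<y cnC 0<u₁ 0<u₂ c12 eu eq en = go (difference x<z) (difference z<y)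
  where
  go : (∃ λ d → x + d ≡ z × 0 < d) → (∃ λ k → z + k ≡ y × 0 < k) → Conclusion u (u ^ 2 + 4) x y z (z ∸ x) (y ∸ z) n u₁ u₂
  go (d , ez , 0<d) (k , ey , 0<k) = subst₂ (λ z y → Conclusion u (u ^ 2 + 4) x y z (z ∸ x) (y ∸ z) n u₁ u₂) ez ey'
      (subst₂ (λ d' k' → Conclusion u (u ^ 2 + 4) x (x + d + k) (x + d) d' k' n u₁ u₂) (sym d≡) (sym k≡) (by-parity S))
    where
    ey' : x + d + k ≡ y
    ey' = trans (cong (_+ k) ez) ey
    d≡ : x + d ∸ x ≡ d
    d≡ = ℕP.m+n∸m≡n x d
    k≡ : x + d + k ∸ (x + d) ≡ k
    k≡ = ℕP.m+n∸m≡n (x + d) k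
    S : Exceptional u (u ^ 2 + 4) u₁ u₂ n x d k
    S = record
      { pu = pu ; ou = ou
      ; eC = cong (λ t → u * t + 4) (ℕP.*-identityʳ u)
      ; eu = trans (cong (_+ 4) (undo-∸ {u ^ 2} {4} {u₁ * u₂} (sym eu) (*-pos 0<u₁ 0<u₂))) (ℕP.+-assoc (u₁ * u₂) 4 4)
      ; cnC = cnC ; c12 = c12 ; 0<x = 0<x ; 0<d = 0<d ; 0<k = 0<k
      ; eq = undo-∸ {(u ^ 2 + 4) ^ (x + d)} {(4 * u) ^ (x + d + k) * n ^ k} {u₁ ^ x}
          (trans (cong (λ t → (u ^ 2 + 4) ^ (x + d) ∸ (4 * u) ^ (x + d + k) * n ^ t) (sym k≡))
            (subst₂ (λ z y → (u ^ 2 + 4) ^ z ∸ (4 * u) ^ y * n ^ (y ∸ z) ≡ u₁ ^ x) (sym ez) (sym ey') eq)) (pow-pos x 0<u₁)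
      ; en = trans (cong (n ^_) (sym d≡)) (subst (λ z → n ^ (z ∸ x) ≡ u₂ ^ x) (sym ez) en)
      }
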